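{- Let $\textup{AC}_m$ denote the class of monotone arithmetic circuits, with the class notation and the succinctness relations $\le, <, \simeq$ defined in the context. Then all of the following hold: (i) $\textup{wD-AC}_m < \textup{D-AC}_m$, $\textup{wD-AC}_m < \textup{swD-AC}_m$ and $\textup{wD-AC}_m < \textup{dwD-AC}_m$; (ii) $\textup{D-AC}_m \simeq \textup{sD-AC}_m \simeq \textup{swD-AC}_m$; (iii) $\textup{D-AC}_m < \textup{dD-AC}_m$, $\textup{sD-AC}_m < \textup{sdD-AC}_m$ and $\textup{swD-AC}_m < \textup{sdwD-AC}_m$; (iv) $\textup{dwD-AC}_m < \textup{dD-AC}_m$ and $\textup{dwD-AC}_m < \textup{sdwD-AC}_m$; (v) $\textup{dD-AC}_m \simeq \textup{sdD-AC}_m \simeq \textup{sdwD-AC}_m$; (vi) $\textup{dwD-AC}_m$ and $\textup{D-AC}_m$ are incomparable, i.e. $\textup{dwD-AC}_m \not\le \textup{D-AC}_m$ and $\textup{D-AC}_m \not\le \textup{dwD-AC}_m$.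
   Context: An arithmetic circuit (AC) is a finite directed acyclic graph with a single source, whose sinks (inputs) are each labeled by a real constant, by a variable $x$ with values in $\{0,1\}$, or by a complemented variable $\overline{x}$ (evaluating to $1-x$), and whose internal nodes each have exactly two successors $g_l,g_r$ and are labeled $+$ or $\times$. The size $|C|$ is the number of nodes. For a node $g$, $\mathit{var}(g)$ is the set of variables $x$ such that $x$ or $\overline{x}$ labels a sink reachable from $g$; $\mathit{var}(C)$ is $\mathit{var}$ of the source. $C$ computes a real-valued function of assignments $\mathit{var}(C)\to\{0,1\}$ by bottom-up evaluation. For a node $g$, $\mathit{supp}(g)$ is the set of assignments to $\mathit{var}(g)$ on which the subcircuit rooted at $g$ evaluates to a nonzero value. A $+$-node $g$ is smooth if $\mathit{var}(g_l)=\mathit{var}(g_r)$, and deterministic if there is no assignment $a$ to $\mathit{var}(g)$ whose restrictions to $\mathit{var}(g_l)$ and $\mathit{var}(g_r)$ lie in $\mathit{supp}(g_l)$ and $\mathit{supp}(g_r)$ respectively. A $\times$-node $g$ is decomposable if $\mathit{var}(g_l)\cap\mathit{var}(g_r)=\emptyset$, and weakly decomposable if every $x\in\mathit{var}(g_l)\cap\mathit{var}(g_r)$ appears with a unique polarity below $g$ (not both $x$ and $\overline{x}$ label sinks reachable from $g$). An AC is smooth (resp. deterministic) if all its $+$-nodes are, and decomposable (resp. weakly decomposable) if all its $\times$-nodes are. An AC is monotone if all its constant inputs are nonnegative. Class names combine prefixes: s = smooth, d = deterministic, D = decomposable, wD = weakly decomposable; e.g. $\textup{sdwD-AC}_m$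 is the class of smooth deterministic weakly decomposable monotone AC. Succinctness: for classes $\mathcal{C}_1,\mathcal{C}_2$, $\mathcal{C}_1\le\mathcal{C}_2$ if there is a polynomial $p$ such that for every $C_2\in\mathcal{C}_2$ there is $C_1\in\mathcal{C}_1$ computing the same function with $|C_1|\le p(|C_2|)$; $\mathcal{C}_1<\mathcal{C}_2$ means $\mathcal{C}_1\le\mathcal{C}_2$ and $\mathcal{C}_2\not\le\mathcal{C}_1$; $\mathcal{C}_1\simeq\mathcal{C}_2$ means both $\mathcal{C}_1\le\mathcal{C}_2$ and $\mathcal{C}_2\le\mathcal{C}_1$. -}

module Defs where

open import Level using (0ℓ)
open import Data.Nat as ℕ using (ℕ; zero; suc)
open import Data.Fin using (Fin; zero; suc)
open import Data.Bool using (Bool; if_then_else_)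
open import Data.List using (List; []; _∷_)
open import Data.Product using (Σ; ∃; _×_; _,_)
open import Data.Sum using (_⊎_)
open import Data.Empty using (⊥)
open import Relation.Nullary using (¬_)
open import Relation.Binary using (Rel)
open import Relation.Binary.Structures using (IsTotalOrder)
open import Relation.Binary.PropositionalEquality using (_≡_; _≢_)
open import Relation.Binary.Construct.Closure.ReflexiveTransitive using (Star)
open import Algebra.Core using (Op₁; Op₂)
open import Algebra.Structures using (IsCommutativeRing)

-- The real numbers, axiomatised as a (Dedekind-/sup-)complete ordered
-- field.  Agda's standard library has no real numbers; the theorem is
-- stated for every model of these axioms (all models are isomorphic).

record RealField : Set₁ where
  infixl 6 _+_
  infixl 7 _*_
  infix 4 _≤_
  field
    Carrier : Set
    _+_ _*_ : Op₂ Carrier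
    -_      : Op₁ Carrier
    0# 1#   : Carrier
    isCommutativeRing : IsCommutativeRing _≡_ _+_ _*_ -_ 0# 1#
    0≢1     : 0# ≢ 1#
    inverse : ∀ x → x ≢ 0# → ∃ λ y → x * y ≡ 1#
    _≤_     : Rel Carrier 0ℓ
    isTotalOrder : IsTotalOrder _≡_ _≤_
    +-mono-≤ : ∀ x y z → x ≤ y → x + z ≤ y + z
    *-nonneg : ∀ x y → 0# ≤ x → 0# ≤ y → 0# ≤ x * y
    complete : (P : Carrier → Set) → ∃ P →
               (∃ λ b → ∀ x → P x → x ≤ b) →
               ∃ λ s → (∀ x → P x → x ≤ s) ×
                       (∀ b → (∀ x → P x → x ≤ b) → s ≤ b)

data Lit : Set where
  pos neg : ℕ → Lit

data Gate (A : Set) (k : ℕ) : Set where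
  const      : A → Gate A k
  lit        : Lit → Gate A k
  plus times : Fin k → Fin k → Gate A k

-- A circuit with k nodes: a list of gates, newest first; node 0 is the
-- most recently added one, and a gate only refers to older nodes, so the
-- graph is acyclic by construction.
data Circ (A : Set) : ℕ → Set where
  []  : Circ A 0
  _∷_ : ∀ {k} → Gate A k → Circ A k → Circ A (suc k)

shift : ∀ {A k} → Gate A k → Gate A (suc k)
shift (const v)    = const v
shift (lit l)      = lit l
shift (plus l r)   = plus (suc l) (suc r)
shift (times l r)  = times (suc l) (suc r)

-- At c i g : node i of c carries gate g (successors as global indices).
data At {A : Set} : ∀ {k} → Circ A k → Fin k → Gate A k → Set where
  here  : ∀ {k} {g : Gate A k} {c} → At (g ∷ c) zero (shift g)
  there : ∀ {k} {h : Gate A k} {c i g} → At c i g → At (h ∷ c) (suc i) (shift g)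

Child : ∀ {A k} → Circ A k → Fin k → Fin k → Set
Child c i j = ∃ λ l → ∃ λ r → (At c i (plus l r) ⊎ At c i (times l r)) × (j ≡ l ⊎ j ≡ r)

Reach : ∀ {A k} → Circ A k → Fin k → Fin k → Set
Reach c = Star (Child c)

Var : ∀ {A k} → Circ A k → Fin k → ℕ → Set
Var c i x = ∃ λ j → Reach c i j × (At c j (lit (pos x)) ⊎ At c j (lit (neg x)))

LitBelow : ∀ {A k} → Circ A k → Fin k → Lit → Set
LitBelow c i ℓ = ∃ λ j → Reach c i j × At c j (lit ℓ)

-- Assignments (total; the value of a node only depends on var of it)
Assignment : Set
Assignment = ℕ → Bool

evalPoly : List ℕ → ℕ → ℕ
evalPoly []       n = 0
evalPoly (c ∷ cs) n = c ℕ.+ n ℕ.* evalPoly cs n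

module Circuits (ℝ : RealField) where
  open RealField ℝ

  evalG : ∀ {k} → Gate Carrier k → Assignment → (Fin k → Carrier) → Carrier
  evalG (const v)       a f = v
  evalG (lit (pos x))   a f = if a x then 1# else 0#
  evalG (lit (neg x))   a f = if a x then 0# else 1#
  evalG (plus l r)      a f = f l + f r
  evalG (times l r)     a f = f l * f r

  val : ∀ {k} → Circ Carrier k → Assignment → Fin k → Carrier
  val (g ∷ c) a zero    = evalG g a (val c a)
  val (g ∷ c) a (suc j) = val c a j

  -- An AC: single source (node 0) from which every node is reachable.
  record AC : Set where
    field
      n         : ℕ
      circ      : Circ Carrier (suc n)
      connected : ∀ j → Reach circ zero j

  open AC public

  size : AC → ℕ
  size C = suc (n C)

  ⟦_⟧ : AC → Assignment → Carrier
  ⟦ C ⟧ a = val (circ C) a zero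

  Smooth : AC → Set
  Smooth C = ∀ i l r → At (circ C) i (plus l r) →
             ∀ x → (Var (circ C) l x → Var (circ C) r x) × (Var (circ C) r x → Var (circ C) l x)

  Deterministic : AC → Set
  Deterministic C = ∀ i l r → At (circ C) i (plus l r) →
    ¬ (∃ λ a → val (circ C) a l ≢ 0# × val (circ C) a r ≢ 0#)

  Decomposable : AC → Set
  Decomposable C = ∀ i l r → At (circ C) i (times l r) →
    ∀ x → Var (circ C) l x → Var (circ C) r x → ⊥

  WeaklyDecomposable : AC → Set
  WeaklyDecomposable C = ∀ i l r → At (circ C) i (times l r) →
    ∀ x → Var (circ C) l x → Var (circ C) r x →
    ¬ (LitBelow (circ C) i (pos x) × LitBelow (circ C) i (neg x))

  Monotone : AC → Set
  Monotone C = ∀ i v → At (circ C) i (const v) → 0# ≤ v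

  Class : Set₁
  Class = AC → Set

  wD-ACₘ D-ACₘ swD-ACₘ sD-ACₘ dwD-ACₘ dD-ACₘ sdwD-ACₘ sdD-ACₘ : Class
  wD-ACₘ   C = WeaklyDecomposable C × Monotone C
  D-ACₘ    C = Decomposable C × Monotone C
  swD-ACₘ  C = Smooth C × WeaklyDecomposable C × Monotone C
  sD-ACₘ   C = Smooth C × Decomposable C × Monotone C
  dwD-ACₘ  C = Deterministic C × WeaklyDecomposable C × Monotone C
  dD-ACₘ   C = Deterministic C × Decomposable C × Monotone C
  sdwD-ACₘ C = Smooth C × Deterministic C × WeaklyDecomposable C × Monotone C
  sdD-ACₘ  C = Smooth C × Deterministic C × Decomposable C × Monotone C

  SameFunction : AC → AC → Set
  SameFunction C₁ C₂ = ∀ a → ⟦ C₁ ⟧ a ≡ ⟦ C₂ ⟧ a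

  infix 4 _≼_ _≺_ _≃_ _⋠_

  _≼_ : Class → Class → Set
  𝒞₁ ≼ 𝒞₂ = ∃ λ (p : List ℕ) → ∀ C₂ → 𝒞₂ C₂ →
             ∃ λ C₁ → 𝒞₁ C₁ × SameFunction C₁ C₂ × size C₁ ℕ.≤ evalPoly p (size C₂)

  _⋠_ : Class → Class → Set
  𝒞₁ ⋠ 𝒞₂ = ¬ (𝒞₁ ≼ 𝒞₂)

  _≺_ : Class → Class → Set
  𝒞₁ ≺ 𝒞₂ = (𝒞₁ ≼ 𝒞₂) × (𝒞₂ ⋠ 𝒞₁)

  _≃_ : Class → Class → Set
  𝒞₁ ≃ 𝒞₂ = (𝒞₁ ≼ 𝒞₂) × (𝒞₂ ≼ 𝒞₁)

module Submission where

-- Collapses.  Smoothing multiplies a summand by x + x̄ for each missing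
-- variable x.  In a smooth weakly decomposable circuit every literal that is
-- pure below a node can be factored out of the node, and this makes the
-- products decomposable.
--
-- dwD ≰ D.  On every input a deterministic circuit takes the value 0 or a
-- monomial in its constants.  A linear form in n variables has a D-circuit of
-- size O(n), but the coefficients can be chosen such that its 2^n values are
-- pairwise coprime integers, hence multiplicatively independent; by linear
-- algebra over ℤ a deterministic circuit then needs 2^n constants.
--
-- D ≰ dwD.  A product of local constraints with private selectors checks
-- whether one-hot encoded symbols form a Reed–Solomon codeword together with
-- the intermediate values of Horner's scheme.  In a smooth decomposable
-- circuit every codeword passes through a node that sees between 1/3 and 2/3
-- of the 3k symbols.  If two codewords passed through the same node, their
-- hybrid would also be a codeword and agree with each of them in k places.
-- So the M^k messages give distinct nodes, whereas the product of the
-- constraints has size O(M²) for fixed k.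

open import Defs
open import Level using (0ℓ)
open import Data.Bool.Base using (Bool; true; false; if_then_else_; not)
import Data.Bool.Properties as Boolₚ
open import Data.Empty using (⊥; ⊥-elim)
open import Data.Fin.Base as Fin using (Fin; zero; suc; punchIn)
import Data.Fin.Properties as Finₚ
open import Data.Integer.Base as ℤ using (ℤ; -[1+_]; 0ℤ; 1ℤ) renaming (+_ to infix 8 ↑_)
import Data.Integer.Properties as ℤₚ
open import Data.Integer.Solver using () renaming (module +-*-Solver to ℤ-Solver)
open import Data.List.Base as List using
  (List; []; _∷_; _++_; length; map; concat; concatMap; filter; upTo; cartesianProductWith; lookup; deduplicate)
open import Data.List.Membership.Propositional using (_∈_; find; lose)
open import Data.List.Membership.Propositional.Properties using
  (∈-++⁺ˡ; ∈-++⁺ʳ; ∈-++⁻; ∈-map⁺; ∈-map⁻; ∈-filter⁺; ∈-filter⁻; ∈-upTo⁺; ∈-upTo⁻; ∈-concatMap⁺; ∈-concatMap⁻;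
   ∈-cartesianProductWith⁺; ∈-cartesianProductWith⁻; ∈-deduplicate⁺)
import Data.List.Properties as Listₚ
open import Data.List.Relation.Binary.Subset.Propositional using (_⊆_)
open import Data.List.Relation.Unary.All as All using (All; []; _∷_)
open import Data.List.Relation.Unary.All.Properties using (all-filter)
open import Data.List.Relation.Unary.AllPairs using (AllPairs; []; _∷_)
open import Data.List.Relation.Unary.Any as Any using (here; there)
open import Data.List.Relation.Unary.Any.Properties using (lookup-index)
open import Data.List.Relation.Unary.Unique.DecPropositional.Properties using (deduplicate-!)
open import Data.List.Relation.Unary.Unique.Propositional using (Unique)
open import Data.List.Relation.Unary.Unique.Propositional.Properties using (map⁺; filter⁺; upTo⁺)
open import Data.Nat using (_!; _<?_)
open import Data.Nat.Base as ℕ using (ℕ; zero; suc)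
open import Data.Nat.Coprimality as Coprimality using (Coprime; coprime-divisor)
open import Data.Nat.Divisibility using
  (_∣_; ∣-trans; ∣1⇒≡1; ∣m⇒∣m*n; ∣n⇒∣m*n; ∣m+n∣m⇒∣n; m≤n⇒m!∣n!; m∣m*n)
open import Data.Nat.ListAction using (sum)
import Data.Nat.Properties as ℕₚ
open import Data.List.Membership.DecPropositional ℕₚ._≟_ using (_∈?_)
open import Data.Nat.Solver using (module +-*-Solver)
open import Data.Product.Base using (∃; _×_; _,_; proj₁; proj₂)
open import Data.Sum.Base as Sum using (_⊎_; inj₁; inj₂; [_,_]′)
open import Data.Unit.Base using (⊤; tt)
open import Data.Vec.Functional using (Vector; insertAt)
open import Data.Vec.Functional.Properties using (insertAt-lookup; insertAt-punchIn)
open import Function.Base using (_∘_; id; case_of_)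
open import Relation.Binary.Construct.Closure.ReflexiveTransitive using (ε; _◅_; gmap)
open import Relation.Binary.Definitions using (tri<; tri≈; tri>)
open import Relation.Binary.PropositionalEquality
open import Relation.Binary.Structures using (IsTotalOrder)
open import Relation.Nullary using (¬_; Dec; yes; no; does; contradiction; _⊎-dec_; _×-dec_; ¬?)
import Relation.Nullary.Decidable as Dec
open import Relation.Nullary.Decidable using (decidable-stable; dec-true; toSum)
open import Relation.Unary using (Decidable)
open import Algebra.Bundles using (CommutativeMonoid; CommutativeRing)
import Algebra.Properties.CommutativeMonoid.Mult as CommutativeMonoidMult
import Algebra.Properties.CommutativeMonoid.Sum as MonoidSum
import Algebra.Properties.Monoid.Mult as MonoidMult
import Algebra.Properties.Ring as RingProperties

-- All strict relations come from `dwD⋠D` and `D⋠dwD`, transported along inclusions and collapses.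
-- The first separation rests on constants being arbitrary reals of cost one: those of the linear
-- form grow like (2^n)!, and its values are an affine image of the binary number held by the input.
-- The second is won one degree at a time: against a bound K s^d the code gets dimension 2d + 1, and
-- M is taken beyond the resulting constant. The code lives over the natural numbers instead of a
-- finite field; its intermediate values stay below a constant times M, which keeps the number of
-- terms quadratic. Two obstacles shape the collapse of weak decomposability. Removing literals
-- preserves a value only where these literals hold, whereas determinism speaks of all assignments.
-- And literals that are pure in a summand may be mixed in the sum, so they have to be put back
-- there. In the lower bound monotonicity excludes cancellation: a nonzero summand makes the sum
-- nonzero whatever the other one does. Case distinctions on whether a real is zero are needed
-- throughout; completeness of the order supplies them without excluded middle.

variable
  A : Set
  κ κ′ : ℕ

-- The unfolding of a node forgets the sharing; every property of a circuit
-- that matters here depends on the unfolding of its source only.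
data Tree (A : Set) : Set where
  const      : A → Tree A
  lit        : Lit → Tree A
  plus times : Tree A → Tree A → Tree A

unfoldGate : Gate A κ → (Fin κ → Tree A) → Tree A
unfoldGate (const v)   f = const v
unfoldGate (lit ℓ)     f = lit ℓ
unfoldGate (plus l r)  f = plus (f l) (f r)
unfoldGate (times l r) f = times (f l) (f r)

unfold : Circ A κ → Fin κ → Tree A
unfold (g ∷ c) zero    = unfoldGate g (unfold c)
unfold (g ∷ c) (suc i) = unfold c i

Occ : Lit → Tree A → Set
Occ ℓ (const _)   = ⊥
Occ ℓ (lit ℓ′)    = ℓ ≡ ℓ′
Occ ℓ (plus l r)  = Occ ℓ l ⊎ Occ ℓ r
Occ ℓ (times l r) = Occ ℓ l ⊎ Occ ℓ r

OccVar : ℕ → Tree A → Set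
OccVar x t = Occ (pos x) t ⊎ Occ (neg x) t

Every : (Tree A → Set) → Tree A → Set
Every Q (const v)   = Q (const v)
Every Q (lit ℓ)     = Q (lit ℓ)
Every Q (plus l r)  = Q (plus l r) × Every Q l × Every Q r
Every Q (times l r) = Q (times l r) × Every Q l × Every Q r

every-root : ∀ {Q : Tree A → Set} t → Every Q t → Q t
every-root (const v)   q = q
every-root (lit ℓ)     q = q
every-root (plus l r)  q = proj₁ q
every-root (times l r) q = proj₁ q

-- A circuit whose nodes are named by their unfoldings. Children have to occur later in the list, so
-- sharing is membership and size is length; repetitions are harmless.
data Dag {A : Set} : List (Tree A) → Set where
  []     : Dag []
  const∷ : ∀ {v L} → Dag L → Dag (const v ∷ L)
  lit∷   : ∀ {ℓ L} → Dag L → Dag (lit ℓ ∷ L)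
  plus∷  : ∀ {l r L} → l ∈ L → r ∈ L → Dag L → Dag (plus l r ∷ L)
  times∷ : ∀ {l r L} → l ∈ L → r ∈ L → Dag L → Dag (times l r ∷ L)

dag-plus : ∀ {L : List (Tree A)} {l r} → Dag L → plus l r ∈ L → l ∈ L × r ∈ L
dag-plus (plus∷ p q d)  (here refl) = there p , there q
dag-plus (const∷ d)     (there m)   = let p , q = dag-plus d m in there p , there q
dag-plus (lit∷ d)       (there m)   = let p , q = dag-plus d m in there p , there q
dag-plus (plus∷ _ _ d)  (there m)   = let p , q = dag-plus d m in there p , there q
dag-plus (times∷ _ _ d) (there m)   = let p , q = dag-plus d m in there p , there q

dag-times : ∀ {L : List (Tree A)} {l r} → Dag L → times l r ∈ L → l ∈ L × r ∈ L
dag-times (times∷ p q d) (here refl) = there p , there q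
dag-times (const∷ d)     (there m)   = let p , q = dag-times d m in there p , there q
dag-times (lit∷ d)       (there m)   = let p , q = dag-times d m in there p , there q
dag-times (plus∷ _ _ d)  (there m)   = let p , q = dag-times d m in there p , there q
dag-times (times∷ _ _ d) (there m)   = let p , q = dag-times d m in there p , there q

trees : Circ A κ → List (Tree A)
trees []      = []
trees (g ∷ c) = unfoldGate g (unfold c) ∷ trees c

unfold∈trees : (c : Circ A κ) (i : Fin κ) → unfold c i ∈ trees c
unfold∈trees (g ∷ c) zero    = here refl
unfold∈trees (g ∷ c) (suc i) = there (unfold∈trees c i)

trees-dag : (c : Circ A κ) → Dag (trees c)
trees-dag []                = []
trees-dag (const v ∷ c)     = const∷ (trees-dag c)
trees-dag (lit ℓ ∷ c)       = lit∷ (trees-dag c)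
trees-dag (plus l r ∷ c)    = plus∷ (unfold∈trees c l) (unfold∈trees c r) (trees-dag c)
trees-dag (times l r ∷ c)   = times∷ (unfold∈trees c l) (unfold∈trees c r) (trees-dag c)

length-trees : (c : Circ A κ) → length (trees c) ≡ κ
length-trees []      = refl
length-trees (g ∷ c) = cong suc (length-trees c)

unfoldGate-shift : (g : Gate A κ) (f : Fin (suc κ) → Tree A) →
                   unfoldGate (shift g) f ≡ unfoldGate g (f ∘ suc)
unfoldGate-shift (const v)   f = refl
unfoldGate-shift (lit ℓ)     f = refl
unfoldGate-shift (plus l r)  f = refl
unfoldGate-shift (times l r) f = refl

unfold-At : {c : Circ A κ} {i : Fin κ} {g : Gate A κ} → At c i g →
            unfold c i ≡ unfoldGate g (unfold c)
unfold-At (here {g = g} {c})              = sym (unfoldGate-shift g (unfold (g ∷ c)))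
unfold-At (there {h = h} {c} {g = g} at)  =
  trans (unfold-At at) (sym (unfoldGate-shift g (unfold (h ∷ c))))

gate-At : (c : Circ A κ) (i : Fin κ) → ∃ λ g → At c i g
gate-At (g ∷ c) zero    = shift g , here
gate-At (g ∷ c) (suc i) = let h , at = gate-At c i in shift h , there at

Child-suc : {h : Gate A κ} {c : Circ A κ} {i j : Fin κ} → Child c i j → Child (h ∷ c) (suc i) (suc j)
Child-suc (l , r , at , eq) =
  suc l , suc r , Sum.map there there at , Sum.map (cong suc) (cong suc) eq

Reach-suc : {h : Gate A κ} {c : Circ A κ} {i j : Fin κ} → Reach c i j → Reach (h ∷ c) (suc i) (suc j)
Reach-suc = gmap suc Child-suc

LitBelow-suc : ∀ {h : Gate A κ} {c : Circ A κ} {i ℓ} → LitBelow c i ℓ → LitBelow (h ∷ c) (suc i) ℓ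
LitBelow-suc (j , r , at) = suc j , Reach-suc r , there at

LitBelow-child : ∀ {c : Circ A κ} {i j ℓ} → Child c i j → LitBelow c j ℓ → LitBelow c i ℓ
LitBelow-child ch (m , r , at) = m , ch ◅ r , at

child-plus-l : ∀ {c : Circ A κ} {i l r} → At c i (plus l r) → Child c i l
child-plus-l at = _ , _ , inj₁ at , inj₁ refl

child-plus-r : ∀ {c : Circ A κ} {i l r} → At c i (plus l r) → Child c i r
child-plus-r at = _ , _ , inj₁ at , inj₂ refl

child-times-l : ∀ {c : Circ A κ} {i l r} → At c i (times l r) → Child c i l
child-times-l at = _ , _ , inj₂ at , inj₁ refl

child-times-r : ∀ {c : Circ A κ} {i l r} → At c i (times l r) → Child c i r
child-times-r at = _ , _ , inj₂ at , inj₂ refl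

Occ⇒LitBelow : ∀ (c : Circ A κ) i {ℓ} → Occ ℓ (unfold c i) → LitBelow c i ℓ
Occ⇒LitBelow (lit _ ∷ c)     zero refl     = zero , ε , here
Occ⇒LitBelow (plus l r ∷ c)  zero (inj₁ o) = LitBelow-child (child-plus-l here) (LitBelow-suc (Occ⇒LitBelow c l o))
Occ⇒LitBelow (plus l r ∷ c)  zero (inj₂ o) = LitBelow-child (child-plus-r here) (LitBelow-suc (Occ⇒LitBelow c r o))
Occ⇒LitBelow (times l r ∷ c) zero (inj₁ o) = LitBelow-child (child-times-l here) (LitBelow-suc (Occ⇒LitBelow c l o))
Occ⇒LitBelow (times l r ∷ c) zero (inj₂ o) = LitBelow-child (child-times-r here) (LitBelow-suc (Occ⇒LitBelow c r o))
Occ⇒LitBelow (g ∷ c) (suc i) o             = LitBelow-suc (Occ⇒LitBelow c i o)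

Occ-child : ∀ {c : Circ A κ} {i j ℓ} → Child c i j → Occ ℓ (unfold c j) → Occ ℓ (unfold c i)
Occ-child (l , r , inj₁ at , inj₁ refl) o rewrite unfold-At at = inj₁ o
Occ-child (l , r , inj₁ at , inj₂ refl) o rewrite unfold-At at = inj₂ o
Occ-child (l , r , inj₂ at , inj₁ refl) o rewrite unfold-At at = inj₁ o
Occ-child (l , r , inj₂ at , inj₂ refl) o rewrite unfold-At at = inj₂ o

LitBelow⇒Occ : ∀ {c : Circ A κ} {i ℓ} → LitBelow c i ℓ → Occ ℓ (unfold c i)
LitBelow⇒Occ {c = c} {ℓ = ℓ} (j , r , at) = go r (subst (Occ ℓ) (sym (unfold-At at)) refl)
  where
  go : ∀ {i j} → Reach c i j → Occ ℓ (unfold c j) → Occ ℓ (unfold c i)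
  go ε        o = o
  go (ch ◅ r) o = Occ-child ch (go r o)

Var⇒OccVar : ∀ {c : Circ A κ} {i x} → Var c i x → OccVar x (unfold c i)
Var⇒OccVar (j , r , inj₁ at) = inj₁ (LitBelow⇒Occ (j , r , at))
Var⇒OccVar (j , r , inj₂ at) = inj₂ (LitBelow⇒Occ (j , r , at))

OccVar⇒Var : ∀ (c : Circ A κ) i {x} → OccVar x (unfold c i) → Var c i x
OccVar⇒Var c i (inj₁ o) = let j , r , at = Occ⇒LitBelow c i o in j , r , inj₁ at
OccVar⇒Var c i (inj₂ o) = let j , r , at = Occ⇒LitBelow c i o in j , r , inj₂ at

every-unfold : {Q : Tree A → Set} (c : Circ A κ) → (∀ i → Q (unfold c i)) → ∀ i → Every Q (unfold c i)
every-unfold (const v ∷ c)   q zero    = q zero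
every-unfold (lit ℓ ∷ c)     q zero    = q zero
every-unfold (plus l r ∷ c)  q zero    =
  q zero , every-unfold c (q ∘ suc) l , every-unfold c (q ∘ suc) r
every-unfold (times l r ∷ c) q zero    =
  q zero , every-unfold c (q ∘ suc) l , every-unfold c (q ∘ suc) r
every-unfold (g ∷ c)         q (suc i) = every-unfold c (q ∘ suc) i

every-reach : {Q : Tree A → Set} {c : Circ A κ} {i j : Fin κ} → Reach c i j →
              Every Q (unfold c i) → Every Q (unfold c j)
every-reach ε        q = q
every-reach {Q = Q} {c} (ch ◅ r) q = every-reach r (step ch q)
  where
  step : ∀ {i j} → Child c i j → Every Q (unfold c i) → Every Q (unfold c j)
  step (l , r , inj₁ at , inj₁ refl) q rewrite unfold-At at = proj₁ (proj₂ q)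
  step (l , r , inj₁ at , inj₂ refl) q rewrite unfold-At at = proj₂ (proj₂ q)
  step (l , r , inj₂ at , inj₁ refl) q rewrite unfold-At at = proj₁ (proj₂ q)
  step (l , r , inj₂ at , inj₂ refl) q rewrite unfold-At at = proj₂ (proj₂ q)

-- Realising a list of trees closed under children as a connected circuit.

-- Indexing by use lets `renameGate` ask for new names of the successors only; all other nodes may
-- have been pruned away.
data Uses {A : Set} {κ : ℕ} : Gate A κ → Fin κ → Set where
  plus-l  : ∀ {l r} → Uses (plus l r) l
  plus-r  : ∀ {l r} → Uses (plus l r) r
  times-l : ∀ {l r} → Uses (times l r) l
  times-r : ∀ {l r} → Uses (times l r) r

uses? : (g : Gate A κ) → Decidable (Uses g)
uses? (const v)   i = no λ ()
uses? (lit ℓ)     i = no λ ()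
uses? (plus l r)  i with i Finₚ.≟ l | i Finₚ.≟ r
... | yes refl | _        = yes plus-l
... | no _     | yes refl = yes plus-r
... | no p     | no q     = no λ { plus-l → p refl ; plus-r → q refl }
uses? (times l r) i with i Finₚ.≟ l | i Finₚ.≟ r
... | yes refl | _        = yes times-l
... | no _     | yes refl = yes times-r
... | no p     | no q     = no λ { times-l → p refl ; times-r → q refl }

renameGate : (g : Gate A κ) → (∀ i → Uses g i → Fin κ′) → Gate A κ′
renameGate (const v)   f = const v
renameGate (lit ℓ)     f = lit ℓ
renameGate (plus l r)  f = plus (f l plus-l) (f r plus-r)
renameGate (times l r) f = times (f l times-l) (f r times-r)

unfold-renameGate : (g : Gate A κ) (f : ∀ i → Uses g i → Fin κ′) {u : Fin κ → Tree A} {u′ : Fin κ′ → Tree A} →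
                    (∀ i p → u′ (f i p) ≡ u i) → unfoldGate (renameGate g f) u′ ≡ unfoldGate g u
unfold-renameGate (const v)   f eq = refl
unfold-renameGate (lit ℓ)     f eq = refl
unfold-renameGate (plus l r)  f eq = cong₂ plus (eq l plus-l) (eq r plus-r)
unfold-renameGate (times l r) f eq = cong₂ times (eq l times-l) (eq r times-r)

child-renameGate : ∀ {g : Gate A κ} {f : ∀ i → Uses g i → Fin κ′} {c : Circ A κ′} {i} (p : Uses g i) →
                   Child (renameGate g f ∷ c) zero (suc (f i p))
child-renameGate plus-l  = child-plus-l here
child-renameGate plus-r  = child-plus-r here
child-renameGate times-l = child-times-l here
child-renameGate times-r = child-times-r here

record Pruned {A : Set} {κ : ℕ} (c : Circ A κ) (S : Fin κ → Set) : Set where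
  field
    {k⁻}    : ℕ
    circ⁻   : Circ A k⁻
    k⁻≤k    : k⁻ ℕ.≤ κ
    φ       : ∀ i → S i → Fin k⁻
    φ-tree  : ∀ i p → unfold circ⁻ (φ i p) ≡ unfold c i
    reached : ∀ j → ∃ λ i → ∃ λ p → Reach circ⁻ (φ i p) j

-- One pass from the newest node to the oldest suffices, because successors are older: a kept gate
-- adds its successors to the set wanted from the rest, and a gate outside the set is dropped.
prune : (c : Circ A κ) (S : Fin κ → Set) → Decidable S → Pruned c S
prune [] S S? = record
  { circ⁻ = [] ; k⁻≤k = ℕ.z≤n ; φ = λ () ; φ-tree = λ () ; reached = λ () }
prune (g ∷ c) S S? with S? zero
... | no ¬S₀ = record
  { circ⁻   = circ⁻
  ; k⁻≤k    = ℕₚ.m≤n⇒m≤1+n k⁻≤k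
  ; φ       = λ { zero p → contradiction p ¬S₀ ; (suc i) p → φ i p }
  ; φ-tree  = λ { zero p → contradiction p ¬S₀ ; (suc i) p → φ-tree i p }
  ; reached = λ j → let i , p , r = reached j in suc i , p , r
  }
  where open Pruned (prune c (S ∘ suc) (S? ∘ suc))
... | yes S₀ = record
  { circ⁻   = renameGate g f ∷ circ⁻
  ; k⁻≤k    = ℕ.s≤s k⁻≤k
  ; φ       = φ′
  ; φ-tree  = λ { zero p → unfold-renameGate g f (λ i q → φ-tree i (inj₂ q))
                ; (suc i) p → φ-tree i (inj₁ p) }
  ; reached = λ { zero → zero , S₀ , ε ; (suc j) → step (reached j) }
  }
  where
  open Pruned (prune c (λ i → S (suc i) ⊎ Uses g i) (λ i → S? (suc i) ⊎-dec uses? g i))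
  f : ∀ i → Uses g i → Fin k⁻
  f i q = φ i (inj₂ q)
  φ′ : ∀ i → S i → Fin (suc k⁻)
  φ′ zero    p = zero
  φ′ (suc i) p = suc (φ i (inj₁ p))
  step : ∀ {j} → (∃ λ i → ∃ λ p → Reach circ⁻ (φ i p) j) →
         ∃ λ i → ∃ λ p → Reach (renameGate g f ∷ circ⁻) (φ′ i p) (suc j)
  step (i , inj₁ p , r) = suc i , p , Reach-suc r
  step (i , inj₂ q , r) = zero , S₀ , child-renameGate q ◅ Reach-suc r

circOf : {L : List (Tree A)} → Dag L → Circ A (length L)
node   : {L : List (Tree A)} {t : Tree A} → Dag L → t ∈ L → Fin (length L)
circOf []                     = []
circOf (const∷ {v = v} d)     = const v ∷ circOf d
circOf (lit∷ {ℓ = ℓ} d)       = lit ℓ ∷ circOf d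
circOf (plus∷ p q d)          = plus (node d p) (node d q) ∷ circOf d
circOf (times∷ p q d)         = times (node d p) (node d q) ∷ circOf d
node (const∷ d)     (here _)  = zero
node (lit∷ d)       (here _)  = zero
node (plus∷ _ _ d)  (here _)  = zero
node (times∷ _ _ d) (here _)  = zero
node (const∷ d)     (there m) = suc (node d m)
node (lit∷ d)       (there m) = suc (node d m)
node (plus∷ _ _ d)  (there m) = suc (node d m)
node (times∷ _ _ d) (there m) = suc (node d m)

unfold-node : {L : List (Tree A)} {t : Tree A} (d : Dag L) (m : t ∈ L) → unfold (circOf d) (node d m) ≡ t
unfold-node (const∷ d)     (here refl) = refl
unfold-node (lit∷ d)       (here refl) = refl
unfold-node (plus∷ p q d)  (here refl) = cong₂ plus (unfold-node d p) (unfold-node d q)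
unfold-node (times∷ p q d) (here refl) = cong₂ times (unfold-node d p) (unfold-node d q)
unfold-node (const∷ d)     (there m)   = unfold-node d m
unfold-node (lit∷ d)       (there m)   = unfold-node d m
unfold-node (plus∷ _ _ d)  (there m)   = unfold-node d m
unfold-node (times∷ _ _ d) (there m)   = unfold-node d m

record Realised {A : Set} (t : Tree A) (s : ℕ) : Set where
  field
    {m}       : ℕ
    circ      : Circ A (suc m)
    tree≡     : unfold circ zero ≡ t
    connected : ∀ j → Reach circ zero j
    size≤     : suc m ℕ.≤ s

prune-source : (c : Circ A κ) (i : Fin κ) → Realised (unfold c i) κ
prune-source (g ∷ c) zero = record
  { circ      = renameGate g φ ∷ circ⁻
  ; tree≡     = unfold-renameGate g φ φ-tree
  ; connected = λ { zero → ε ; (suc j) → let i , p , r = reached j in child-renameGate p ◅ Reach-suc r }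
  ; size≤     = ℕ.s≤s k⁻≤k
  }
  where open Pruned (prune c (Uses g) (uses? g))
prune-source (g ∷ c) (suc i) = record
  { Realised (prune-source c i) ; size≤ = ℕₚ.m≤n⇒m≤1+n (Realised.size≤ (prune-source c i)) }

realise : {L : List (Tree A)} {t : Tree A} → Dag L → t ∈ L → Realised t (length L)
realise d m = subst (λ t → Realised t _) (unfold-node d m) (prune-source (circOf d) (node d m))

dag-++ : {L L′ : List (Tree A)} → Dag L → Dag L′ → Dag (L ++ L′)
dag-++ {L′ = L′} d d′ = go d
  where
  go : ∀ {L} → Dag L → Dag (L ++ L′)
  go []             = d′
  go (const∷ d)     = const∷ (go d)
  go (lit∷ d)       = lit∷ (go d)
  go (plus∷ p q d)  = plus∷ (∈-++⁺ˡ p) (∈-++⁺ˡ q) (go d)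
  go (times∷ p q d) = times∷ (∈-++⁺ˡ p) (∈-++⁺ˡ q) (go d)

-- Without any sharing: this serves the two explicit families, which are small already as trees.
subtrees : Tree A → List (Tree A)
subtrees t@(const v)   = t ∷ []
subtrees t@(lit ℓ)     = t ∷ []
subtrees t@(plus l r)  = t ∷ subtrees l ++ subtrees r
subtrees t@(times l r) = t ∷ subtrees l ++ subtrees r

root∈subtrees : (t : Tree A) → t ∈ subtrees t
root∈subtrees (const v)   = here refl
root∈subtrees (lit ℓ)     = here refl
root∈subtrees (plus l r)  = here refl
root∈subtrees (times l r) = here refl

subtrees-dag : (t : Tree A) → Dag (subtrees t)
subtrees-dag (const v)   = const∷ []
subtrees-dag (lit ℓ)     = lit∷ []
subtrees-dag (plus l r)  = plus∷ (∈-++⁺ˡ (root∈subtrees l)) (∈-++⁺ʳ (subtrees l) (root∈subtrees r))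
                             (dag-++ (subtrees-dag l) (subtrees-dag r))
subtrees-dag (times l r) = times∷ (∈-++⁺ˡ (root∈subtrees l)) (∈-++⁺ʳ (subtrees l) (root∈subtrees r))
                             (dag-++ (subtrees-dag l) (subtrees-dag r))

open MonoidSum ℤₚ.+-0-commutativeMonoid using () renaming (sum to Σℤ; sum-remove to Σℤ-remove; sum-cong-≗ to Σℤ-cong)
open MonoidSum ℕₚ.+-0-commutativeMonoid using () renaming (sum to Σℕ)
open MonoidSum ℕₚ.*-1-commutativeMonoid using () renaming (sum to Πℕ)
-- The exponent is the left operand: `n ^ℕ x` is the n-fold multiple of x in the multiplicative
-- monoid. The same convention is used for `^ℝ`.
open MonoidMult (CommutativeMonoid.monoid ℕₚ.*-1-commutativeMonoid) using () renaming (_×_ to infixr 8 _^ℕ_)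

-- Linear dependence

Σℤ-0 : ∀ {n} {f : Vector ℤ n} → (∀ j → f j ≡ 0ℤ) → Σℤ f ≡ 0ℤ
Σℤ-0 {zero}  h = refl
Σℤ-0 {suc n} h = cong₂ ℤ._+_ (h zero) (Σℤ-0 (h ∘ suc))

-- Elimination without division: row j becomes d times itself minus a j times the pivot row. A
-- relation c of the new rows gives the old ones the coefficients d c j, and the pivot row minus the
-- sum of all c j a j.
eliminate : ∀ {n} (c a b : Vector ℤ n) d q →
            ℤ.- Σℤ (λ j → c j ℤ.* a j) ℤ.* q ℤ.+ Σℤ (λ j → d ℤ.* c j ℤ.* b j) ≡
            Σℤ (λ j → c j ℤ.* (d ℤ.* b j ℤ.- a j ℤ.* q))
eliminate {zero}  c a b d q = refl
eliminate {suc n} c a b d q = trans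
  (rearrange (c zero) (a zero) (b zero) d q (Σℤ (λ j → c (suc j) ℤ.* a (suc j))) _)
  (cong (ℤ._+_ (c zero ℤ.* (d ℤ.* b zero ℤ.- a zero ℤ.* q))) (eliminate (c ∘ suc) (a ∘ suc) (b ∘ suc) d q))
  where
  open ℤ-Solver
  rearrange : ∀ c a b d q s t → ℤ.- (c ℤ.* a ℤ.+ s) ℤ.* q ℤ.+ (d ℤ.* c ℤ.* b ℤ.+ t) ≡
                                c ℤ.* (d ℤ.* b ℤ.- a ℤ.* q) ℤ.+ (ℤ.- s ℤ.* q ℤ.+ t)
  rearrange = solve 7 (λ c a b d q s t → :- (c :* a :+ s) :* q :+ (d :* c :* b :+ t) :=
                                         c :* (d :* b :- a :* q) :+ (:- s :* q :+ t)) refl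

-- Induction on the number of columns. A first column of zeros is dropped together with row 0, which
-- gets coefficient 0; otherwise a row with a nonzero entry d in that column is the pivot.
linearly-dependent : ∀ m (e : Fin (suc m) → Fin m → ℤ) →
                     ∃ λ (c : Vector ℤ (suc m)) → (∃ λ j → c j ≢ 0ℤ) × (∀ i → Σℤ (λ j → c j ℤ.* e j i) ≡ 0ℤ)
linearly-dependent zero    e = (λ _ → 1ℤ) , (zero , λ ()) , λ ()
linearly-dependent (suc m) e with Finₚ.any? (λ j → ¬? (e j zero ℤₚ.≟ 0ℤ))
... | no ∄pivot = c , (suc (proj₁ (proj₁ (proj₂ IH))) , proj₂ (proj₁ (proj₂ IH))) ,
  λ { zero    → Σℤ-0 (λ j → trans (cong (c j ℤ.*_) (column j)) (ℤₚ.*-zeroʳ (c j)))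
    ; (suc i) → trans (ℤₚ.+-identityˡ _) (proj₂ (proj₂ IH) i) }
  where
  IH = linearly-dependent m (λ j i → e (suc j) (suc i))
  c : Vector ℤ (suc (suc m))
  c zero    = 0ℤ
  c (suc j) = proj₁ IH j
  column : ∀ j → e j zero ≡ 0ℤ
  column j = decidable-stable (e j zero ℤₚ.≟ 0ℤ) (λ p → ∄pivot (j , p))
... | yes (p , d≢0) = c , nonzero , λ
    -- The reduced rows vanish in the pivot column.
    { zero    → trans (combination zero) (Σℤ-0 λ j → trans (cong (c′ j ℤ.*_)
                  (trans (cong (ℤ._- a j ℤ.* d) (ℤₚ.*-comm d (a j))) (ℤₚ.+-inverseʳ (a j ℤ.* d)))) (ℤₚ.*-zeroʳ (c′ j)))
    ; (suc i) → trans (combination (suc i)) (proj₂ (proj₂ IH) i) }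
  where
  d = e p zero
  a : Vector ℤ (suc m)
  a j = e (punchIn p j) zero
  IH = linearly-dependent m (λ j i → d ℤ.* e (punchIn p j) (suc i) ℤ.- a j ℤ.* e p (suc i))
  c′ = proj₁ IH
  cₚ = ℤ.- Σℤ (λ j → c′ j ℤ.* a j)
  c : Vector ℤ (suc (suc m))
  c = insertAt (λ j → d ℤ.* c′ j) p cₚ
  nonzero : ∃ λ j → c j ≢ 0ℤ
  nonzero with proj₁ (proj₂ IH)
  -- The relation stays nontrivial since d is nonzero and ℤ has no zero divisors.
  ... | j , c′j≢0 = punchIn p j , λ eq → Sum.[ d≢0 , c′j≢0 ]′
    (ℤₚ.i*j≡0⇒i≡0∨j≡0 d (trans (sym (insertAt-punchIn (λ j → d ℤ.* c′ j) p cₚ j)) eq))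
  combination : ∀ i → Σℤ (λ j → c j ℤ.* e j i) ≡
                      Σℤ (λ j → c′ j ℤ.* (d ℤ.* e (punchIn p j) i ℤ.- a j ℤ.* e p i))
  combination i = begin
    Σℤ (λ j → c j ℤ.* e j i)
      ≡⟨ Σℤ-remove {i = p} (λ j → c j ℤ.* e j i) ⟩
    c p ℤ.* e p i ℤ.+ Σℤ (λ j → c (punchIn p j) ℤ.* e (punchIn p j) i)
      ≡⟨ cong₂ (λ u v → u ℤ.* e p i ℤ.+ v) (insertAt-lookup (λ j → d ℤ.* c′ j) p cₚ)
           (Σℤ-cong λ j → cong (ℤ._* e (punchIn p j) i) (insertAt-punchIn (λ j → d ℤ.* c′ j) p cₚ j)) ⟩
    ℤ.- Σℤ (λ j → c′ j ℤ.* a j) ℤ.* e p i ℤ.+ Σℤ (λ j → d ℤ.* c′ j ℤ.* e (punchIn p j) i)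
      ≡⟨ eliminate c′ a (λ j → e (punchIn p j) i) d (e p i) ⟩
    Σℤ (λ j → c′ j ℤ.* (d ℤ.* e (punchIn p j) i ℤ.- a j ℤ.* e p i)) ∎
    where open ≡-Reasoning

⁺ ⁻ : ℤ → ℕ
⁺ (↑ n)    = n
⁺ -[1+ n ] = 0
⁻ (↑ n)    = 0
⁻ -[1+ n ] = suc n

Σ-parts : ∀ {n} (c : Vector ℤ n) (e : Vector ℕ n) →
          Σℤ (λ j → c j ℤ.* ↑ e j) ℤ.+ ↑ Σℕ (λ j → ⁻ (c j) ℕ.* e j) ≡ ↑ Σℕ (λ j → ⁺ (c j) ℕ.* e j)
Σ-parts {zero}  c e = refl
Σ-parts {suc n} c e = begin
  (c zero ℤ.* ↑ e zero ℤ.+ S) ℤ.+ (↑ (⁻ (c zero) ℕ.* e zero) ℤ.+ N)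
    ≡⟨ interchange (c zero ℤ.* ↑ e zero) S (↑ (⁻ (c zero) ℕ.* e zero)) N ⟩
  (c zero ℤ.* ↑ e zero ℤ.+ ↑ (⁻ (c zero) ℕ.* e zero)) ℤ.+ (S ℤ.+ N)
    ≡⟨ cong₂ ℤ._+_ (single (c zero) (e zero)) (Σ-parts (c ∘ suc) (e ∘ suc)) ⟩
  ↑ (⁺ (c zero) ℕ.* e zero) ℤ.+ ↑ Σℕ (λ j → ⁺ (c (suc j)) ℕ.* e (suc j)) ∎
  where
  open ≡-Reasoning
  S = Σℤ (λ j → c (suc j) ℤ.* ↑ e (suc j))
  N = ↑ Σℕ (λ j → ⁻ (c (suc j)) ℕ.* e (suc j))
  interchange : ∀ a b c d → (a ℤ.+ b) ℤ.+ (c ℤ.+ d) ≡ (a ℤ.+ c) ℤ.+ (b ℤ.+ d)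
  interchange = solve 4 (λ a b c d → (a :+ b) :+ (c :+ d) := (a :+ c) :+ (b :+ d)) refl
    where open ℤ-Solver
  single : ∀ c e → c ℤ.* ↑ e ℤ.+ ↑ (⁻ c ℕ.* e) ≡ ↑ (⁺ c ℕ.* e)
  single (↑ n)    e = trans (ℤₚ.+-identityʳ _) (sym (ℤₚ.pos-* n e))
  single -[1+ n ] e = begin
    -[1+ n ] ℤ.* ↑ e ℤ.+ ↑ (suc n ℕ.* e)        ≡⟨ cong (λ z → -[1+ n ] ℤ.* ↑ e ℤ.+ z) (ℤₚ.pos-* (suc n) e) ⟩
    -[1+ n ] ℤ.* ↑ e ℤ.+ ↑ suc n ℤ.* ↑ e        ≡⟨ sym (ℤₚ.*-distribʳ-+ (↑ e) -[1+ n ] (↑ suc n)) ⟩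
    (-[1+ n ] ℤ.+ ↑ suc n) ℤ.* ↑ e              ≡⟨ cong (ℤ._* ↑ e) (ℤₚ.+-inverseˡ (↑ suc n)) ⟩
    0ℤ ℤ.* ↑ e                                  ≡⟨ ℤₚ.*-zeroˡ (↑ e) ⟩
    0ℤ                                          ∎

-- Moving the negative coefficients to the other side turns an integer relation into an equation
-- between natural exponents. The two sides have disjoint supports, which is what `independent` asks
-- for.
balanced-relation : ∀ m (e : Fin (suc m) → Fin m → ℕ) → ∃ λ (α : Vector ℕ (suc m)) → ∃ λ (β : Vector ℕ (suc m)) →
                    (∃ λ j → α j ≢ 0 ⊎ β j ≢ 0) × (∀ j → α j ≡ 0 ⊎ β j ≡ 0) ×
                    (∀ i → Σℕ (λ j → α j ℕ.* e j i) ≡ Σℕ (λ j → β j ℕ.* e j i))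
balanced-relation m e with linearly-dependent m (λ j i → ↑ e j i)
... | c , (j , cj≢0) , eq = ⁺ ∘ c , ⁻ ∘ c , (j , nontrivial (c j) cj≢0) , (λ j → disjoint (c j)) ,
  λ i → ℤₚ.+-injective (trans (sym (Σ-parts c (λ j → e j i)))
          (trans (cong (ℤ._+ ↑ Σℕ (λ j → ⁻ (c j) ℕ.* e j i)) (eq i)) (ℤₚ.+-identityˡ _)))
  where
  nontrivial : ∀ c → c ≢ 0ℤ → ⁺ c ≢ 0 ⊎ ⁻ c ≢ 0
  nontrivial (↑ n)    p = inj₁ λ { refl → p refl }
  nontrivial -[1+ n ] p = inj₂ λ ()
  disjoint : ∀ c → ⁺ c ≡ 0 ⊎ ⁻ c ≡ 0
  disjoint (↑ n)    = inj₂ refl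
  disjoint -[1+ n ] = inj₁ refl

-- Pairwise coprime numbers are multiplicatively independent

factor∣Π : ∀ {n} (f : Vector ℕ n) j → f j ∣ Πℕ f
factor∣Π f zero    = m∣m*n _
factor∣Π f (suc j) = ∣n⇒∣m*n (f zero) (factor∣Π (f ∘ suc) j)

coprime-^ : ∀ {d v x} n → Coprime d v → d ∣ n ^ℕ v ℕ.* x → d ∣ x
coprime-^ {d} {x = x} zero    c p = subst (d ∣_) (ℕₚ.+-identityʳ x) p
coprime-^ {d} {v} {x} (suc n) c p = coprime-^ n c (coprime-divisor c (subst (d ∣_) (ℕₚ.*-assoc v (n ^ℕ v) x) p))

coprime-Π : ∀ {n d} (v β : Vector ℕ n) → (∀ i → β i ≡ 0 ⊎ Coprime d (v i)) → d ∣ Πℕ (λ i → β i ^ℕ v i) → d ∣ 1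
coprime-Π {zero}  v β h p = p
coprime-Π {suc n} {d} v β h p with h zero
... | inj₂ c = coprime-Π (v ∘ suc) (β ∘ suc) (h ∘ suc) (coprime-^ (β zero) c p)
... | inj₁ eq = coprime-Π (v ∘ suc) (β ∘ suc) (h ∘ suc)
                  (subst (d ∣_) (ℕₚ.+-identityʳ _) (subst (λ b → d ∣ b ^ℕ v zero ℕ.* Πℕ (λ i → β (suc i) ^ℕ v (suc i))) eq p))

-- If α j were positive, then v j would divide the left product and hence the right one. There β j =
-- 0, and all other bases are coprime to v j, so v j would divide 1.
independent : ∀ {n} (v α β : Vector ℕ n) → (∀ j → v j ≢ 1) → (∀ {i j} → i ≢ j → Coprime (v i) (v j)) →
              (∀ j → α j ≡ 0 ⊎ β j ≡ 0) → Πℕ (λ j → α j ^ℕ v j) ≡ Πℕ (λ j → β j ^ℕ v j) → ∀ j → α j ≡ 0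
independent v α β v≢1 coprime disj eq j with disj j
... | inj₁ αj≡0 = αj≡0
... | inj₂ βj≡0 with α j in αj≡
...   | zero  = refl
...   | suc a = ⊥-elim (v≢1 j (∣1⇒≡1 (coprime-Π v β dichotomy
        (subst (v j ∣_) eq (∣-trans (subst (λ b → v j ∣ b ^ℕ v j) (sym αj≡) (m∣m*n _))
                                    (factor∣Π (λ j → α j ^ℕ v j) j))))))
  where
  dichotomy : ∀ i → β i ≡ 0 ⊎ Coprime (v j) (v i)
  dichotomy i with j Finₚ.≟ i
  ... | yes refl = inj₁ βj≡0
  ... | no j≢i   = inj₂ (coprime j≢i)

-- Gödel's β-function moduli: a common divisor of 1 + N! i and 1 + N! j
-- divides j - i, hence N!, hence 1.
β-modulus : ℕ → ℕ → ℕ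
β-modulus N j = suc (N ! ℕ.* suc j)

β-coprime-< : ∀ {N i j} → i ℕ.< j → j ℕ.< N → Coprime (β-modulus N i) (β-modulus N j)
β-coprime-< {N} {i} {j} i<j j<N {d} (p , q) = ∣1⇒≡1 (∣m+n∣m⇒∣n
  (subst (d ∣_) (sym (ℕₚ.+-comm (N ! ℕ.* suc i) 1)) p)
  (∣m⇒∣m*n (suc i) (∣-trans d∣k k∣N!)))
  where
  k = j ℕ.∸ i
  i+k≡j : i ℕ.+ k ≡ j
  i+k≡j = ℕₚ.m+[n∸m]≡n (ℕₚ.<⇒≤ i<j)
  -- The combination of the two moduli in which N! cancels: (j + 1) times the i-th exceeds (i + 1)
  -- times the j-th by j - i.
  identity : ∀ T i k → suc (i ℕ.+ k) ℕ.* suc (T ℕ.* suc i) ≡ suc i ℕ.* suc (T ℕ.* suc (i ℕ.+ k)) ℕ.+ k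
  identity = solve 3 (λ T i k → (con 1 :+ (i :+ k)) :* (con 1 :+ T :* (con 1 :+ i)) :=
                                (con 1 :+ i) :* (con 1 :+ T :* (con 1 :+ (i :+ k))) :+ k) refl
    where open +-*-Solver
  d∣k : d ∣ k
  d∣k = ∣m+n∣m⇒∣n
    (subst (d ∣_) (subst (λ j → suc j ℕ.* β-modulus N i ≡ suc i ℕ.* β-modulus N j ℕ.+ k) i+k≡j (identity (N !) i k))
      (∣n⇒∣m*n (suc j) p))
    (∣n⇒∣m*n (suc i) q)
  k∣k! : ∀ k → 1 ℕ.≤ k → k ∣ k !
  k∣k! (suc k) _ = m∣m*n (k !)
  k∣N! : k ∣ N !
  k∣N! = ∣-trans (k∣k! k (ℕₚ.m<n⇒0<n∸m i<j)) (m≤n⇒m!∣n! (ℕₚ.≤-trans (ℕₚ.m∸n≤m j i) (ℕₚ.<⇒≤ j<N)))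

β-coprime : ∀ {N i j} → i ℕ.< N → j ℕ.< N → i ≢ j → Coprime (β-modulus N i) (β-modulus N j)
β-coprime {N} {i} {j} i<N j<N i≢j with ℕₚ.<-cmp i j
... | tri< i<j _ _ = β-coprime-< i<j j<N
... | tri≈ _ i≡j _ = ⊥-elim (i≢j i≡j)
... | tri> _ _ j<i = Coprimality.sym (β-coprime-< j<i i<N)

β-modulus≢1 : ∀ N j → β-modulus N j ≢ 1
β-modulus≢1 N j eq = Sum.[ ℕ.≢-nonZero⁻¹ (N !) {{ℕₚ._!≢0 N}} , (λ ()) ]′ (ℕₚ.m*n≡0⇒m≡0∨n≡0 (N !) (ℕₚ.suc-injective eq))

-- Polynomials in Horner form: horner u k x = Σ_{r<k} u r x^(k-1-r)

horner : (ℕ → ℕ) → ℕ → ℕ → ℕ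
horner u zero    x = 0
horner u (suc r) x = u r ℕ.+ x ℕ.* horner u r x

hornerℤ : (ℕ → ℤ) → ℕ → ℤ → ℤ
hornerℤ u zero    x = 0ℤ
hornerℤ u (suc r) x = u r ℤ.+ x ℤ.* hornerℤ u r x

-- The intermediate values of Horner's scheme at y are the coefficients of
-- the quotient by x - y.
horner-quotient : ∀ u k x y → hornerℤ u (suc k) x ℤ.- hornerℤ u (suc k) y ≡
                              (x ℤ.- y) ℤ.* hornerℤ (λ r → hornerℤ u (suc r) y) k x
horner-quotient u zero    x y = base (u 0) x y
  where
  open ℤ-Solver
  base : ∀ c x y → (c ℤ.+ x ℤ.* 0ℤ) ℤ.- (c ℤ.+ y ℤ.* 0ℤ) ≡ (x ℤ.- y) ℤ.* 0ℤ
  base = solve 3 (λ c x y → (c :+ x :* con 0ℤ) :- (c :+ y :* con 0ℤ) := (x :- y) :* con 0ℤ) refl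
horner-quotient u (suc k) x y = begin
  (c ℤ.+ x ℤ.* P) ℤ.- (c ℤ.+ y ℤ.* R)        ≡⟨ expand c x y P R ⟩
  x ℤ.* (P ℤ.- R) ℤ.+ (x ℤ.- y) ℤ.* R        ≡⟨ cong (λ z → x ℤ.* z ℤ.+ (x ℤ.- y) ℤ.* R) (horner-quotient u k x y) ⟩
  x ℤ.* ((x ℤ.- y) ℤ.* Q) ℤ.+ (x ℤ.- y) ℤ.* R ≡⟨ factor x y Q R ⟩
  (x ℤ.- y) ℤ.* (R ℤ.+ x ℤ.* Q)              ∎
  where
  open ≡-Reasoning
  c = u (suc k)
  P = hornerℤ u (suc k) x
  R = hornerℤ u (suc k) y
  Q = hornerℤ (λ r → hornerℤ u (suc r) y) k x
  open ℤ-Solver using (solve; _:=_; _:+_; _:*_; _:-_)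
  expand : ∀ c x y P R → (c ℤ.+ x ℤ.* P) ℤ.- (c ℤ.+ y ℤ.* R) ≡ x ℤ.* (P ℤ.- R) ℤ.+ (x ℤ.- y) ℤ.* R
  expand = solve 5 (λ c x y P R → (c :+ x :* P) :- (c :+ y :* R) := x :* (P :- R) :+ (x :- y) :* R) refl
  factor : ∀ x y Q R → x ℤ.* ((x ℤ.- y) ℤ.* Q) ℤ.+ (x ℤ.- y) ℤ.* R ≡ (x ℤ.- y) ℤ.* (R ℤ.+ x ℤ.* Q)
  factor = solve 4 (λ x y Q R → x :* ((x :- y) :* Q) :+ (x :- y) :* R := (x :- y) :* (R :+ x :* Q)) refl

-- Dividing by x - y leaves a quotient with the other points as roots. By induction its coefficients
-- vanish; these are the intermediate values at y, and u r is the next such value minus y times the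
-- previous one.
horner-roots : ∀ u k xs → Unique xs → k ℕ.≤ length xs → (∀ {x} → x ∈ xs → hornerℤ u k x ≡ 0ℤ) →
               ∀ {r} → r ℕ.< k → u r ≡ 0ℤ
horner-roots u (suc k) (y ∷ xs) (y∉xs ∷ uniq) (ℕ.s≤s k≤) root {r} (ℕ.s≤s r≤k) = begin
  u r                          ≡⟨ sym (ℤₚ.+-identityʳ (u r)) ⟩
  u r ℤ.+ 0ℤ                   ≡⟨ cong (λ z → u r ℤ.+ z) (sym (trans (cong (λ z → y ℤ.* z) (previous r r≤k)) (ℤₚ.*-zeroʳ y))) ⟩
  hornerℤ u (suc r) y          ≡⟨ partial r r≤k ⟩
  0ℤ                           ∎
  where
  open ≡-Reasoning
  quotient-root : ∀ {x} → x ∈ xs → hornerℤ (λ r → hornerℤ u (suc r) y) k x ≡ 0ℤ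
  quotient-root {x} x∈xs with ℤₚ.i*j≡0⇒i≡0∨j≡0 (x ℤ.- y)
    (trans (sym (horner-quotient u k x y)) (cong₂ ℤ._-_ (root (there x∈xs)) (root (here refl))))
  ... | inj₂ eq = eq
  ... | inj₁ eq = ⊥-elim (All.lookup y∉xs x∈xs (sym (ℤₚ.i-j≡0⇒i≡j x y eq)))
  partial : ∀ r → r ℕ.≤ k → hornerℤ u (suc r) y ≡ 0ℤ
  partial r r≤k with ℕₚ.m≤n⇒m<n∨m≡n r≤k
  ... | inj₁ r<k  = horner-roots (λ r → hornerℤ u (suc r) y) k xs uniq k≤ quotient-root r<k
  ... | inj₂ refl = root (here refl)
  previous : ∀ r → r ℕ.≤ k → hornerℤ u r y ≡ 0ℤ
  previous zero    _   = refl
  previous (suc r) r<k = partial r (ℕₚ.<⇒≤ r<k)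

hornerℤ-difference : ∀ u v k x → hornerℤ (λ r → ↑ u r ℤ.- ↑ v r) k (↑ x) ≡ ↑ horner u k x ℤ.- ↑ horner v k x
hornerℤ-difference u v zero    x = refl
hornerℤ-difference u v (suc k) x = begin
  (↑ u k ℤ.- ↑ v k) ℤ.+ ↑ x ℤ.* hornerℤ (λ r → ↑ u r ℤ.- ↑ v r) k (↑ x)
    ≡⟨ cong (λ z → (↑ u k ℤ.- ↑ v k) ℤ.+ ↑ x ℤ.* z) (hornerℤ-difference u v k x) ⟩
  (↑ u k ℤ.- ↑ v k) ℤ.+ ↑ x ℤ.* (↑ P ℤ.- ↑ R)
    ≡⟨ rearrange (↑ u k) (↑ v k) (↑ x) (↑ P) (↑ R) ⟩
  (↑ u k ℤ.+ ↑ x ℤ.* ↑ P) ℤ.- (↑ v k ℤ.+ ↑ x ℤ.* ↑ R)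
    ≡⟨ cong₂ (λ a b → (↑ u k ℤ.+ a) ℤ.- (↑ v k ℤ.+ b)) (sym (ℤₚ.pos-* x P)) (sym (ℤₚ.pos-* x R)) ⟩
  ↑ horner u (suc k) x ℤ.- ↑ horner v (suc k) x ∎
  where
  open ≡-Reasoning
  P = horner u k x
  R = horner v k x
  open ℤ-Solver using (solve; _:=_; _:+_; _:*_; _:-_)
  rearrange : ∀ a b x P R → (a ℤ.- b) ℤ.+ x ℤ.* (P ℤ.- R) ≡ (a ℤ.+ x ℤ.* P) ℤ.- (b ℤ.+ x ℤ.* R)
  rearrange = solve 5 (λ a b x P R → (a :- b) :+ x :* (P :- R) := (a :+ x :* P) :- (b :+ x :* R)) refl

-- The distance of the Reed-Solomon code: k points determine a message of length k. The detour over
-- ℤ permits taking the difference of two messages.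
horner-agree : ∀ u v k xs → Unique xs → k ℕ.≤ length xs → (∀ {x} → x ∈ xs → horner u k x ≡ horner v k x) →
               ∀ {r} → r ℕ.< k → u r ≡ v r
horner-agree u v k xs uniq k≤ agree {r} r<k = ℤₚ.+-injective (ℤₚ.i-j≡0⇒i≡j _ _
  (horner-roots (λ r → ↑ u r ℤ.- ↑ v r) k (List.map ↑_ xs) (map⁺ ℤₚ.+-injective uniq)
    (subst (k ℕ.≤_) (sym (Listₚ.length-map ↑_ xs)) k≤) root r<k))
  where
  root : ∀ {z} → z ∈ List.map ↑_ xs → hornerℤ (λ r → ↑ u r ℤ.- ↑ v r) k z ≡ 0ℤ
  root m with ∈-map⁻ ↑_ m
  ... | x , x∈xs , refl = trans (hornerℤ-difference u v k x)
    (trans (cong (λ z → ↑ z ℤ.- ↑ horner v k x) (agree x∈xs)) (ℤₚ.+-inverseʳ (↑ horner v k x)))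

-- The point of this bound is that it is linear in M once n and k are fixed, so the ranges of the
-- symbols cost only a constant factor.
horner-bound : ∀ u M n x → x ℕ.≤ n → 1 ℕ.≤ M → ∀ k → (∀ {r} → r ℕ.< k → u r ℕ.< M) → horner u k x ℕ.< M ℕ.* suc n ℕ.^ k
horner-bound u M n x x≤n 1≤M zero    h = subst (1 ℕ.≤_) (sym (ℕₚ.*-identityʳ M)) 1≤M
horner-bound u M n x x≤n 1≤M (suc k) h = begin-strict
  u k ℕ.+ x ℕ.* horner u k x          <⟨ ℕₚ.+-mono-<-≤ (h ℕₚ.≤-refl) (ℕₚ.*-mono-≤ x≤n (ℕₚ.<⇒≤ (horner-bound u M n x x≤n 1≤M k (h ∘ ℕₚ.m≤n⇒m≤1+n)))) ⟩
  M ℕ.+ n ℕ.* (M ℕ.* E)               ≤⟨ ℕₚ.+-monoˡ-≤ _ (ℕₚ.m≤m*n M E {{ℕₚ.m^n≢0 (suc n) k}}) ⟩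
  M ℕ.* E ℕ.+ n ℕ.* (M ℕ.* E)         ≡⟨ rearrange M E n ⟩
  M ℕ.* suc n ℕ.^ suc k               ∎
  where
  open ℕₚ.≤-Reasoning
  E = suc n ℕ.^ k
  rearrange : ∀ M E n → M ℕ.* E ℕ.+ n ℕ.* (M ℕ.* E) ≡ M ℕ.* (suc n ℕ.* E)
  rearrange = solve 3 (λ M E n → M :* E :+ n :* (M :* E) := M :* ((con 1 :+ n) :* E)) refl
    where open +-*-Solver

-- Injective coding of lists by numbers

pair : ℕ → ℕ → ℕ
pair a b = (a ℕ.+ b) ℕ.* (a ℕ.+ b) ℕ.+ a

-- For s = a + b the code lies between s² and (s + 1)², the latter excluded. So it determines first
-- the sum and then a.
pair-< : ∀ a b c d → a ℕ.+ b ℕ.< c ℕ.+ d → pair a b ℕ.< pair c d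
pair-< a b c d lt = begin-strict
  s ℕ.* s ℕ.+ a              ≤⟨ ℕₚ.+-monoʳ-≤ (s ℕ.* s) (ℕₚ.m≤m+n a b) ⟩
  s ℕ.* s ℕ.+ s              <⟨ ℕₚ.m<m+n (s ℕ.* s ℕ.+ s) {suc s} (ℕ.s≤s ℕ.z≤n) ⟩
  s ℕ.* s ℕ.+ s ℕ.+ suc s    ≡⟨ square s ⟩
  suc s ℕ.* suc s            ≤⟨ ℕₚ.*-mono-≤ lt lt ⟩
  (c ℕ.+ d) ℕ.* (c ℕ.+ d)    ≤⟨ ℕₚ.m≤m+n _ c ⟩
  pair c d                   ∎
  where
  open ℕₚ.≤-Reasoning
  s = a ℕ.+ b
  square : ∀ s → s ℕ.* s ℕ.+ s ℕ.+ suc s ≡ suc s ℕ.* suc s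
  square = solve 1 (λ s → s :* s :+ s :+ (con 1 :+ s) := (con 1 :+ s) :* (con 1 :+ s)) refl
    where open +-*-Solver

pair-injective : ∀ a b c d → pair a b ≡ pair c d → a ≡ c × b ≡ d
pair-injective a b c d eq with ℕₚ.<-cmp (a ℕ.+ b) (c ℕ.+ d)
... | tri< lt _ _ = ⊥-elim (ℕₚ.<⇒≢ (pair-< a b c d lt) eq)
... | tri> _ _ gt = ⊥-elim (ℕₚ.<⇒≢ (pair-< c d a b gt) (sym eq))
... | tri≈ _ s≡s′ _ with ℕₚ.+-cancelˡ-≡ ((c ℕ.+ d) ℕ.* (c ℕ.+ d)) a c (subst (λ s → s ℕ.* s ℕ.+ a ≡ pair c d) s≡s′ eq)
...   | refl = refl , ℕₚ.+-cancelˡ-≡ a b d s≡s′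

encode : List ℕ → ℕ
encode []       = 0
encode (x ∷ xs) = suc (pair x (encode xs))

encode-injective : ∀ xs ys → encode xs ≡ encode ys → xs ≡ ys
encode-injective []       []       eq = refl
encode-injective (x ∷ xs) (y ∷ ys) eq with pair-injective x (encode xs) y (encode ys) (ℕₚ.suc-injective eq)
... | refl , eq′ = cong (x ∷_) (encode-injective xs ys eq′)

-- Even and odd numbers

double : ℕ → ℕ
double zero    = zero
double (suc n) = suc (suc (double n))

parity : ℕ → ℕ ⊎ ℕ
parity zero          = inj₁ 0
parity (suc zero)    = inj₂ 0
parity (suc (suc n)) = Sum.map suc suc (parity n)

parity-even : ∀ n → parity (double n) ≡ inj₁ n
parity-even zero    = refl
parity-even (suc n) = cong (Sum.map suc suc) (parity-even n)

parity-odd : ∀ n → parity (suc (double n)) ≡ inj₂ n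
parity-odd zero    = refl
parity-odd (suc n) = cong (Sum.map suc suc) (parity-odd n)

-- Counting list elements with a property

module _ {X : Set} where

  count-mono : ∀ {P Q : X → Set} (P? : Decidable P) (Q? : Decidable Q) xs → (∀ {x} → P x → Q x) →
               length (filter P? xs) ℕ.≤ length (filter Q? xs)
  count-mono P? Q? []       h = ℕ.z≤n
  count-mono P? Q? (x ∷ xs) h with P? x | Q? x
  ... | yes _ | yes _ = ℕ.s≤s (count-mono P? Q? xs h)
  ... | yes p | no ¬q = ⊥-elim (¬q (h p))
  ... | no _  | yes _ = ℕₚ.m≤n⇒m≤1+n (count-mono P? Q? xs h)
  ... | no _  | no _  = count-mono P? Q? xs h

  count-⊎ : ∀ {P Q R : X → Set} (P? : Decidable P) (Q? : Decidable Q) (R? : Decidable R) xs → (∀ {x} → P x → Q x ⊎ R x) →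
            length (filter P? xs) ℕ.≤ length (filter Q? xs) ℕ.+ length (filter R? xs)
  count-⊎ P? Q? R? []       h = ℕ.z≤n
  count-⊎ P? Q? R? (x ∷ xs) h with P? x | Q? x | R? x
  ... | no _  | no _  | no _  = count-⊎ P? Q? R? xs h
  ... | no _  | no _  | yes _ = ℕₚ.≤-trans (count-⊎ P? Q? R? xs h) (ℕₚ.+-monoʳ-≤ (length (filter Q? xs)) (ℕₚ.n≤1+n _))
  ... | no _  | yes _ | no _  = ℕₚ.m≤n⇒m≤1+n (count-⊎ P? Q? R? xs h)
  ... | no _  | yes _ | yes _ = ℕₚ.m≤n⇒m≤1+n (ℕₚ.≤-trans (count-⊎ P? Q? R? xs h) (ℕₚ.+-monoʳ-≤ (length (filter Q? xs)) (ℕₚ.n≤1+n _)))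
  ... | yes _ | yes _ | no _  = ℕ.s≤s (count-⊎ P? Q? R? xs h)
  ... | yes _ | yes _ | yes _ = ℕ.s≤s (ℕₚ.≤-trans (count-⊎ P? Q? R? xs h) (ℕₚ.+-monoʳ-≤ (length (filter Q? xs)) (ℕₚ.n≤1+n _)))
  ... | yes _ | no _  | yes _ = subst (suc (length (filter P? xs)) ℕ.≤_) (sym (ℕₚ.+-suc (length (filter Q? xs)) (length (filter R? xs)))) (ℕ.s≤s (count-⊎ P? Q? R? xs h))
  ... | yes p | no ¬q | no ¬r = ⊥-elim (Sum.[ ¬q , ¬r ]′ (h p))

  count-all : ∀ {P : X → Set} (P? : Decidable P) xs → (∀ {x} → x ∈ xs → P x) → length xs ℕ.≤ length (filter P? xs)
  count-all P? xs h = ℕₚ.≤-reflexive (cong length (sym (Listₚ.filter-all P? (All.tabulate h))))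

  count-≤1 : ∀ {P : X → Set} (P? : Decidable P) {xs} → Unique xs → (∀ {x y} → P x → P y → x ≡ y) → length (filter P? xs) ℕ.≤ 1
  count-≤1 {P} P? {xs} uniq h = go (filter⁺ P? uniq) (all-filter P? xs)
    where
    go : ∀ {ys} → Unique ys → All P ys → length ys ℕ.≤ 1
    go []                  []           = ℕ.z≤n
    go (_ ∷ [])            (_ ∷ [])     = ℕ.s≤s ℕ.z≤n
    go ((x≢y ∷ _) ∷ _ ∷ _) (p ∷ q ∷ _)  = ⊥-elim (x≢y (h p q))

length-cartesianProductWith : ∀ {X Y Z : Set} (f : X → Y → Z) xs ys →
                              length (List.cartesianProductWith f xs ys) ≡ length xs ℕ.* length ys
length-cartesianProductWith f []       ys = refl
length-cartesianProductWith f (x ∷ xs) ys = trans (Listₚ.length-++ (List.map (f x) ys))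
  (cong₂ ℕ._+_ (Listₚ.length-map (f x) ys) (length-cartesianProductWith f xs ys))

-- Order and zero test of the real field

module Succinctness (ℝ : RealField) where

  open Circuits ℝ
  open RealField ℝ
  module ≤ = IsTotalOrder isTotalOrder

  ℝ-ring : CommutativeRing 0ℓ 0ℓ
  ℝ-ring = record { isCommutativeRing = isCommutativeRing }

  open CommutativeRing ℝ-ring using
    (+-assoc; +-comm; +-identityˡ; +-identityʳ; -‿inverseˡ; -‿inverseʳ;
     *-assoc; *-comm; *-identityˡ; *-identityʳ; zeroˡ; zeroʳ; distribʳ; *-commutativeMonoid)

  open RingProperties (CommutativeRing.ring ℝ-ring) using (-‿involutive; -‿distribˡ-*; -‿distribʳ-*; -0#≈0#)

  0≤1 : 0# ≤ 1#
  0≤1 with ≤.total 0# 1#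
  ... | inj₁ p = p
  ... | inj₂ 1≤0 = subst (0# ≤_) -1*-1≡1 (*-nonneg _ _ 0≤-1 0≤-1)
    where
    0≤-1 : 0# ≤ - 1#
    0≤-1 = subst₂ _≤_ (-‿inverseʳ 1#) (+-identityˡ (- 1#)) (+-mono-≤ _ _ (- 1#) 1≤0)
    -1*-1≡1 : - 1# * - 1# ≡ 1#
    -1*-1≡1 = trans (sym (-‿distribˡ-* 1# (- 1#))) (trans (cong -_ (*-identityˡ (- 1#))) (-‿involutive 1#))

  1≰0 : ¬ (1# ≤ 0#)
  1≰0 p = 0≢1 (≤.antisym 0≤1 p)

  +-nonneg : ∀ {x y} → 0# ≤ x → 0# ≤ y → 0# ≤ x + y
  +-nonneg {x} {y} p q = ≤.trans q (subst (_≤ x + y) (+-identityˡ y) (+-mono-≤ 0# x y p))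

  +≡0ˡ : ∀ {x y} → 0# ≤ x → 0# ≤ y → x + y ≡ 0# → x ≡ 0#
  +≡0ˡ {x} {y} p q eq =
    ≤.antisym (subst₂ _≤_ (+-identityˡ x) (trans (+-comm y x) eq) (+-mono-≤ 0# y x q)) p

  +≡0ʳ : ∀ {x y} → 0# ≤ x → 0# ≤ y → x + y ≡ 0# → y ≡ 0#
  +≡0ʳ {x} {y} p q eq = +≡0ˡ q p (trans (+-comm y x) eq)

  -- The doubly negated zeros have a supremum s, and translating by one of
  -- them leaves s an upper bound.
  ≡0-stable : ∀ x → ¬ ¬ (x ≡ 0#) → x ≡ 0#
  ≡0-stable x ¬¬x≡0 = ≤.antisym (nonpos x ¬¬x≡0) 0≤x
    where
    S : Carrier → Set
    S y = ¬ ¬ (y ≡ 0#)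
    bounded : ∀ y → S y → y ≤ 1#
    bounded y Sy with ≤.total y 1#
    ... | inj₁ p = p
    ... | inj₂ p = ⊥-elim (Sy λ eq → 1≰0 (subst (1# ≤_) eq p))
    sup = complete S (0# , λ ¬p → ¬p refl) (1# , bounded)
    s = proj₁ sup
    cancel : ∀ x → (s + - x) + (- s + x) ≡ 0#
    cancel x = begin
      (s + - x) + (- s + x) ≡⟨ cong ((s + - x) +_) (+-comm (- s) x) ⟩
      (s + - x) + (x + - s) ≡⟨ +-assoc s (- x) (x + - s) ⟩
      s + (- x + (x + - s)) ≡⟨ cong (s +_) (sym (+-assoc (- x) x (- s))) ⟩
      s + ((- x + x) + - s) ≡⟨ cong (λ z → s + (z + - s)) (-‿inverseˡ x) ⟩
      s + (0# + - s)        ≡⟨ cong (s +_) (+-identityˡ (- s)) ⟩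
      s + - s               ≡⟨ -‿inverseʳ s ⟩
      0#                    ∎
      where open ≡-Reasoning
    nonpos : ∀ x → S x → x ≤ 0#
    nonpos x Sx = subst₂ _≤_ left (cancel x) (+-mono-≤ _ _ (- s + x) (proj₂ (proj₂ sup) (s + - x) ub))
      where
      left : s + (- s + x) ≡ x
      left = trans (sym (+-assoc s (- s) x)) (trans (cong (_+ x) (-‿inverseʳ s)) (+-identityˡ x))
      ub : ∀ y → S y → y ≤ s + - x
      ub y Sy = subst (_≤ s + - x) (trans (+-assoc y x (- x)) (trans (cong (y +_) (-‿inverseʳ x)) (+-identityʳ y)))
                  (+-mono-≤ _ _ (- x) (proj₁ (proj₂ sup) (y + x)
                    λ ¬p → Sy λ y≡0 → Sx λ x≡0 → ¬p (trans (cong₂ _+_ y≡0 x≡0) (+-identityˡ 0#))))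
    0≤x : 0# ≤ x
    0≤x = subst₂ _≤_ (-‿inverseˡ x) (+-identityˡ x)
            (+-mono-≤ _ _ x (nonpos (- x) λ ¬p → ¬¬x≡0 λ x≡0 → ¬p (trans (cong -_ x≡0) -0#≈0#)))

  1+1≰1 : ¬ (1# + 1# ≤ 1#)
  1+1≰1 p = 1≰0 (subst₂ _≤_ (trans (+-assoc 1# 1# (- 1#)) (trans (cong (1# +_) (-‿inverseʳ 1#)) (+-identityʳ 1#)))
                         (-‿inverseʳ 1#) (+-mono-≤ _ _ (- 1#) p))

  -- Completeness for arbitrary predicates gives the weak excluded middle: the
  -- supremum of {0} ∪ {2 ∣ x ≡ 0} is comparable with 1.
  _≟0 : ∀ x → Dec (x ≡ 0#)
  x ≟0 = decide (≤.total s 1#)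
    where
    S : Carrier → Set
    S y = y ≡ 0# ⊎ (y ≡ 1# + 1# × x ≡ 0#)
    bounded : ∀ y → S y → y ≤ 1# + 1#
    bounded y (inj₁ refl)       = +-nonneg 0≤1 0≤1
    bounded y (inj₂ (refl , _)) = ≤.refl
    sup = complete S (0# , inj₁ refl) (1# + 1# , bounded)
    s = proj₁ sup
    decide : s ≤ 1# ⊎ 1# ≤ s → Dec (x ≡ 0#)
    decide (inj₁ s≤1) = no λ x≡0 → 1+1≰1 (≤.trans (proj₁ (proj₂ sup) _ (inj₂ (refl , x≡0))) s≤1)
    decide (inj₂ 1≤s) = yes (≡0-stable x λ x≢0 → 1≰0 (≤.trans 1≤s (proj₂ (proj₂ sup) 0# λ
      { y (inj₁ refl) → ≤.refl ; y (inj₂ (_ , x≡0)) → ⊥-elim (x≢0 x≡0) })))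

  *-≢0 : ∀ {x y} → x ≢ 0# → y ≢ 0# → x * y ≢ 0#
  *-≢0 {x} {y} x≢0 y≢0 xy≡0 = y≢0 (begin
    y                 ≡⟨ sym (*-identityˡ y) ⟩
    1# * y            ≡⟨ cong (_* y) (sym (trans (*-comm x⁻¹ x) (proj₂ (inverse x x≢0)))) ⟩
    (x⁻¹ * x) * y     ≡⟨ *-assoc x⁻¹ x y ⟩
    x⁻¹ * (x * y)     ≡⟨ cong (x⁻¹ *_) xy≡0 ⟩
    x⁻¹ * 0#          ≡⟨ zeroʳ x⁻¹ ⟩
    0#                ∎)
    where
    open ≡-Reasoning
    x⁻¹ = proj₁ (inverse x x≢0)

  *-≢0ˡ : ∀ {x y} → x * y ≢ 0# → x ≢ 0#
  *-≢0ˡ {y = y} p refl = p (zeroˡ y)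

  *-≢0ʳ : ∀ {x y} → x * y ≢ 0# → y ≢ 0#
  *-≢0ʳ {x = x} p refl = p (zeroʳ x)

  -- Values of trees, and the circuit classes as conditions on unfoldings

  holds : Lit → Assignment → Bool
  holds (pos x) a = a x
  holds (neg x) a = not (a x)

  eval : Tree Carrier → Assignment → Carrier
  eval (const v)   a = v
  eval (lit ℓ)     a = if holds ℓ a then 1# else 0#
  eval (plus l r)  a = eval l a + eval r a
  eval (times l r) a = eval l a * eval r a

  val-unfold : ∀ {k} (c : Circ Carrier k) a i → val c a i ≡ eval (unfold c i) a
  val-unfold (const v ∷ c)     a zero    = refl
  val-unfold (lit (pos x) ∷ c) a zero    = refl
  val-unfold (lit (neg x) ∷ c) a zero    with a x
  ... | true  = refl
  ... | false = refl
  val-unfold (plus l r ∷ c)    a zero    = cong₂ _+_ (val-unfold c a l) (val-unfold c a r)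
  val-unfold (times l r ∷ c)   a zero    = cong₂ _*_ (val-unfold c a l) (val-unfold c a r)
  val-unfold (g ∷ c)           a (suc i) = val-unfold c a i

  holds-cong : ∀ ℓ {a b} → (∀ x → OccVar {A = Carrier} x (lit ℓ) → a x ≡ b x) → holds ℓ a ≡ holds ℓ b
  holds-cong (pos x) h = h x (inj₁ refl)
  holds-cong (neg x) h = cong not (h x (inj₂ refl))

  eval-cong : ∀ t {a b} → (∀ x → OccVar x t → a x ≡ b x) → eval t a ≡ eval t b
  eval-cong (const v)   h = refl
  eval-cong (lit ℓ)     h = cong (if_then 1# else 0#) (holds-cong ℓ h)
  eval-cong (plus l r)  h = cong₂ _+_ (eval-cong l λ x → h x ∘ Sum.map inj₁ inj₁)
                                      (eval-cong r λ x → h x ∘ Sum.map inj₂ inj₂)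
  eval-cong (times l r) h = cong₂ _*_ (eval-cong l λ x → h x ∘ Sum.map inj₁ inj₁)
                                      (eval-cong r λ x → h x ∘ Sum.map inj₂ inj₂)

  SmoothAt DetAt DecAt WDecAt MonAt : Tree Carrier → Set
  SmoothAt (plus l r)  = ∀ x → (OccVar x l → OccVar x r) × (OccVar x r → OccVar x l)
  SmoothAt _           = ⊤
  DetAt (plus l r)     = ¬ (∃ λ a → eval l a ≢ 0# × eval r a ≢ 0#)
  DetAt _              = ⊤
  DecAt (times l r)    = ∀ x → OccVar x l → OccVar x r → ⊥
  DecAt _              = ⊤
  WDecAt (times l r)   = ∀ x → OccVar x l → OccVar x r →
                         ¬ (Occ (pos x) (times l r) × Occ (neg x) (times l r))
  WDecAt _             = ⊤
  MonAt (const v)      = 0# ≤ v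
  MonAt _              = ⊤

  eval-nonneg : ∀ t → Every MonAt t → ∀ a → 0# ≤ eval t a
  eval-nonneg (const v)   m           a = m
  eval-nonneg (lit ℓ)     m           a with holds ℓ a
  ... | true  = 0≤1
  ... | false = ≤.refl
  eval-nonneg (plus l r)  (_ , m , n) a = +-nonneg (eval-nonneg l m a) (eval-nonneg r n a)
  eval-nonneg (times l r) (_ , m , n) a = *-nonneg _ _ (eval-nonneg l m a) (eval-nonneg r n a)

  tree : AC → Tree Carrier
  tree C = unfold (circ C) zero

  ⟦⟧-eval : ∀ C a → ⟦ C ⟧ a ≡ eval (tree C) a
  ⟦⟧-eval C a = val-unfold (circ C) a zero

  at-gates : {Q : Tree Carrier → Set} (C : AC) →
             (∀ i g → At (circ C) i g → Q (unfoldGate g (unfold (circ C)))) → Every Q (tree C)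
  at-gates {Q} C h = every-unfold (circ C) (λ i → let g , at = gate-At (circ C) i in
                                       subst Q (sym (unfold-At at)) (h i g at)) zero

  -- Here connectedness enters: each node is reachable from the source, so what holds throughout the
  -- unfolding of the source holds at each gate.
  at-gate : {Q : Tree Carrier → Set} (C : AC) → Every Q (tree C) →
            ∀ {i g} → At (circ C) i g → Q (unfoldGate g (unfold (circ C)))
  at-gate {Q} C q {i} at = subst Q (unfold-At at) (every-root (unfold (circ C) i) (every-reach {Q = Q} (connected C i) q))

  module _ (C : AC) where
    private c = circ C

    smooth⇒ : Smooth C → Every SmoothAt (tree C)
    smooth⇒ s = at-gates C λ
      { i (const v) at → tt ; i (lit ℓ) at → tt ; i (times l r) at → tt
      ; i (plus l r) at x → Var⇒OccVar ∘ proj₁ (s i l r at x) ∘ OccVar⇒Var c l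
                          , Var⇒OccVar ∘ proj₂ (s i l r at x) ∘ OccVar⇒Var c r }

    smooth⇐ : Every SmoothAt (tree C) → Smooth C
    smooth⇐ s i l r at x = OccVar⇒Var c r ∘ proj₁ (at-gate C s at x) ∘ Var⇒OccVar
                         , OccVar⇒Var c l ∘ proj₂ (at-gate C s at x) ∘ Var⇒OccVar

    det⇒ : Deterministic C → Every DetAt (tree C)
    det⇒ d = at-gates C λ
      { i (const v) at → tt ; i (lit ℓ) at → tt ; i (times l r) at → tt
      ; i (plus l r) at (a , p , q) → d i l r at
          (a , p ∘ trans (sym (val-unfold c a l)) , q ∘ trans (sym (val-unfold c a r))) }

    det⇐ : Every DetAt (tree C) → Deterministic C
    det⇐ d i l r at (a , p , q) =
      at-gate C d at (a , p ∘ trans (val-unfold c a l) , q ∘ trans (val-unfold c a r))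

    dec⇒ : Decomposable C → Every DecAt (tree C)
    dec⇒ d = at-gates C λ
      { i (const v) at → tt ; i (lit ℓ) at → tt ; i (plus l r) at → tt
      ; i (times l r) at x p q → d i l r at x (OccVar⇒Var c l p) (OccVar⇒Var c r q) }

    dec⇐ : Every DecAt (tree C) → Decomposable C
    dec⇐ d i l r at x p q = at-gate C d at x (Var⇒OccVar p) (Var⇒OccVar q)

    wdec⇒ : WeaklyDecomposable C → Every WDecAt (tree C)
    wdec⇒ d = at-gates C λ
      { i (const v) at → tt ; i (lit ℓ) at → tt ; i (plus l r) at → tt
      ; i (times l r) at x p q (u , v) → d i l r at x (OccVar⇒Var c l p) (OccVar⇒Var c r q)
          (below at u , below at v) }
      where
      below : ∀ {i l r ℓ} → At c i (times l r) → Occ ℓ (times (unfold c l) (unfold c r)) → LitBelow c i ℓ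
      below at (inj₁ o) = LitBelow-child (child-times-l at) (Occ⇒LitBelow c _ o)
      below at (inj₂ o) = LitBelow-child (child-times-r at) (Occ⇒LitBelow c _ o)

    wdec⇐ : Every WDecAt (tree C) → WeaklyDecomposable C
    wdec⇐ d i l r at x p q (u , v) = at-gate C d at x (Var⇒OccVar p) (Var⇒OccVar q)
      (subst (Occ (pos x)) (unfold-At at) (LitBelow⇒Occ u) , subst (Occ (neg x)) (unfold-At at) (LitBelow⇒Occ v))

    mon⇒ : Monotone C → Every MonAt (tree C)
    mon⇒ m = at-gates C λ
      { i (const v) at → m i v at ; i (lit ℓ) at → tt ; i (plus l r) at → tt ; i (times l r) at → tt }

    mon⇐ : Every MonAt (tree C) → Monotone C
    mon⇐ m i v at = at-gate C m at

  realiseAC : ∀ {t L} → Dag L → t ∈ L → ∃ λ C → tree C ≡ t × size C ℕ.≤ length L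
  realiseAC d m = record { Realised R } , Realised.tree≡ R , Realised.size≤ R
    where R = realise d m

  dagAC : ∀ C → ∃ λ L → Dag L × tree C ∈ L × length L ≡ size C
  dagAC C = trees (circ C) , trees-dag (circ C) , unfold∈trees (circ C) zero , length-trees (circ C)

  -- Occurrences of literals, and iterated products

  var : Lit → ℕ
  var (pos x) = x
  var (neg x) = x

  flip : Lit → Lit
  flip (pos x) = neg x
  flip (neg x) = pos x

  _≟Lit_ : (ℓ ℓ′ : Lit) → Dec (ℓ ≡ ℓ′)
  pos x ≟Lit pos y = Dec.map′ (cong pos) (cong var) (x ℕₚ.≟ y)
  pos x ≟Lit neg y = no λ ()
  neg x ≟Lit pos y = no λ ()
  neg x ≟Lit neg y = Dec.map′ (cong neg) (cong var) (x ℕₚ.≟ y)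

  occ? : ∀ ℓ (t : Tree A) → Dec (Occ ℓ t)
  occ? ℓ (const _)   = no λ ()
  occ? ℓ (lit ℓ′)    = ℓ ≟Lit ℓ′
  occ? ℓ (plus l r)  = occ? ℓ l ⊎-dec occ? ℓ r
  occ? ℓ (times l r) = occ? ℓ l ⊎-dec occ? ℓ r

  occVar? : ∀ x (t : Tree A) → Dec (OccVar x t)
  occVar? x t = occ? (pos x) t ⊎-dec occ? (neg x) t

  occ⇒occVar : ∀ ℓ {t : Tree A} → Occ ℓ t → OccVar (var ℓ) t
  occ⇒occVar (pos x) = inj₁
  occ⇒occVar (neg x) = inj₂

  occVar⇒occ : ∀ ℓ {t : Tree A} → OccVar (var ℓ) t → Occ ℓ t ⊎ Occ (flip ℓ) t
  occVar⇒occ (pos x) = id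
  occVar⇒occ (neg x) = Sum.swap

  occVar-lit : ∀ ℓ {x} → OccVar {A} x (lit ℓ) → x ≡ var ℓ
  occVar-lit ℓ (inj₁ refl) = refl
  occVar-lit ℓ (inj₂ refl) = refl

  mul : List (Tree A) → Tree A → Tree A
  mul []       t = t
  mul (f ∷ fs) t = times f (mul fs t)

  Disjoint : Tree A → Tree A → Set
  Disjoint s t = ∀ x → OccVar x s → OccVar x t → ⊥

  occVar-times : ∀ {l r : Tree A} {x} → OccVar x (times l r) → OccVar x l ⊎ OccVar x r
  occVar-times (inj₁ (inj₁ o)) = inj₁ (inj₁ o)
  occVar-times (inj₁ (inj₂ o)) = inj₂ (inj₁ o)
  occVar-times (inj₂ (inj₁ o)) = inj₁ (inj₂ o)
  occVar-times (inj₂ (inj₂ o)) = inj₂ (inj₂ o)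

  occVar-plus : ∀ {l r : Tree A} {x} → OccVar x (plus l r) → OccVar x l ⊎ OccVar x r
  occVar-plus (inj₁ (inj₁ o)) = inj₁ (inj₁ o)
  occVar-plus (inj₁ (inj₂ o)) = inj₂ (inj₁ o)
  occVar-plus (inj₂ (inj₁ o)) = inj₁ (inj₂ o)
  occVar-plus (inj₂ (inj₂ o)) = inj₂ (inj₂ o)

  occVar-mul⁻ : ∀ fs {t : Tree A} {x} → OccVar x (mul fs t) → (∃ λ f → f ∈ fs × OccVar x f) ⊎ OccVar x t
  occVar-mul⁻ []       o = inj₂ o
  occVar-mul⁻ (f ∷ fs) o with occVar-times o
  ... | inj₁ p = inj₁ (f , here refl , p)
  ... | inj₂ p = Sum.map₁ (λ (g , m , q) → g , there m , q) (occVar-mul⁻ fs p)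

  occVar-mul⁺ˡ : ∀ {fs} {t : Tree A} {f x} → f ∈ fs → OccVar x f → OccVar x (mul fs t)
  occVar-mul⁺ˡ (here refl) o = Sum.map inj₁ inj₁ o
  occVar-mul⁺ˡ (there m)   o = Sum.map inj₂ inj₂ (occVar-mul⁺ˡ m o)

  occVar-mul⁺ʳ : ∀ fs {t : Tree A} {x} → OccVar x t → OccVar x (mul fs t)
  occVar-mul⁺ʳ []       o = o
  occVar-mul⁺ʳ (f ∷ fs) o = Sum.map inj₂ inj₂ (occVar-mul⁺ʳ fs o)

  every-mul : ∀ (Q : Tree A → Set) → (∀ l r → Q (times l r)) → ∀ {fs t} → All (Every Q) fs → Every Q t → Every Q (mul fs t)
  every-mul Q q []       e = e
  every-mul Q q (f ∷ fs) e = q _ _ , f , every-mul Q q fs e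

  dec-mul : ∀ {fs t} → AllPairs Disjoint fs → All (λ f → Disjoint f t) fs →
            All (Every DecAt) fs → Every DecAt t → Every DecAt (mul fs t)
  dec-mul []       []       []       e = e
  dec-mul {f ∷ fs} (p ∷ ps) (d ∷ ds) (q ∷ qs) e =
    (λ x o o′ → [ (λ (g , m , o″) → All.lookup p m x o o″) , d x o ]′ (occVar-mul⁻ fs o′)) ,
    q , dec-mul ps ds qs e

  eval-mul-1 : ∀ {fs t a} → All (λ f → eval f a ≡ 1#) fs → eval (mul fs t) a ≡ eval t a
  eval-mul-1 []             = refl
  eval-mul-1 {t = t} {a} (p ∷ ps) = trans (cong₂ _*_ p (eval-mul-1 ps)) (*-identityˡ _)

  eval-mul-0 : ∀ {fs t f a} → f ∈ fs → eval f a ≡ 0# → eval (mul fs t) a ≡ 0#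
  eval-mul-0 (here refl) p = trans (cong (_* _) p) (zeroˡ _)
  eval-mul-0 (there m)   p = trans (cong (_ *_) (eval-mul-0 m p)) (zeroʳ _)

  dag-mul : ∀ fs {L} {t : Tree A} → Dag L → All (_∈ L) fs → t ∈ L →
            ∃ λ L′ → Dag L′ × L ⊆ L′ × mul fs t ∈ L′ × length L′ ≡ length fs ℕ.+ length L
  dag-mul []       d []       m = _ , d , id , m , refl
  dag-mul (f ∷ fs) d (p ∷ ps) m with dag-mul fs d ps m
  ... | L′ , d′ , sub , m′ , eq = _ , times∷ (sub p) m′ d′ , there ∘ sub , here refl , cong suc eq

  litsIn : List (Tree A) → List Lit
  litsIn []                = []
  litsIn (const _ ∷ L)     = litsIn L
  litsIn (lit ℓ ∷ L)       = ℓ ∷ litsIn L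
  litsIn (plus _ _ ∷ L)    = litsIn L
  litsIn (times _ _ ∷ L)   = litsIn L

  length-litsIn : (L : List (Tree A)) → length (litsIn L) ℕ.≤ length L
  length-litsIn []              = ℕ.z≤n
  length-litsIn (const _ ∷ L)   = ℕₚ.m≤n⇒m≤1+n (length-litsIn L)
  length-litsIn (lit ℓ ∷ L)     = ℕ.s≤s (length-litsIn L)
  length-litsIn (plus _ _ ∷ L)  = ℕₚ.m≤n⇒m≤1+n (length-litsIn L)
  length-litsIn (times _ _ ∷ L) = ℕₚ.m≤n⇒m≤1+n (length-litsIn L)

  lit∈litsIn : ∀ {L : List (Tree A)} {ℓ} → lit ℓ ∈ L → ℓ ∈ litsIn L
  lit∈litsIn {L = lit ℓ ∷ L}       (here refl) = here refl
  lit∈litsIn {L = const _ ∷ L}     (there m)   = lit∈litsIn m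
  lit∈litsIn {L = lit ℓ ∷ L}       (there m)   = there (lit∈litsIn m)
  lit∈litsIn {L = plus _ _ ∷ L}    (there m)   = lit∈litsIn m
  lit∈litsIn {L = times _ _ ∷ L}   (there m)   = lit∈litsIn m

  occ⇒∈litsIn : ∀ {L : List (Tree A)} → Dag L → ∀ t {ℓ} → t ∈ L → Occ ℓ t → ℓ ∈ litsIn L
  occ⇒∈litsIn d (lit ℓ)     m refl     = lit∈litsIn m
  occ⇒∈litsIn d (plus l r)  m (inj₁ o) = occ⇒∈litsIn d l (proj₁ (dag-plus d m)) o
  occ⇒∈litsIn d (plus l r)  m (inj₂ o) = occ⇒∈litsIn d r (proj₂ (dag-plus d m)) o
  occ⇒∈litsIn d (times l r) m (inj₁ o) = occ⇒∈litsIn d l (proj₁ (dag-times d m)) o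
  occ⇒∈litsIn d (times l r) m (inj₂ o) = occ⇒∈litsIn d r (proj₂ (dag-times d m)) o

  map-AllPairs : ∀ {B C : Set} {R : B → B → Set} {S : C → C → Set} {g : B → C} {xs} →
                 (∀ {x y} → x ∈ xs → y ∈ xs → R x y → S (g x) (g y)) → AllPairs R xs → AllPairs S (map g xs)
  map-AllPairs h []       = []
  map-AllPairs {S = S} {g} {x ∷ xs} h (p ∷ ps) =
    All.tabulate (λ m → let y , m′ , eq = ∈-map⁻ _ m in
                        subst (S (g x)) (sym eq) (h (here refl) (there m′) (All.lookup p m′))) ∷
    map-AllPairs (λ m m′ → h (there m) (there m′)) ps

  all-map : ∀ {B C : Set} {P : C → Set} {g : B → C} {xs} → (∀ {x} → x ∈ xs → P (g x)) → All P (map g xs)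
  all-map {P = P} h = All.tabulate λ m → let y , m′ , eq = ∈-map⁻ _ m in subst P (sym eq) (h m′)

  -- Smoothing

  taut : ℕ → Tree A
  taut x = plus (lit (pos x)) (lit (neg x))

  occVar-taut : ∀ {x y} → OccVar {A} y (taut x) → y ≡ x
  occVar-taut (inj₁ (inj₁ refl)) = refl
  occVar-taut (inj₂ (inj₂ refl)) = refl

  eval-taut : ∀ x a → eval (taut x) a ≡ 1#
  eval-taut x a with a x
  ... | true  = +-identityʳ 1#
  ... | false = +-identityˡ 1#

  det-taut : ∀ x → Every DetAt (taut x)
  det-taut x = both , tt , tt
    where
    both : DetAt (taut x)
    both (a , p , q) with a x
    ... | true  = q refl
    ... | false = p refl

  smooth-taut : ∀ x → Every SmoothAt (taut x)
  smooth-taut x = (λ y → (λ { (inj₁ refl) → inj₂ refl }) , (λ { (inj₂ refl) → inj₁ refl })) , tt , tt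

  -- `V` enumerates the variables of the circuit. Drawing the missing variables from it bounds the
  -- number of padding factors; coverage yields smoothness, and freedom from repetitions keeps the
  -- padding factors disjoint.
  module Smoothing (V : List ℕ) where

    missing : Tree Carrier → Tree Carrier → List ℕ
    missing l r = filter (λ x → occVar? x r ×-dec ¬? (occVar? x l)) V

    pad : List ℕ → Tree Carrier → Tree Carrier
    pad xs = mul (map taut xs)

    smooth : Tree Carrier → Tree Carrier
    smooth (const v)   = const v
    smooth (lit ℓ)     = lit ℓ
    smooth (plus l r)  = plus (pad (missing l r) (smooth l)) (pad (missing r l) (smooth r))
    smooth (times l r) = times (smooth l) (smooth r)

    ∈-missing⁻ : ∀ l r {x} → x ∈ missing l r → OccVar x r × ¬ OccVar x l
    ∈-missing⁻ l r m = proj₂ (∈-filter⁻ (λ x → occVar? x r ×-dec ¬? (occVar? x l)) {xs = V} m)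

    occVar-pad⁻ : ∀ xs {t x} → OccVar x (pad xs t) → x ∈ xs ⊎ OccVar x t
    occVar-pad⁻ xs o with occVar-mul⁻ (map taut xs) o
    ... | inj₂ p = inj₂ p
    ... | inj₁ (f , m , p) with ∈-map⁻ taut m
    ...   | y , m′ , refl = inj₁ (subst (_∈ xs) (sym (occVar-taut {A = Carrier} p)) m′)

    occVar-pad⁺ : ∀ {xs t x} → x ∈ xs → OccVar x (pad xs t)
    occVar-pad⁺ m = occVar-mul⁺ˡ (∈-map⁺ taut m) (inj₁ (inj₁ refl))

    every-pad : ∀ Q → (∀ l r → Q (times l r)) → (∀ x → Every Q (taut x)) →
                ∀ xs {t} → Every Q t → Every Q (pad xs t)
    every-pad Q q h xs = every-mul Q q (all-map {P = Every Q} {xs = xs} λ {x} _ → h x)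

    eval-pad : ∀ xs t a → eval (pad xs t) a ≡ eval t a
    eval-pad xs t a = eval-mul-1 {map taut xs} (all-map λ {x} _ → eval-taut x a)

    occVar-smooth⁻ : ∀ t {x} → OccVar x (smooth t) → OccVar x t
    occVar-smooth⁻ (const v)   o = o
    occVar-smooth⁻ (lit ℓ)     o = o
    occVar-smooth⁻ (plus l r)  o with occVar-plus o
    ... | inj₁ p = [ Sum.map inj₂ inj₂ ∘ proj₁ ∘ ∈-missing⁻ l r , Sum.map inj₁ inj₁ ∘ occVar-smooth⁻ l ]′
                     (occVar-pad⁻ (missing l r) p)
    ... | inj₂ p = [ Sum.map inj₁ inj₁ ∘ proj₁ ∘ ∈-missing⁻ r l , Sum.map inj₂ inj₂ ∘ occVar-smooth⁻ r ]′
                     (occVar-pad⁻ (missing r l) p)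
    occVar-smooth⁻ (times l r) o with occVar-times o
    ... | inj₁ p = Sum.map inj₁ inj₁ (occVar-smooth⁻ l p)
    ... | inj₂ p = Sum.map inj₂ inj₂ (occVar-smooth⁻ r p)

    occVar-smooth⁺ : ∀ t {x} → OccVar x t → OccVar x (smooth t)
    occVar-smooth⁺ (const v)   o = o
    occVar-smooth⁺ (lit ℓ)     o = o
    occVar-smooth⁺ (plus l r)  o with occVar-plus o
    ... | inj₁ p = Sum.map inj₁ inj₁ (occVar-mul⁺ʳ (map taut (missing l r)) (occVar-smooth⁺ l p))
    ... | inj₂ p = Sum.map inj₂ inj₂ (occVar-mul⁺ʳ (map taut (missing r l)) (occVar-smooth⁺ r p))
    occVar-smooth⁺ (times l r) o with occVar-times o
    ... | inj₁ p = Sum.map inj₁ inj₁ (occVar-smooth⁺ l p)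
    ... | inj₂ p = Sum.map inj₂ inj₂ (occVar-smooth⁺ r p)

    eval-smooth : ∀ t a → eval (smooth t) a ≡ eval t a
    eval-smooth (const v)   a = refl
    eval-smooth (lit ℓ)     a = refl
    eval-smooth (plus l r)  a = cong₂ _+_ (trans (eval-pad (missing l r) _ a) (eval-smooth l a))
                                          (trans (eval-pad (missing r l) _ a) (eval-smooth r a))
    eval-smooth (times l r) a = cong₂ _*_ (eval-smooth l a) (eval-smooth r a)

    mon-smooth : ∀ t → Every MonAt t → Every MonAt (smooth t)
    mon-smooth (const v)   m = m
    mon-smooth (lit ℓ)     m = m
    mon-smooth (plus l r)  (_ , m , n) = tt , every-pad MonAt (λ _ _ → tt) (λ _ → tt , tt , tt) (missing l r) (mon-smooth l m)
                                            , every-pad MonAt (λ _ _ → tt) (λ _ → tt , tt , tt) (missing r l) (mon-smooth r n)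
    mon-smooth (times l r) (_ , m , n) = tt , mon-smooth l m , mon-smooth r n

    det-smooth : ∀ t → Every DetAt t → Every DetAt (smooth t)
    det-smooth (const v)   d = tt
    det-smooth (lit ℓ)     d = tt
    det-smooth (plus l r)  (c , d , e) =
      (λ (a , p , q) → c (a , p ∘ trans (trans (eval-pad (missing l r) _ a) (eval-smooth l a))
                            , q ∘ trans (trans (eval-pad (missing r l) _ a) (eval-smooth r a)))) ,
      every-pad DetAt (λ _ _ → tt) det-taut (missing l r) (det-smooth l d) ,
      every-pad DetAt (λ _ _ → tt) det-taut (missing r l) (det-smooth r e)
    det-smooth (times l r) (_ , d , e) = tt , det-smooth l d , det-smooth r e

    smooth-smooth : ∀ t → (∀ {x} → OccVar x t → x ∈ V) → Every SmoothAt (smooth t)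
    smooth-smooth (const v)   cov = tt
    smooth-smooth (lit ℓ)     cov = tt
    smooth-smooth (times l r) cov = tt , smooth-smooth l (cov ∘ Sum.map inj₁ inj₁) , smooth-smooth r (cov ∘ Sum.map inj₂ inj₂)
    smooth-smooth (plus l r)  cov =
      (λ x → transfer l r (cov ∘ Sum.map inj₁ inj₁) , transfer r l (cov ∘ Sum.map inj₂ inj₂)) ,
      every-pad SmoothAt (λ _ _ → tt) smooth-taut (missing l r) (smooth-smooth l (cov ∘ Sum.map inj₁ inj₁)) ,
      every-pad SmoothAt (λ _ _ → tt) smooth-taut (missing r l) (smooth-smooth r (cov ∘ Sum.map inj₂ inj₂))
      where
      transfer : ∀ l r {x} → (∀ {x} → OccVar x l → x ∈ V) →
                 OccVar x (pad (missing l r) (smooth l)) → OccVar x (pad (missing r l) (smooth r))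
      transfer l r {x} cov o with occVar? x r | occVar-pad⁻ (missing l r) o
      ... | yes p | _      = occVar-mul⁺ʳ (map taut (missing r l)) (occVar-smooth⁺ r p)
      ... | no ¬p | inj₁ m = ⊥-elim (¬p (proj₁ (∈-missing⁻ l r m)))
      ... | no ¬p | inj₂ q = occVar-pad⁺ (∈-filter⁺ _ (cov (occVar-smooth⁻ l q)) (occVar-smooth⁻ l q , ¬p))

    -- Smoothing leaves the variable set of a node unchanged, so old products stay decomposable. In
    -- the new ones a padding variable is missing from the summand and differs from the other
    -- padding variables.
    dec-smooth : Unique V → ∀ t → Every DecAt t → Every DecAt (smooth t)
    dec-smooth u (const v)   d = tt
    dec-smooth u (lit ℓ)     d = tt
    dec-smooth u (times l r) (c , d , e) =
      (λ x p q → c x (occVar-smooth⁻ l p) (occVar-smooth⁻ r q)) , dec-smooth u l d , dec-smooth u r e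
    dec-smooth u (plus l r)  (_ , d , e) = tt , dec-pad l r (dec-smooth u l d) , dec-pad r l (dec-smooth u r e)
      where
      dec-pad : ∀ l r → Every DecAt (smooth l) → Every DecAt (pad (missing l r) (smooth l))
      dec-pad l r d = dec-mul
        (map-AllPairs (λ _ _ x≢y z o o′ → x≢y (trans (sym (occVar-taut {A = Carrier} o)) (occVar-taut {A = Carrier} o′))) (filter⁺ _ u))
        (all-map λ {x} m z o o′ → proj₂ (∈-missing⁻ l r m) (subst (λ z → OccVar z l) (occVar-taut {A = Carrier} o) (occVar-smooth⁻ l o′)))
        (all-map λ _ → tt , tt , tt) d

    dag-base : ∃ λ (L : List (Tree Carrier)) → Dag L × (∀ {x} → x ∈ V → taut x ∈ L) × length L ≡ 3 ℕ.* length V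
    dag-base = go V
      where
      go : ∀ V → ∃ λ (L : List (Tree Carrier)) → Dag L × (∀ {x} → x ∈ V → taut x ∈ L) × length L ≡ 3 ℕ.* length V
      go []      = [] , [] , (λ ()) , refl
      go (x ∷ V) with go V
      ... | L , d , h , eq =
        _ , plus∷ (here refl) (there (here refl)) (lit∷ (lit∷ d)) ,
        (λ { (here refl) → here refl ; (there m) → there (there (there (h m))) }) ,
        trans (cong (3 ℕ.+_) eq) (sym (ℕₚ.*-distribˡ-+ 3 1 (length V)))

    length-missing : ∀ l r → length (map {B = Tree Carrier} taut (missing l r)) ℕ.≤ length V
    length-missing l r = subst (ℕ._≤ _) (sym (Listₚ.length-map taut (missing l r))) (Listₚ.length-filter _ V)

  -- Common size count of both transformations. The image of a node depends on its unfolding only,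
  -- so sharing survives; `M` holds the padding or literal factors once for all, and each node then
  -- costs at most `v` new nodes.
  module _ (M : List (Tree Carrier)) (f : Tree Carrier → Tree Carrier) (b v : ℕ)
           (dag-M : Dag M) (length-M : length M ℕ.≤ b)
           (step : ∀ {L} t → Dag L → M ⊆ L →
                   (∀ l r → t ≡ plus l r ⊎ t ≡ times l r → f l ∈ L × f r ∈ L) →
                   ∃ λ L′ → Dag L′ × L ⊆ L′ × f t ∈ L′ × length L′ ℕ.≤ v ℕ.+ length L) where

    dag-transform : ∀ {L} → Dag L → ∃ λ L′ → Dag L′ × M ⊆ L′ × (∀ {t} → t ∈ L → f t ∈ L′) ×
                                              length L′ ℕ.≤ length L ℕ.* v ℕ.+ b
    dag-cons : ∀ {L} t → Dag L → (∀ l r → t ≡ plus l r ⊎ t ≡ times l r → l ∈ L × r ∈ L) →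
               ∃ λ L′ → Dag L′ × M ⊆ L′ × (∀ {s} → s ∈ t ∷ L → f s ∈ L′) ×
                        length L′ ℕ.≤ suc (length L) ℕ.* v ℕ.+ b
    dag-cons {L} t d ch with dag-transform d
    ... | L₁ , d₁ , sub₁ , h₁ , len₁ with step t d₁ sub₁ (λ l r eq → let p , q = ch l r eq in h₁ p , h₁ q)
    ...   | L₂ , d₂ , sub₂ , m , len₂ = L₂ , d₂ , sub₂ ∘ sub₁ , (λ { (here refl) → m ; (there p) → sub₂ (h₁ p) }) ,
      (begin
        length L₂                                 ≤⟨ len₂ ⟩
        v ℕ.+ length L₁                           ≤⟨ ℕₚ.+-monoʳ-≤ v len₁ ⟩
        v ℕ.+ (length L ℕ.* v ℕ.+ b)              ≡⟨ sym (ℕₚ.+-assoc v _ b) ⟩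
        suc (length L) ℕ.* v ℕ.+ b                ∎)
      where open ℕₚ.≤-Reasoning
    dag-transform []             = M , dag-M , id , (λ ()) , length-M
    dag-transform (const∷ d)     = dag-cons _ d λ { _ _ (inj₁ ()) ; _ _ (inj₂ ()) }
    dag-transform (lit∷ d)       = dag-cons _ d λ { _ _ (inj₁ ()) ; _ _ (inj₂ ()) }
    dag-transform (plus∷ p q d)  = dag-cons _ d λ { _ _ (inj₁ refl) → p , q }
    dag-transform (times∷ p q d) = dag-cons _ d λ { _ _ (inj₂ refl) → p , q }

  -- Removing pure literals

  Pure : Lit → Tree A → Set
  Pure ℓ t = Occ ℓ t × ¬ Occ (flip ℓ) t

  pure? : ∀ ℓ (t : Tree A) → Dec (Pure ℓ t)
  pure? ℓ t = occ? ℓ t ×-dec ¬? (occ? (flip ℓ) t)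

  Mixed : ℕ → Tree A → Set
  Mixed x t = Occ (pos x) t × Occ (neg x) t

  mixed : ∀ ℓ (t : Tree A) → Occ ℓ t → Occ (flip ℓ) t → Mixed (var ℓ) t
  mixed (pos x) t p q = p , q
  mixed (neg x) t p q = q , p

  mixed⇒¬pure : ∀ ℓ (t : Tree A) → Mixed (var ℓ) t → ¬ Pure ℓ t
  mixed⇒¬pure (pos x) t (p , q) (_ , ¬q) = ¬q q
  mixed⇒¬pure (neg x) t (p , q) (_ , ¬p) = ¬p p

  occVar⇒pure⊎mixed : ∀ x (t : Tree A) → OccVar x t → (∃ λ ℓ → var ℓ ≡ x × Pure ℓ t) ⊎ Mixed x t
  occVar⇒pure⊎mixed x t o with occ? (pos x) t | occ? (neg x) t
  ... | yes p | yes q = inj₂ (p , q)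
  ... | yes p | no ¬q = inj₁ (pos x , refl , p , ¬q)
  ... | no ¬p | yes q = inj₁ (neg x , refl , q , ¬p)
  ... | no ¬p | no ¬q = ⊥-elim ([ ¬p , ¬q ]′ o)

  -- Below a smooth weakly decomposable node t, a literal that is pure in t
  -- occurs in every certificate of t, so it can be factored out of t; by
  -- idempotence it is then harmless that both children of a product lose it.
  -- A summand gets back the literals that are pure in it but not in the sum.
  module Purify (Λ : List Lit) where

    -- `K` collects the literals that the context already guarantees: those pure in the parent sum,
    -- or none at the source.
    lost : {K : Lit → Set} → Decidable K → Tree Carrier → List Lit
    lost K? l = filter (λ ℓ → pure? ℓ l ×-dec ¬? (K? ℓ)) Λ

    restore : {K : Lit → Set} → Decidable K → Tree Carrier → Tree Carrier → Tree Carrier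
    restore K? l = mul (map lit (lost K? l))

    pureIn? : (t : Tree Carrier) → Decidable (λ ℓ → Pure ℓ t)
    pureIn? t ℓ = pure? ℓ t

    strip : Tree Carrier → Tree Carrier
    strip (const v)   = const v
    -- A literal is pure in itself, so nothing remains of it.
    strip (lit ℓ)     = const 1#
    strip (plus l r)  = plus (restore (pureIn? (plus l r)) l (strip l))
                             (restore (pureIn? (plus l r)) r (strip r))
    strip (times l r) = times (strip l) (strip r)

    none? : Decidable {A = Lit} (λ _ → ⊥)
    none? _ = no id

    -- No context guarantees anything at the source, so it gets back all its pure literals.
    purify : Tree Carrier → Tree Carrier
    purify t = restore none? t (strip t)

    ∈-lost⁻ : ∀ {K} (K? : Decidable K) l {ℓ} → ℓ ∈ lost K? l → Pure ℓ l × ¬ K ℓ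
    ∈-lost⁻ K? l m = proj₂ (∈-filter⁻ (λ ℓ → pure? ℓ l ×-dec ¬? (K? ℓ)) {xs = Λ} m)

    Covered : Tree Carrier → Set
    Covered t = ∀ {ℓ} → Occ ℓ t → ℓ ∈ Λ

    Below : Tree Carrier → Tree Carrier → Set
    Below l t = (∀ {ℓ} → Occ ℓ l → Occ ℓ t) × (∀ {x} → OccVar x t → OccVar x l)

    -- By smoothness a summand has all variables of the sum but possibly fewer literals. So the
    -- variable occurs in the summand, and only with the polarity it has in the sum.
    pure-below : ∀ l t → Below l t → ∀ ℓ → Pure ℓ t → Pure ℓ l
    pure-below l t (up , down) ℓ (o , ¬o) =
      [ id , ⊥-elim ∘ ¬o ∘ up ]′ (occVar⇒occ ℓ {l} (down (occ⇒occVar ℓ {t} o))) , ¬o ∘ up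

    below-l : ∀ l r → SmoothAt (plus l r) → Below l (plus l r)
    below-l l r s = inj₁ , λ {x} o → [ id , proj₂ (s x) ]′ (occVar-plus {l = l} {r} o)

    below-r : ∀ l r → SmoothAt (plus l r) → Below r (plus l r)
    below-r l r s = inj₂ , λ {x} o → [ proj₁ (s x) , id ]′ (occVar-plus {l = l} {r} o)

    -- A restored literal is pure in the summand but not in the sum, so its complement enters from
    -- the other summand and the variable is mixed in the sum.
    occVar-restore⁻ : ∀ l t → (∀ {ℓ} → Occ ℓ l → Occ ℓ t) →
                      ∀ {s x} → (OccVar x s → Mixed x l) → OccVar x (restore (pureIn? t) l s) → Mixed x t
    occVar-restore⁻ l t up ih o with occVar-mul⁻ (map lit (lost (pureIn? t) l)) o
    ... | inj₂ p = let u , v = ih p in up u , up v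
    ... | inj₁ (f , m , p) with ∈-map⁻ lit m
    ...   | ℓ , m′ , refl with occVar-lit {A = Carrier} ℓ p | occ? (flip ℓ) t | ∈-lost⁻ (pureIn? t) l m′
    ...     | refl | yes q | (u , _) , _  = mixed ℓ t (up u) q
    ...     | refl | no ¬q | (u , _) , ¬k = ⊥-elim (¬k (up u , ¬q))

    occVar-restore⁺ : ∀ l t → Covered l → (∀ {x} → OccVar x t → OccVar x l) →
                      ∀ {s x} → (Mixed x l → OccVar x s) → Mixed x t → OccVar x (restore (pureIn? t) l s)
    occVar-restore⁺ l t cov down {s} {x} ih m with occVar⇒pure⊎mixed x l (down (inj₁ (proj₁ m)))
    ... | inj₂ m′ = occVar-mul⁺ʳ (map lit (lost (pureIn? t) l)) (ih m′)
    ... | inj₁ (ℓ , refl , p) =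
      occVar-mul⁺ˡ {t = s} (∈-map⁺ lit (∈-filter⁺ (λ ℓ → pure? ℓ l ×-dec ¬? (pureIn? t ℓ)) (cov (proj₁ p))
        (p , mixed⇒¬pure ℓ t m))) (occ⇒occVar {A = Carrier} ℓ {lit ℓ} refl)

    -- Together with `occVar-strip⁺`, the central invariant: exactly the mixed variables survive
    -- stripping. Smoothness and decomposability of the result are read off from it.
    occVar-strip⁻ : ∀ t {x} → OccVar x (strip t) → Mixed x t
    occVar-strip⁻ (const v)   (inj₁ ())
    occVar-strip⁻ (const v)   (inj₂ ())
    occVar-strip⁻ (lit ℓ)     (inj₁ ())
    occVar-strip⁻ (lit ℓ)     (inj₂ ())
    occVar-strip⁻ (plus l r)  o with occVar-plus o
    ... | inj₁ p = occVar-restore⁻ l (plus l r) inj₁ (occVar-strip⁻ l) p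
    ... | inj₂ p = occVar-restore⁻ r (plus l r) inj₂ (occVar-strip⁻ r) p
    occVar-strip⁻ (times l r) o with occVar-times o
    ... | inj₁ p = let u , v = occVar-strip⁻ l p in inj₁ u , inj₁ v
    ... | inj₂ p = let u , v = occVar-strip⁻ r p in inj₂ u , inj₂ v

    -- Opposite polarities coming from different factors would make a shared variable mixed, which
    -- weak decomposability forbids.
    mixed-times : ∀ {l r x} → WDecAt (times l r) → Mixed x (times l r) → Mixed x l ⊎ Mixed x r
    mixed-times         w (inj₁ p , inj₁ q) = inj₁ (p , q)
    mixed-times {x = x} w (inj₁ p , inj₂ q) = ⊥-elim (w x (inj₁ p) (inj₂ q) (inj₁ p , inj₂ q))
    mixed-times {x = x} w (inj₂ p , inj₁ q) = ⊥-elim (w x (inj₂ q) (inj₁ p) (inj₂ p , inj₁ q))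
    mixed-times         w (inj₂ p , inj₂ q) = inj₂ (p , q)

    occVar-strip⁺ : ∀ t → Covered t → Every SmoothAt t → Every WDecAt t → ∀ {x} → Mixed x t → OccVar x (strip t)
    occVar-strip⁺ (lit (pos x)) cov s w (refl , ())
    occVar-strip⁺ (lit (neg x)) cov s w (() , _)
    occVar-strip⁺ (plus l r)  cov (s , sl , sr) (_ , wl , wr) m =
      Sum.map inj₁ inj₁ (occVar-restore⁺ l (plus l r) (cov ∘ inj₁)
                           (proj₂ (below-l l r s)) (occVar-strip⁺ l (cov ∘ inj₁) sl wl) m)
    occVar-strip⁺ (times l r) cov (_ , sl , sr) (w , wl , wr) m with mixed-times {l} {r} w m
    ... | inj₁ p = Sum.map inj₁ inj₁ (occVar-strip⁺ l (cov ∘ inj₁) sl wl p)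
    ... | inj₂ p = Sum.map inj₂ inj₂ (occVar-strip⁺ r (cov ∘ inj₂) sr wr p)

    lit-true : ∀ ℓ {a} → holds ℓ a ≡ true → eval (lit ℓ) a ≡ 1#
    lit-true ℓ p = cong (if_then 1# else 0#) p

    lit-false : ∀ ℓ {a} → holds ℓ a ≡ false → eval (lit ℓ) a ≡ 0#
    lit-false ℓ p = cong (if_then 1# else 0#) p

    -- A pure literal is pure in both summands of a smooth sum and in some factor of a product, so
    -- its falsity propagates zeros from the leaves to t.
    pure-false : ∀ t → Every SmoothAt t → ∀ {ℓ a} → Pure ℓ t → holds ℓ a ≡ false → eval t a ≡ 0#
    pure-false (lit ℓ)     s (refl , _) h = lit-false ℓ h
    pure-false (plus l r)  (s , sl , sr) {ℓ} p h =
      trans (cong₂ _+_ (pure-false l sl (pure-below l (plus l r) (below-l l r s) ℓ p) h)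
                       (pure-false r sr (pure-below r (plus l r) (below-r l r s) ℓ p) h)) (+-identityˡ 0#)
    pure-false (times l r) (_ , sl , sr) (inj₁ o , ¬o) h =
      trans (cong (_* _) (pure-false l sl (o , ¬o ∘ inj₁) h)) (zeroˡ _)
    pure-false (times l r) (_ , sl , sr) (inj₂ o , ¬o) h =
      trans (cong (_ *_) (pure-false r sr (o , ¬o ∘ inj₂) h)) (zeroʳ _)

    AllPure : Tree Carrier → Assignment → Set
    AllPure t a = ∀ ℓ → Pure ℓ t → holds ℓ a ≡ true

    -- A false restored literal makes both sides zero, the right one by `pure-false`. If all of them
    -- are true, then with the guaranteed ones every pure literal of l holds, and the inductive
    -- equation applies.
    eval-restore : ∀ {K} (K? : Decidable K) l {s a} → Covered l → Every SmoothAt l →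
                   (∀ ℓ → K ℓ → holds ℓ a ≡ true) → (AllPure l a → eval s a ≡ eval l a) →
                   eval (restore K? l s) a ≡ eval l a
    eval-restore {K} K? l {s} {a} cov sm kept ih
      with Any.any? (λ ℓ → holds ℓ a Boolₚ.≟ false) (lost K? l)
    ... | yes any = let ℓ , m , h = find any in
      trans (eval-mul-0 (∈-map⁺ lit m) (lit-false ℓ h)) (sym (pure-false l sm (proj₁ (∈-lost⁻ K? l m)) h))
    ... | no ¬any = trans (eval-mul-1 {map lit (lost K? l)} (all-map λ {ℓ} m → lit-true ℓ (true′ m))) (ih allPure)
      where
      true′ : ∀ {ℓ} → ℓ ∈ lost K? l → holds ℓ a ≡ true
      true′ {ℓ} m with holds ℓ a in eq
      ... | true  = refl
      ... | false = ⊥-elim (¬any (lose m eq))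
      allPure : AllPure l a
      allPure ℓ p with K? ℓ
      ... | yes k = kept ℓ k
      ... | no ¬k = true′ (∈-filter⁺ (λ ℓ → pure? ℓ l ×-dec ¬? (K? ℓ)) (cov (proj₁ p)) (p , ¬k))

    eval-strip : ∀ t {a} → Covered t → Every SmoothAt t → Every WDecAt t → AllPure t a → eval (strip t) a ≡ eval t a
    eval-strip (const v)   cov s w h = refl
    eval-strip (lit ℓ)     cov s w h = sym (lit-true ℓ (h ℓ (refl , flip≢ ℓ)))
      where
      flip≢ : ∀ ℓ → flip ℓ ≢ ℓ
      flip≢ (pos x) ()
      flip≢ (neg x) ()
    eval-strip (plus l r)  cov (s , sl , sr) (_ , wl , wr) h = cong₂ _+_
      (eval-restore (pureIn? (plus l r)) l (cov ∘ inj₁) sl h (eval-strip l (cov ∘ inj₁) sl wl))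
      (eval-restore (pureIn? (plus l r)) r (cov ∘ inj₂) sr h (eval-strip r (cov ∘ inj₂) sr wr))
    -- A literal pure in one factor is pure in the product: its complement in the other factor would
    -- contradict weak decomposability. So the hypothesis on pure literals passes to both factors.
    eval-strip (times l r) cov (_ , sl , sr) (w , wl , wr) h = cong₂ _*_
      (eval-strip l (cov ∘ inj₁) sl wl λ ℓ (o , ¬o) → h ℓ (inj₁ o ,
        [ ¬o , (λ o′ → clash ℓ (occ⇒occVar ℓ {l} o) (flipVar ℓ {r} o′) (inj₁ o) (inj₂ o′)) ]′))
      (eval-strip r (cov ∘ inj₂) sr wr λ ℓ (o , ¬o) → h ℓ (inj₂ o ,
        [ (λ o′ → clash ℓ (flipVar ℓ {l} o′) (occ⇒occVar ℓ {r} o) (inj₂ o) (inj₁ o′)) , ¬o ]′))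
      where
      flipVar : ∀ ℓ {t} → Occ (flip ℓ) t → OccVar {A = Carrier} (var ℓ) t
      flipVar (pos x) = inj₂
      flipVar (neg x) = inj₁
      clash : ∀ ℓ → OccVar (var ℓ) l → OccVar (var ℓ) r → Occ ℓ (times l r) → ¬ Occ (flip ℓ) (times l r)
      clash ℓ p q o o′ = w (var ℓ) p q (mixed ℓ (times l r) o o′)

    eval-purify : ∀ t a → Covered t → Every SmoothAt t → Every WDecAt t → eval (purify t) a ≡ eval t a
    eval-purify t a cov s w = eval-restore none? t cov s (λ _ ()) (eval-strip t cov s w)

    every-restore : ∀ Q → (∀ l r → Q (times l r)) → (∀ ℓ → Q (lit ℓ)) →
                    ∀ {K} (K? : Decidable K) l {s} → Every Q s → Every Q (restore K? l s)
    every-restore Q q h K? l = every-mul Q q (all-map {P = Every Q} {xs = lost K? l} λ {ℓ} _ → h ℓ)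

    mon-strip : ∀ t → Every MonAt t → Every MonAt (strip t)
    mon-strip (const v)   m = m
    mon-strip (lit ℓ)     m = 0≤1
    mon-strip (plus l r)  (_ , m , n) =
      tt , every-restore MonAt (λ _ _ → tt) (λ _ → tt) (pureIn? (plus l r)) l (mon-strip l m)
         , every-restore MonAt (λ _ _ → tt) (λ _ → tt) (pureIn? (plus l r)) r (mon-strip r n)
    mon-strip (times l r) (_ , m , n) = tt , mon-strip l m , mon-strip r n

    smooth-strip : ∀ t → Covered t → Every SmoothAt t → Every WDecAt t → Every SmoothAt (strip t)
    smooth-strip (const v)   cov s w = tt
    smooth-strip (lit ℓ)     cov s w = tt
    smooth-strip (times l r) cov (_ , sl , sr) (_ , wl , wr) =
      tt , smooth-strip l (cov ∘ inj₁) sl wl , smooth-strip r (cov ∘ inj₂) sr wr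
    smooth-strip (plus l r)  cov (s , sl , sr) (_ , wl , wr) =
      (λ x → right ∘ fromLeft , left ∘ fromRight) ,
      every-restore SmoothAt (λ _ _ → tt) (λ _ → tt) K? l (smooth-strip l (cov ∘ inj₁) sl wl) ,
      every-restore SmoothAt (λ _ _ → tt) (λ _ → tt) K? r (smooth-strip r (cov ∘ inj₂) sr wr)
      where
      t = plus l r
      K? = pureIn? t
      fromLeft : ∀ {x} → OccVar x (restore K? l (strip l)) → Mixed x t
      fromLeft = occVar-restore⁻ l t inj₁ (occVar-strip⁻ l)
      fromRight : ∀ {x} → OccVar x (restore K? r (strip r)) → Mixed x t
      fromRight = occVar-restore⁻ r t inj₂ (occVar-strip⁻ r)
      left : ∀ {x} → Mixed x t → OccVar x (restore K? l (strip l))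
      left = occVar-restore⁺ l t (cov ∘ inj₁) (proj₂ (below-l l r s)) (occVar-strip⁺ l (cov ∘ inj₁) sl wl)
      right : ∀ {x} → Mixed x t → OccVar x (restore K? r (strip r))
      right = occVar-restore⁺ r t (cov ∘ inj₂) (proj₂ (below-r l r s)) (occVar-strip⁺ r (cov ∘ inj₂) sr wr)

    -- Stripping preserves values only where the pure literals hold. As stripped summands see mixed
    -- variables only, any assignment may be changed to one making the pure literals true; this
    -- carries determinism over.
    force : Tree Carrier → Assignment → Assignment
    force t a x with pure? (pos x) t | pure? (neg x) t
    ... | yes _ | _     = true
    ... | no _  | yes _ = false
    ... | no _  | no _  = a x

    force-pure : ∀ t a → AllPure t (force t a)
    force-pure t a (pos x) p with pure? (pos x) t
    ... | yes _ = refl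
    ... | no ¬p = ⊥-elim (¬p p)
    force-pure t a (neg x) p with pure? (pos x) t | pure? (neg x) t
    ... | yes q | _     = ⊥-elim (proj₂ p (proj₁ q))
    ... | no _  | yes _ = refl
    ... | no _  | no ¬p = ⊥-elim (¬p p)

    force-mixed : ∀ t a {x} → Mixed x t → a x ≡ force t a x
    force-mixed t a {x} m with pure? (pos x) t | pure? (neg x) t
    ... | yes p | _     = ⊥-elim (mixed⇒¬pure (pos x) t m p)
    ... | no _  | yes p = ⊥-elim (mixed⇒¬pure (neg x) t m p)
    ... | no _  | no _  = refl

    det-strip : ∀ t → Covered t → Every SmoothAt t → Every WDecAt t → Every DetAt t → Every DetAt (strip t)
    det-strip (const v)   cov s w d = tt
    det-strip (lit ℓ)     cov s w d = tt
    det-strip (times l r) cov (_ , sl , sr) (_ , wl , wr) (_ , dl , dr) =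
      tt , det-strip l (cov ∘ inj₁) sl wl dl , det-strip r (cov ∘ inj₂) sr wr dr
    det-strip (plus l r)  cov (s , sl , sr) (_ , wl , wr) (d , dl , dr) =
      (λ (a , p , q) → d (force t a , p ∘ trans (evalˡ a) , q ∘ trans (evalʳ a))) ,
      every-restore DetAt (λ _ _ → tt) (λ _ → tt) K? l (det-strip l (cov ∘ inj₁) sl wl dl) ,
      every-restore DetAt (λ _ _ → tt) (λ _ → tt) K? r (det-strip r (cov ∘ inj₂) sr wr dr)
      where
      t = plus l r
      K? = pureIn? t
      evalˡ : ∀ a → eval (restore K? l (strip l)) a ≡ eval l (force t a)
      evalˡ a = trans
        (eval-cong (restore K? l (strip l)) λ x o →
          force-mixed t a (occVar-restore⁻ l t inj₁ (occVar-strip⁻ l) o))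
        (eval-restore K? l (cov ∘ inj₁) sl (force-pure t a) (eval-strip l (cov ∘ inj₁) sl wl))
      evalʳ : ∀ a → eval (restore K? r (strip r)) a ≡ eval r (force t a)
      evalʳ a = trans
        (eval-cong (restore K? r (strip r)) λ x o →
          force-mixed t a (occVar-restore⁻ r t inj₂ (occVar-strip⁻ r) o))
        (eval-restore K? r (cov ∘ inj₂) sr (force-pure t a) (eval-strip r (cov ∘ inj₂) sr wr))

    dec-restore : Unique Λ → ∀ {K} (K? : Decidable K) l → Every DecAt (strip l) → Every DecAt (restore K? l (strip l))
    dec-restore u K? l d = dec-mul (map-AllPairs disjoint (filter⁺ _ u))
      (all-map λ {ℓ} m x o o′ → mixed⇒¬pure ℓ l
        (subst (λ x → Mixed x l) (occVar-lit {A = Carrier} ℓ o) (occVar-strip⁻ l o′)) (proj₁ (∈-lost⁻ K? l m)))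
      (all-map λ _ → tt) d
      where
      same : ∀ ℓ ℓ′ → Pure ℓ l → Pure ℓ′ l → var ℓ ≡ var ℓ′ → ℓ ≡ ℓ′
      same (pos x) (pos .x) p q refl = refl
      same (pos x) (neg .x) p q refl = ⊥-elim (proj₂ p (proj₁ q))
      same (neg x) (pos .x) p q refl = ⊥-elim (proj₂ p (proj₁ q))
      same (neg x) (neg .x) p q refl = refl
      disjoint : ∀ {ℓ ℓ′} → ℓ ∈ lost K? l → ℓ′ ∈ lost K? l → ℓ ≢ ℓ′ → Disjoint {A = Carrier} (lit ℓ) (lit ℓ′)
      disjoint {ℓ} {ℓ′} m m′ ℓ≢ℓ′ x o o′ = ℓ≢ℓ′ (same ℓ ℓ′ (proj₁ (∈-lost⁻ K? l m)) (proj₁ (∈-lost⁻ K? l m′))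
        (trans (sym (occVar-lit {A = Carrier} ℓ o)) (occVar-lit {A = Carrier} ℓ′ o′)))

    -- A variable left in both factors is mixed in each of them, hence shared with both polarities,
    -- against weak decomposability.
    dec-strip : Unique Λ → ∀ t → Every WDecAt t → Every DecAt (strip t)
    dec-strip u (const v)   w = tt
    dec-strip u (lit ℓ)     w = tt
    dec-strip u (plus l r)  (_ , wl , wr) = tt , dec-restore u (pureIn? (plus l r)) l (dec-strip u l wl) , dec-restore u (pureIn? (plus l r)) r (dec-strip u r wr)
    dec-strip u (times l r) (w , wl , wr) =
      (λ x p q → let pl , nl = occVar-strip⁻ l p ; pr , _ = occVar-strip⁻ r q in
                 w x (inj₁ pl) (inj₁ pr) (inj₁ pl , inj₁ nl)) ,
      dec-strip u l wl , dec-strip u r wr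

    dag-base : ∃ λ (L : List (Tree Carrier)) → Dag L × (∀ {ℓ} → ℓ ∈ Λ → lit ℓ ∈ L) × length L ≡ length Λ
    dag-base = go Λ
      where
      go : ∀ Λ → ∃ λ (L : List (Tree Carrier)) → Dag L × (∀ {ℓ} → ℓ ∈ Λ → lit ℓ ∈ L) × length L ≡ length Λ
      go []      = [] , [] , (λ ()) , refl
      go (ℓ ∷ Λ) with go Λ
      ... | L , d , h , eq = _ , lit∷ d , (λ { (here refl) → here refl ; (there m) → there (h m) }) , cong suc eq

    length-lost : ∀ {K} (K? : Decidable K) l → length (map {B = Tree Carrier} lit (lost K? l)) ℕ.≤ length Λ
    length-lost K? l = subst (ℕ._≤ _) (sym (Listₚ.length-map lit (lost K? l))) (Listₚ.length-filter _ Λ)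

  -- Polynomial bounds and the composition of simulations

  evalPoly≤ : ∀ p s → 1 ℕ.≤ s → evalPoly p s ℕ.≤ sum p ℕ.* s ℕ.^ length p
  evalPoly≤ []      s 1≤s = ℕ.z≤n
  evalPoly≤ (c ∷ p) s@(suc _) 1≤s = begin
    c ℕ.+ s ℕ.* evalPoly p s                     ≤⟨ ℕₚ.+-mono-≤ (ℕₚ.m≤m*n c (s ℕ.^ suc d) {{ℕₚ.m^n≢0 s (suc d)}})
                                                    (ℕₚ.*-monoʳ-≤ s (evalPoly≤ p s 1≤s)) ⟩
    c ℕ.* s ℕ.^ suc d ℕ.+ s ℕ.* (sum p ℕ.* s ℕ.^ d) ≡⟨ lemma c s (sum p) (s ℕ.^ d) ⟩
    (c ℕ.+ sum p) ℕ.* s ℕ.^ suc d                ∎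
    where
    open ℕₚ.≤-Reasoning
    d = length p
    lemma : ∀ c s q e → c ℕ.* (s ℕ.* e) ℕ.+ s ℕ.* (q ℕ.* e) ≡ (c ℕ.+ q) ℕ.* (s ℕ.* e)
    lemma = solve 4 (λ c s q e → c :* (s :* e) :+ s :* (q :* e) := (c :+ q) :* (s :* e)) refl
      where open +-*-Solver

  monomial : ℕ → ℕ → List ℕ
  monomial K zero    = K ∷ []
  monomial K (suc d) = 0 ∷ monomial K d

  evalPoly-monomial : ∀ K d s → evalPoly (monomial K d) s ≡ K ℕ.* s ℕ.^ d
  evalPoly-monomial K zero    s = trans (cong (K ℕ.+_) (ℕₚ.*-zeroʳ s)) (trans (ℕₚ.+-identityʳ K) (sym (ℕₚ.*-identityʳ K)))
  evalPoly-monomial K (suc d) s = trans (cong (s ℕ.*_) (evalPoly-monomial K d s)) (lemma s K (s ℕ.^ d))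
    where
    lemma : ∀ s K e → s ℕ.* (K ℕ.* e) ≡ K ℕ.* (s ℕ.* e)
    lemma = solve 3 (λ s K e → s :* (K :* e) := K :* (s :* e)) refl
      where open +-*-Solver

  -- Sizes are at least 1, so a polynomial is dominated by a monomial; monomials are closed under
  -- composition, and their degree is what both separations fight against.
  Simulates : Class → Class → ℕ → ℕ → Set
  Simulates 𝒞₁ 𝒞₂ K d = ∀ C₂ → 𝒞₂ C₂ → ∃ λ C₁ → 𝒞₁ C₁ × SameFunction C₁ C₂ × size C₁ ℕ.≤ K ℕ.* size C₂ ℕ.^ d

  ≼⇒simulates : ∀ {𝒞₁ 𝒞₂} → 𝒞₁ ≼ 𝒞₂ → ∃ λ K → ∃ λ d → Simulates 𝒞₁ 𝒞₂ K d
  ≼⇒simulates (p , sim) = sum p , length p , λ C₂ c₂ → let C₁ , c₁ , eq , le = sim C₂ c₂ in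
    C₁ , c₁ , eq , ℕₚ.≤-trans le (evalPoly≤ p (size C₂) (ℕ.s≤s ℕ.z≤n))

  simulates⇒≼ : ∀ {𝒞₁ 𝒞₂} K d → Simulates 𝒞₁ 𝒞₂ K d → 𝒞₁ ≼ 𝒞₂
  simulates⇒≼ K d sim = monomial K d , λ C₂ c₂ → let C₁ , c₁ , eq , le = sim C₂ c₂ in
    C₁ , c₁ , eq , subst (_ ℕ.≤_) (sym (evalPoly-monomial K d (size C₂))) le

  ^-distribʳ-* : ∀ d x y → (x ℕ.* y) ℕ.^ d ≡ x ℕ.^ d ℕ.* y ℕ.^ d
  ^-distribʳ-* zero    x y = refl
  ^-distribʳ-* (suc d) x y = trans (cong (x ℕ.* y ℕ.*_) (^-distribʳ-* d x y)) (lemma x y (x ℕ.^ d) (y ℕ.^ d))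
    where
    open +-*-Solver
    lemma : ∀ x y u v → x ℕ.* y ℕ.* (u ℕ.* v) ≡ x ℕ.* u ℕ.* (y ℕ.* v)
    lemma = solve 4 (λ x y u v → x :* y :* (u :* v) := x :* u :* (y :* v)) refl

  ≼-trans : ∀ {𝒞₁ 𝒞₂ 𝒞₃} → 𝒞₁ ≼ 𝒞₂ → 𝒞₂ ≼ 𝒞₃ → 𝒞₁ ≼ 𝒞₃
  ≼-trans p q with ≼⇒simulates p | ≼⇒simulates q
  ... | K , d , f | K′ , d′ , g = simulates⇒≼ (K ℕ.* K′ ℕ.^ d) (d′ ℕ.* d) λ C₃ c₃ →
    let C₂ , c₂ , eq₂ , le₂ = g C₃ c₃ ; C₁ , c₁ , eq₁ , le₁ = f C₂ c₂ in
    C₁ , c₁ , (λ a → trans (eq₁ a) (eq₂ a)) , bound (size C₁) (size C₂) (size C₃) le₁ le₂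
    where
    open ℕₚ.≤-Reasoning
    bound : ∀ s₁ s₂ s₃ → s₁ ℕ.≤ K ℕ.* s₂ ℕ.^ d → s₂ ℕ.≤ K′ ℕ.* s₃ ℕ.^ d′ → s₁ ℕ.≤ K ℕ.* K′ ℕ.^ d ℕ.* s₃ ℕ.^ (d′ ℕ.* d)
    bound s₁ s₂ s₃ le₁ le₂ = begin
      s₁                                      ≤⟨ le₁ ⟩
      K ℕ.* s₂ ℕ.^ d                          ≤⟨ ℕₚ.*-monoʳ-≤ K (ℕₚ.^-monoˡ-≤ d le₂) ⟩
      K ℕ.* (K′ ℕ.* s₃ ℕ.^ d′) ℕ.^ d          ≡⟨ cong (K ℕ.*_) (^-distribʳ-* d K′ (s₃ ℕ.^ d′)) ⟩
      K ℕ.* (K′ ℕ.^ d ℕ.* (s₃ ℕ.^ d′) ℕ.^ d)  ≡⟨ cong (λ z → K ℕ.* (K′ ℕ.^ d ℕ.* z)) (ℕₚ.^-*-assoc s₃ d′ d) ⟩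
      K ℕ.* (K′ ℕ.^ d ℕ.* s₃ ℕ.^ (d′ ℕ.* d))  ≡⟨ sym (ℕₚ.*-assoc K _ _) ⟩
      K ℕ.* K′ ℕ.^ d ℕ.* s₃ ℕ.^ (d′ ℕ.* d)    ∎

  ⊇⇒≼ : ∀ {𝒞₁ 𝒞₂ : Class} → (∀ C → 𝒞₂ C → 𝒞₁ C) → 𝒞₁ ≼ 𝒞₂
  ⊇⇒≼ sub = simulates⇒≼ 1 1 λ C c → C , sub C c , (λ _ → refl) ,
    ℕₚ.≤-reflexive (sym (trans (ℕₚ.+-identityʳ _) (ℕₚ.^-identityʳ (size C))))

  -- Sizes of the smoothed and of the purified circuit

  dag-plus-mul : ∀ {L} {l r : Tree A} fs gs → Dag L → All (_∈ L) fs → All (_∈ L) gs → l ∈ L → r ∈ L →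
                 ∃ λ L′ → Dag L′ × L ⊆ L′ × plus (mul fs l) (mul gs r) ∈ L′ ×
                          length L′ ≡ suc (length gs ℕ.+ (length fs ℕ.+ length L))
  dag-plus-mul fs gs d as bs p q with dag-mul fs d as p
  ... | L₁ , d₁ , sub₁ , m₁ , len₁ with dag-mul gs d₁ (All.map sub₁ bs) (sub₁ q)
  ...   | L₂ , d₂ , sub₂ , m₂ , len₂ =
    _ , plus∷ (sub₂ m₁) m₂ d₂ , there ∘ sub₂ ∘ sub₁ , here refl ,
    cong suc (trans len₂ (cong (length gs ℕ.+_) len₁))

  module _ (V : List ℕ) where
    open Smoothing V

    dag-smooth : ∀ {L} → Dag L → ∃ λ L′ → Dag L′ × (∀ {t} → t ∈ L → smooth t ∈ L′) ×
                 length L′ ℕ.≤ length L ℕ.* suc (length V ℕ.+ length V) ℕ.+ 3 ℕ.* length V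
    dag-smooth d with dag-base
    ... | M , dM , h , len with dag-transform M smooth _ (suc (length V ℕ.+ length V)) dM (ℕₚ.≤-reflexive len) step d
      where
      step : ∀ {L} t → Dag L → M ⊆ L → (∀ l r → t ≡ plus l r ⊎ t ≡ times l r → smooth l ∈ L × smooth r ∈ L) →
             ∃ λ L′ → Dag L′ × L ⊆ L′ × smooth t ∈ L′ × length L′ ℕ.≤ suc (length V ℕ.+ length V) ℕ.+ length L
      step (const v)   d sub ch = _ , const∷ d , there , here refl , ℕ.s≤s (ℕₚ.m≤n+m _ _)
      step (lit ℓ)     d sub ch = _ , lit∷ d , there , here refl , ℕ.s≤s (ℕₚ.m≤n+m _ _)
      step (times l r) d sub ch = let p , q = ch l r (inj₂ refl) in
        _ , times∷ p q d , there , here refl , ℕ.s≤s (ℕₚ.m≤n+m _ _)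
      step {L} (plus l r)  d sub ch with ch l r (inj₁ refl)
      ... | p , q with dag-plus-mul (map taut (missing l r)) (map taut (missing r l)) d (taut∈ l r) (taut∈ r l) p q
        where
        taut∈ : ∀ l r → All (_∈ L) (map taut (missing l r))
        taut∈ l r = all-map λ m → sub (h (proj₁ (∈-filter⁻ _ {xs = V} m)))
      ...   | L′ , d′ , sub′ , m , eq = L′ , d′ , sub′ , m , subst (ℕ._≤ _) (sym eq) (ℕ.s≤s (begin
        length gs ℕ.+ (length fs ℕ.+ length L) ≡⟨ sym (ℕₚ.+-assoc (length gs) (length fs) (length L)) ⟩
        length gs ℕ.+ length fs ℕ.+ length L   ≤⟨ ℕₚ.+-monoˡ-≤ (length L) (ℕₚ.+-mono-≤ (length-missing r l) (length-missing l r)) ⟩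
        length V ℕ.+ length V ℕ.+ length L     ∎))
        where
        open ℕₚ.≤-Reasoning
        fs gs : List (Tree Carrier)
        fs = map taut (missing l r)
        gs = map taut (missing r l)
    ... | L′ , d′ , _ , h′ , len′ = L′ , d′ , h′ , len′

  module _ (Λ : List Lit) where
    open Purify Λ

    dag-purify : ∀ {L} → Dag L → ∃ λ L′ → Dag L′ × (∀ {t} → t ∈ L → strip t ∈ L′) × (∀ {ℓ} → ℓ ∈ Λ → lit ℓ ∈ L′) ×
                 length L′ ℕ.≤ length L ℕ.* suc (length Λ ℕ.+ length Λ) ℕ.+ length Λ
    dag-purify d with dag-base
    ... | M , dM , h , len with dag-transform M strip _ (suc (length Λ ℕ.+ length Λ)) dM (ℕₚ.≤-reflexive len) step d
      where
      step : ∀ {L} t → Dag L → M ⊆ L → (∀ l r → t ≡ plus l r ⊎ t ≡ times l r → strip l ∈ L × strip r ∈ L) →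
             ∃ λ L′ → Dag L′ × L ⊆ L′ × strip t ∈ L′ × length L′ ℕ.≤ suc (length Λ ℕ.+ length Λ) ℕ.+ length L
      step (const v)   d sub ch = _ , const∷ d , there , here refl , ℕ.s≤s (ℕₚ.m≤n+m _ _)
      step (lit ℓ)     d sub ch = _ , const∷ d , there , here refl , ℕ.s≤s (ℕₚ.m≤n+m _ _)
      step (times l r) d sub ch = let p , q = ch l r (inj₂ refl) in
        _ , times∷ p q d , there , here refl , ℕ.s≤s (ℕₚ.m≤n+m _ _)
      step {L} (plus l r)  d sub ch with ch l r (inj₁ refl)
      ... | p , q with dag-plus-mul (map lit (lost K? l)) (map lit (lost K? r)) d (lit∈ l) (lit∈ r) p q
        where
        K? = pureIn? (plus l r)
        lit∈ : ∀ l → All (_∈ L) (map lit (lost K? l))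
        lit∈ l = all-map λ m → sub (h (proj₁ (∈-filter⁻ _ {xs = Λ} m)))
      ...   | L′ , d′ , sub′ , m , eq = L′ , d′ , sub′ , m , subst (ℕ._≤ _) (sym eq) (ℕ.s≤s (begin
        length gs ℕ.+ (length fs ℕ.+ length L) ≡⟨ sym (ℕₚ.+-assoc (length gs) (length fs) (length L)) ⟩
        length gs ℕ.+ length fs ℕ.+ length L   ≤⟨ ℕₚ.+-monoˡ-≤ (length L) (ℕₚ.+-mono-≤ (length-lost K? r) (length-lost K? l)) ⟩
        length Λ ℕ.+ length Λ ℕ.+ length L     ∎))
        where
        open ℕₚ.≤-Reasoning
        K? = pureIn? (plus l r)
        fs gs : List (Tree Carrier)
        fs = map lit (lost K? l)
        gs = map lit (lost K? r)
    ... | L′ , d′ , sub , h′ , len′ = L′ , d′ , h′ , sub ∘ h , len′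

  -- The base 3s covers both uses: three nodes for each tautology in smoothing, the literals and the
  -- final product at the source in purification. The double n stands for the two summands.
  quadratic : ∀ {s n b} → n ℕ.≤ s → b ℕ.≤ 3 ℕ.* s → 1 ℕ.≤ s → s ℕ.* suc (n ℕ.+ n) ℕ.+ b ℕ.≤ 6 ℕ.* s ℕ.^ 2
  quadratic {s@(suc _)} {n} {b} n≤s b≤3s 1≤s = begin
    s ℕ.* suc (n ℕ.+ n) ℕ.+ b           ≤⟨ ℕₚ.+-mono-≤ (ℕₚ.*-monoʳ-≤ s (ℕ.s≤s (ℕₚ.+-mono-≤ n≤s n≤s))) b≤3s ⟩
    s ℕ.* (1 ℕ.+ (s ℕ.+ s)) ℕ.+ 3 ℕ.* s ≡⟨ lemma s ⟩
    4 ℕ.* s ℕ.+ 2 ℕ.* (s ℕ.* s)         ≤⟨ ℕₚ.+-monoˡ-≤ _ (ℕₚ.*-monoʳ-≤ 4 (ℕₚ.m≤m*n s s)) ⟩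
    4 ℕ.* (s ℕ.* s) ℕ.+ 2 ℕ.* (s ℕ.* s) ≡⟨ lemma′ s ⟩
    6 ℕ.* s ℕ.^ 2                       ∎
    where
    open ℕₚ.≤-Reasoning
    open +-*-Solver
    lemma : ∀ s → s ℕ.* (1 ℕ.+ (s ℕ.+ s)) ℕ.+ 3 ℕ.* s ≡ 4 ℕ.* s ℕ.+ 2 ℕ.* (s ℕ.* s)
    lemma = solve 1 (λ s → s :* (con 1 :+ (s :+ s)) :+ con 3 :* s := con 4 :* s :+ con 2 :* (s :* s)) refl
    lemma′ : ∀ s → 4 ℕ.* (s ℕ.* s) ℕ.+ 2 ℕ.* (s ℕ.* s) ≡ 6 ℕ.* s ℕ.^ 2
    lemma′ = solve 1 (λ s → con 4 :* (s :* s) :+ con 2 :* (s :* s) := con 6 :* (s :* (s :* con 1))) refl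

  AC-smooth : ∀ C → Every DecAt (tree C) → Every MonAt (tree C) →
              ∃ λ C′ → (Every SmoothAt (tree C′) × Every DecAt (tree C′) × Every MonAt (tree C′) ×
                        (Every DetAt (tree C) → Every DetAt (tree C′))) ×
                       SameFunction C′ C × size C′ ℕ.≤ 6 ℕ.* size C ℕ.^ 2
  AC-smooth C dec mon with dagAC C
  ... | L , d , m , len with dag-smooth V d
    where V = deduplicate ℕₚ._≟_ (map var (litsIn L))
  ... | L′ , d′ , h , len′ with realiseAC d′ (h m)
  ...   | C′ , eq , le = C′ ,
    ( subst (Every SmoothAt) (sym eq) (smooth-smooth t cov)
    , subst (Every DecAt) (sym eq) (dec-smooth (deduplicate-! ℕₚ._≟_ (map var (litsIn L))) t dec)
    , subst (Every MonAt) (sym eq) (mon-smooth t mon)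
    , λ det → subst (Every DetAt) (sym eq) (det-smooth t det)) ,
    (λ a → trans (⟦⟧-eval C′ a) (trans (cong (λ t → eval t a) eq) (trans (eval-smooth t a) (sym (⟦⟧-eval C a))))) ,
    ℕₚ.≤-trans le (ℕₚ.≤-trans len′ (subst (λ s → s ℕ.* suc (length V ℕ.+ length V) ℕ.+ 3 ℕ.* length V ℕ.≤ 6 ℕ.* size C ℕ.^ 2) (sym len)
      (quadratic V≤ (ℕₚ.*-monoʳ-≤ 3 V≤) (ℕ.s≤s ℕ.z≤n))))
    where
    t = tree C
    V = deduplicate ℕₚ._≟_ (map var (litsIn L))
    open Smoothing V
    cov : ∀ {x} → OccVar x t → x ∈ V
    cov (inj₁ o) = ∈-deduplicate⁺ ℕₚ._≟_ (∈-map⁺ var (occ⇒∈litsIn d t m o))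
    cov (inj₂ o) = ∈-deduplicate⁺ ℕₚ._≟_ (∈-map⁺ var (occ⇒∈litsIn d t m o))
    V≤ : length V ℕ.≤ size C
    V≤ = begin
      length V                       ≤⟨ Listₚ.length-deduplicate ℕₚ._≟_ (map var (litsIn L)) ⟩
      length (map var (litsIn L))    ≡⟨ Listₚ.length-map var (litsIn L) ⟩
      length (litsIn L)              ≤⟨ length-litsIn L ⟩
      length L                       ≡⟨ len ⟩
      size C                         ∎
      where open ℕₚ.≤-Reasoning

  AC-purify : ∀ C → Every SmoothAt (tree C) → Every WDecAt (tree C) → Every MonAt (tree C) →
              ∃ λ C′ → (Every SmoothAt (tree C′) × Every DecAt (tree C′) × Every MonAt (tree C′) ×
                        (Every DetAt (tree C) → Every DetAt (tree C′))) ×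
                       SameFunction C′ C × size C′ ℕ.≤ 6 ℕ.* size C ℕ.^ 2
  AC-purify C sm wdec mon with dagAC C
  ... | L , d , m , len with dag-purify Λ d
    where Λ = deduplicate _≟Lit_ (litsIn L)
  ... | L′ , d′ , h , hlit , len′ with dag-mul (map lit (Purify.lost Λ (Purify.none? Λ) (tree C))) d′ factors (h m)
    where
    Λ = deduplicate _≟Lit_ (litsIn L)
    factors = all-map λ m → hlit (proj₁ (∈-filter⁻ _ {xs = Λ} m))
  ... | L″ , d″ , _ , m″ , len″ with realiseAC d″ m″
  ...   | C′ , eq , le = C′ ,
    ( subst (Every SmoothAt) (sym eq) (every-restore SmoothAt (λ _ _ → tt) (λ _ → tt) none? t (smooth-strip t cov sm wdec))
    , subst (Every DecAt) (sym eq) (dec-restore (deduplicate-! _≟Lit_ (litsIn L)) none? t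
                                      (dec-strip (deduplicate-! _≟Lit_ (litsIn L)) t wdec))
    , subst (Every MonAt) (sym eq) (every-restore MonAt (λ _ _ → tt) (λ _ → tt) none? t (mon-strip t mon))
    , λ det → subst (Every DetAt) (sym eq) (every-restore DetAt (λ _ _ → tt) (λ _ → tt) none? t
                                              (det-strip t cov sm wdec det))) ,
    (λ a → trans (⟦⟧-eval C′ a) (trans (cong (λ t → eval t a) eq)
             (trans (eval-purify t a cov sm wdec) (sym (⟦⟧-eval C a))))) ,
    ℕₚ.≤-trans le (begin
      length L″                                        ≡⟨ len″ ⟩
      length (map lit (lost none? t)) ℕ.+ length L′    ≤⟨ ℕₚ.+-mono-≤ (length-lost none? t) len′ ⟩
      b ℕ.+ (length L ℕ.* suc (b ℕ.+ b) ℕ.+ b)         ≡⟨ ℕₚ.+-comm b _ ⟩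
      length L ℕ.* suc (b ℕ.+ b) ℕ.+ b ℕ.+ b           ≡⟨ ℕₚ.+-assoc (length L ℕ.* suc (b ℕ.+ b)) b b ⟩
      length L ℕ.* suc (b ℕ.+ b) ℕ.+ (b ℕ.+ b)         ≡⟨ cong (λ s → s ℕ.* suc (b ℕ.+ b) ℕ.+ (b ℕ.+ b)) len ⟩
      size C ℕ.* suc (b ℕ.+ b) ℕ.+ (b ℕ.+ b)           ≤⟨ quadratic Λ≤ (ℕₚ.+-mono-≤ Λ≤ (ℕₚ.≤-trans Λ≤ (ℕₚ.m≤m+n _ _))) (ℕ.s≤s ℕ.z≤n) ⟩
      6 ℕ.* size C ℕ.^ 2                               ∎)
    where
    open ℕₚ.≤-Reasoning
    t = tree C
    Λ = deduplicate _≟Lit_ (litsIn L)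
    b = length Λ
    open Purify Λ
    cov : Covered t
    cov o = ∈-deduplicate⁺ _≟Lit_ (occ⇒∈litsIn d t m o)
    Λ≤ : b ℕ.≤ size C
    Λ≤ = begin
      b                              ≤⟨ Listₚ.length-deduplicate _≟Lit_ (litsIn L) ⟩
      length (litsIn L)              ≤⟨ length-litsIn L ⟩
      length L                       ≡⟨ len ⟩
      size C                         ∎

  sD≼D : sD-ACₘ ≼ D-ACₘ
  sD≼D = simulates⇒≼ 6 2 λ C (d , m) →
    let C′ , (s′ , d′ , m′ , _) , r = AC-smooth C (dec⇒ C d) (mon⇒ C m) in
    C′ , (smooth⇐ C′ s′ , dec⇐ C′ d′ , mon⇐ C′ m′) , r

  sdD≼dD : sdD-ACₘ ≼ dD-ACₘ
  sdD≼dD = simulates⇒≼ 6 2 λ C (e , d , m) →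
    let C′ , (s′ , d′ , m′ , e′) , r = AC-smooth C (dec⇒ C d) (mon⇒ C m) in
    C′ , (smooth⇐ C′ s′ , det⇐ C′ (e′ (det⇒ C e)) , dec⇐ C′ d′ , mon⇐ C′ m′) , r

  sD≼swD : sD-ACₘ ≼ swD-ACₘ
  sD≼swD = simulates⇒≼ 6 2 λ C (s , w , m) →
    let C′ , (s′ , d′ , m′ , _) , r = AC-purify C (smooth⇒ C s) (wdec⇒ C w) (mon⇒ C m) in
    C′ , (smooth⇐ C′ s′ , dec⇐ C′ d′ , mon⇐ C′ m′) , r

  sdD≼sdwD : sdD-ACₘ ≼ sdwD-ACₘ
  sdD≼sdwD = simulates⇒≼ 6 2 λ C (s , e , w , m) →
    let C′ , (s′ , d′ , m′ , e′) , r = AC-purify C (smooth⇒ C s) (wdec⇒ C w) (mon⇒ C m) in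
    C′ , (smooth⇐ C′ s′ , det⇐ C′ (e′ (det⇒ C e)) , dec⇐ C′ d′ , mon⇐ C′ m′) , r

  -- Monomials over the reals

  open MonoidSum *-commutativeMonoid using ()
    renaming (sum to ∏; sum-cong-≗ to ∏-cong; ∑-comm to ∏-comm; ∑-distrib-+ to ∏-distrib-*)
  open CommutativeMonoidMult *-commutativeMonoid using ()
    renaming (_×_ to infixr 8 _^ℝ_; ×-homo-+ to ^-homo-+; ×-assocˡ to ^-assocˡ; ×-distrib-+ to ^-distrib-*)

  fromℕ : ℕ → Carrier
  fromℕ zero    = 0#
  fromℕ (suc n) = 1# + fromℕ n

  fromℕ-nonneg : ∀ n → 0# ≤ fromℕ n
  fromℕ-nonneg zero    = ≤.refl
  fromℕ-nonneg (suc n) = +-nonneg 0≤1 (fromℕ-nonneg n)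

  fromℕ-suc≢0 : ∀ n → fromℕ (suc n) ≢ 0#
  fromℕ-suc≢0 n eq = 0≢1 (sym (+≡0ˡ 0≤1 (fromℕ-nonneg n) eq))

  fromℕ-+ : ∀ m n → fromℕ (m ℕ.+ n) ≡ fromℕ m + fromℕ n
  fromℕ-+ zero    n = sym (+-identityˡ (fromℕ n))
  fromℕ-+ (suc m) n = trans (cong (1# +_) (fromℕ-+ m n)) (sym (+-assoc 1# (fromℕ m) (fromℕ n)))

  fromℕ-* : ∀ m n → fromℕ (m ℕ.* n) ≡ fromℕ m * fromℕ n
  fromℕ-* zero    n = sym (zeroˡ (fromℕ n))
  fromℕ-* (suc m) n = trans (fromℕ-+ n (m ℕ.* n))
    (trans (cong₂ _+_ (sym (*-identityˡ (fromℕ n))) (fromℕ-* m n)) (sym (distribʳ (fromℕ n) 1# (fromℕ m))))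

  +-cancelˡ : ∀ x {y z} → x + y ≡ x + z → y ≡ z
  +-cancelˡ x {y} {z} eq = trans (undo y) (trans (cong (- x +_) eq) (sym (undo z)))
    where
    undo : ∀ y → y ≡ - x + (x + y)
    undo y = trans (sym (+-identityˡ y)) (trans (cong (_+ y) (sym (trans (+-comm (- x) x) (-‿inverseʳ x)))) (+-assoc (- x) x y))

  fromℕ-injective : ∀ {m n} → fromℕ m ≡ fromℕ n → m ≡ n
  fromℕ-injective {zero}  {zero}  eq = refl
  fromℕ-injective {zero}  {suc n} eq = ⊥-elim (fromℕ-suc≢0 n (sym eq))
  fromℕ-injective {suc m} {zero}  eq = ⊥-elim (fromℕ-suc≢0 m eq)
  fromℕ-injective {suc m} {suc n} eq = cong suc (fromℕ-injective (+-cancelˡ 1# eq))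

  fromℕ-^ : ∀ n x → fromℕ (n ^ℕ x) ≡ n ^ℝ fromℕ x
  fromℕ-^ zero    x = +-identityʳ 1#
  fromℕ-^ (suc n) x = trans (fromℕ-* x (n ^ℕ x)) (cong (fromℕ x *_) (fromℕ-^ n x))

  fromℕ-∏ : ∀ {n} (f : Vector ℕ n) → fromℕ (Πℕ f) ≡ ∏ (fromℕ ∘ f)
  fromℕ-∏ {zero}  f = +-identityʳ 1#
  fromℕ-∏ {suc n} f = trans (fromℕ-* (f zero) _) (cong (fromℕ (f zero) *_) (fromℕ-∏ (f ∘ suc)))

  Monomial : ∀ {m} → Vector Carrier m → Carrier → Set
  Monomial {m} c x = ∃ λ (e : Vector ℕ m) → x ≡ ∏ (λ i → e i ^ℝ c i)

  ∏-1 : ∀ {m} (c : Vector Carrier m) → ∏ (λ i → 0 ^ℝ c i) ≡ 1#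
  ∏-1 {zero}  c = refl
  ∏-1 {suc m} c = trans (*-identityˡ _) (∏-1 (c ∘ suc))

  monomial-1 : ∀ {m} (c : Vector Carrier m) → Monomial c 1#
  monomial-1 c = (λ _ → 0) , sym (∏-1 c)

  monomial-var : ∀ {m} (c : Vector Carrier m) i → Monomial c (c i)
  monomial-var {suc m} c zero    = (λ { zero → 1 ; (suc _) → 0 }) ,
    sym (trans (cong₂ _*_ (*-identityʳ (c zero)) (∏-1 (c ∘ suc))) (*-identityʳ (c zero)))
  monomial-var {suc m} c (suc i) with monomial-var (c ∘ suc) i
  ... | e , eq = (λ { zero → 0 ; (suc j) → e j }) , trans eq (sym (*-identityˡ _))

  monomial-* : ∀ {m} (c : Vector Carrier m) {x y} → Monomial c x → Monomial c y → Monomial c (x * y)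
  monomial-* c (e , refl) (e′ , refl) = (λ i → e i ℕ.+ e′ i) ,
    trans (sym (∏-distrib-* (λ i → e i ^ℝ c i) (λ i → e′ i ^ℝ c i)))
          (∏-cong λ i → sym (^-homo-+ (c i) (e i) (e′ i)))

  ∏-^ : ∀ {m} (f : Vector Carrier m) n → n ^ℝ ∏ f ≡ ∏ (λ i → n ^ℝ f i)
  ∏-^ {zero}  f zero    = refl
  ∏-^ {zero}  f (suc n) = trans (*-identityˡ _) (∏-^ f n)
  ∏-^ {suc m} f n = trans (^-distrib-* (f zero) (∏ (f ∘ suc)) n) (cong (n ^ℝ f zero *_) (∏-^ (f ∘ suc) n))

  ∏-exponents : ∀ {n} (x : Carrier) (e : Vector ℕ n) → ∏ (λ j → e j ^ℝ x) ≡ Σℕ e ^ℝ x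
  ∏-exponents {zero}  x e = refl
  ∏-exponents {suc n} x e = trans (cong (e zero ^ℝ x *_) (∏-exponents x (e ∘ suc))) (sym (^-homo-+ x (e zero) (Σℕ (e ∘ suc))))

  ∏-monomials : ∀ {m n} (c : Vector Carrier m) (e : Fin n → Fin m → ℕ) (α : Vector ℕ n) →
                ∏ (λ j → α j ^ℝ ∏ (λ i → e j i ^ℝ c i)) ≡ ∏ (λ i → Σℕ (λ j → α j ℕ.* e j i) ^ℝ c i)
  ∏-monomials c e α = begin
    ∏ (λ j → α j ^ℝ ∏ (λ i → e j i ^ℝ c i))        ≡⟨ ∏-cong (λ j → ∏-^ (λ i → e j i ^ℝ c i) (α j)) ⟩
    ∏ (λ j → ∏ (λ i → α j ^ℝ e j i ^ℝ c i))        ≡⟨ ∏-cong (λ j → ∏-cong λ i → ^-assocˡ (c i) (α j) (e j i)) ⟩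
    ∏ (λ j → ∏ (λ i → (α j ℕ.* e j i) ^ℝ c i))     ≡⟨ ∏-comm (λ j i → (α j ℕ.* e j i) ^ℝ c i) ⟩
    ∏ (λ i → ∏ (λ j → (α j ℕ.* e j i) ^ℝ c i))     ≡⟨ ∏-cong (λ i → ∏-exponents (c i) (λ j → α j ℕ.* e j i)) ⟩
    ∏ (λ i → Σℕ (λ j → α j ℕ.* e j i) ^ℝ c i)      ∎
    where open ≡-Reasoning

  -- The m + 1 exponent vectors have m entries, so they satisfy a balanced relation. It equates two
  -- products of powers of the v j, first in the reals and then, as `fromℕ` is injective, in ℕ,
  -- contradicting independence.
  too-many-monomials : ∀ {m} (c : Vector Carrier m) (v : Vector ℕ (suc m)) → (∀ j → v j ≢ 1) →
                       (∀ {i j} → i ≢ j → Coprime (v i) (v j)) → ¬ (∀ j → Monomial c (fromℕ (v j)))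
  too-many-monomials {m} c v v≢1 coprime mono with balanced-relation m (λ j → proj₁ (mono j))
  ... | α , β , (j , nz) , disj , bal =
    [ (λ p → p (independent v α β v≢1 coprime disj Πα≡Πβ j))
    , (λ p → p (independent v β α v≢1 coprime (Sum.swap ∘ disj) (sym Πα≡Πβ) j)) ]′ nz
    where
    e : Fin (suc m) → Fin m → ℕ
    e j = proj₁ (mono j)
    evaluate : ∀ α → fromℕ (Πℕ (λ j → α j ^ℕ v j)) ≡ ∏ (λ i → Σℕ (λ j → α j ℕ.* e j i) ^ℝ c i)
    evaluate α = begin
      fromℕ (Πℕ (λ j → α j ^ℕ v j))            ≡⟨ fromℕ-∏ (λ j → α j ^ℕ v j) ⟩
      ∏ (λ j → fromℕ (α j ^ℕ v j))             ≡⟨ ∏-cong (λ j → fromℕ-^ (α j) (v j)) ⟩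
      ∏ (λ j → α j ^ℝ fromℕ (v j))             ≡⟨ ∏-cong (λ j → cong (α j ^ℝ_) (proj₂ (mono j))) ⟩
      ∏ (λ j → α j ^ℝ ∏ (λ i → e j i ^ℝ c i))  ≡⟨ ∏-monomials c e α ⟩
      ∏ (λ i → Σℕ (λ j → α j ℕ.* e j i) ^ℝ c i) ∎
      where open ≡-Reasoning
    Πα≡Πβ : Πℕ (λ j → α j ^ℕ v j) ≡ Πℕ (λ j → β j ^ℕ v j)
    Πα≡Πβ = fromℕ-injective (trans (evaluate α)
      (trans (∏-cong λ i → cong (_^ℝ c i) (bal i)) (sym (evaluate β))))

  -- Deterministic circuits take monomial values

  constsIn : List (Tree Carrier) → List Carrier
  constsIn []                = []
  constsIn (const v ∷ L)     = v ∷ constsIn L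
  constsIn (lit _ ∷ L)       = constsIn L
  constsIn (plus _ _ ∷ L)    = constsIn L
  constsIn (times _ _ ∷ L)   = constsIn L

  length-constsIn : ∀ L → length (constsIn L) ℕ.≤ length L
  length-constsIn []              = ℕ.z≤n
  length-constsIn (const _ ∷ L)   = ℕ.s≤s (length-constsIn L)
  length-constsIn (lit _ ∷ L)     = ℕₚ.m≤n⇒m≤1+n (length-constsIn L)
  length-constsIn (plus _ _ ∷ L)  = ℕₚ.m≤n⇒m≤1+n (length-constsIn L)
  length-constsIn (times _ _ ∷ L) = ℕₚ.m≤n⇒m≤1+n (length-constsIn L)

  const∈constsIn : ∀ {L v} → const v ∈ L → ∃ λ i → lookup (constsIn L) i ≡ v
  const∈constsIn {const v ∷ L}     (here refl) = zero , refl
  const∈constsIn {const _ ∷ L}     (there m)   = let i , eq = const∈constsIn m in suc i , eq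
  const∈constsIn {lit _ ∷ L}       (there m)   = const∈constsIn m
  const∈constsIn {plus _ _ ∷ L}    (there m)   = const∈constsIn m
  const∈constsIn {times _ _ ∷ L}   (there m)   = const∈constsIn m

  -- In a deterministic sum at most one summand is nonzero, so addition never combines two
  -- monomials; products add the exponents.
  monomial-eval : ∀ {L} → Dag L → ∀ t → t ∈ L → Every DetAt t → ∀ a → eval t a ≢ 0# →
                  Monomial (lookup (constsIn L)) (eval t a)
  monomial-eval d (const v)   m det a nz with const∈constsIn m
  ... | i , refl = monomial-var _ i
  monomial-eval d (lit ℓ)     m det a nz with holds ℓ a
  ... | true  = monomial-1 _
  ... | false = ⊥-elim (nz refl)
  monomial-eval d (plus l r)  m (det , dl , dr) a nz with eval l a ≟0 | eval r a ≟0
  ... | no p  | no q  = ⊥-elim (det (a , p , q))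
  ... | yes p | yes q = ⊥-elim (nz (trans (cong₂ _+_ p q) (+-identityˡ 0#)))
  ... | no p  | yes q = subst (Monomial _) (trans (sym (+-identityʳ _)) (cong (eval l a +_) (sym q)))
                          (monomial-eval d l (proj₁ (dag-plus d m)) dl a p)
  ... | yes p | no q  = subst (Monomial _) (trans (sym (+-identityˡ _)) (cong (_+ eval r a) (sym p)))
                          (monomial-eval d r (proj₂ (dag-plus d m)) dr a q)
  monomial-eval d (times l r) m (_ , dl , dr) a nz =
    monomial-* _ (monomial-eval d l (proj₁ (dag-times d m)) dl a (*-≢0ˡ nz))
                 (monomial-eval d r (proj₂ (dag-times d m)) dr a (*-≢0ʳ nz))

  -- If there were fewer nodes than values, there would be fewer constants, and the first of the
  -- values, one more than there are constants, would be too many monomials.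
  det-size : ∀ C → Every DetAt (tree C) → ∀ {N} (v : Vector ℕ N) → (∀ j → v j ≢ 1) → (∀ j → v j ≢ 0) →
             (∀ {i j} → i ≢ j → Coprime (v i) (v j)) →
             (∀ j → ∃ λ a → eval (tree C) a ≡ fromℕ (v j)) → N ℕ.≤ size C
  det-size C det {N} v v≢1 v≢0 coprime attained with dagAC C
  ... | L , d , m , len = ℕₚ.≮⇒≥ λ size<N → refute (ℕₚ.≤-trans (ℕ.s≤s (subst (length (constsIn L) ℕ.≤_) len (length-constsIn L))) size<N)
    where
    refute : ¬ (suc (length (constsIn L)) ℕ.≤ N)
    refute le = too-many-monomials (lookup (constsIn L)) (v ∘ ι) (v≢1 ∘ ι) (λ i≢j → coprime (i≢j ∘ Finₚ.inject≤-injective le le _ _)) λ j →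
      let a , eq = attained (ι j) in
      subst (Monomial _) eq (monomial-eval d (tree C) m det a
        (λ z → v≢0 (ι j) (fromℕ-injective (trans (sym eq) z))))
      where
      ι : Fin (suc (length (constsIn L))) → Fin N
      ι j = Fin.inject≤ j le

  -- A linear form whose values are the moduli of the β-function

  set : ℕ → Bool → Assignment → Assignment
  set x b a y with y ℕₚ.≟ x
  ... | yes _ = b
  ... | no _  = a y

  set-same : ∀ x b a → set x b a x ≡ b
  set-same x b a with x ℕₚ.≟ x
  ... | yes _  = refl
  ... | no x≢x = ⊥-elim (x≢x refl)

  set-other : ∀ x b a y → y ≢ x → set x b a y ≡ a y
  set-other x b a y y≢x with y ℕₚ.≟ x
  ... | yes y≡x = ⊥-elim (y≢x y≡x)
  ... | no _    = refl

  bits : ℕ → ℕ → Assignment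
  bits zero    j = λ _ → false
  bits (suc n) j with j <? 2 ℕ.^ n
  ... | yes _ = set n false (bits n j)
  ... | no _  = set n true (bits n (j ℕ.∸ 2 ℕ.^ n))

  value : ℕ → Assignment → ℕ
  value zero    a = 0
  value (suc n) a = (if a n then 2 ℕ.^ n else 0) ℕ.+ value n a

  value-cong : ∀ n {a b} → (∀ x → x ℕ.< n → a x ≡ b x) → value n a ≡ value n b
  value-cong zero    h = refl
  value-cong (suc n) h = cong₂ (λ b v → (if b then 2 ℕ.^ n else 0) ℕ.+ v) (h n ℕₚ.≤-refl)
                               (value-cong n λ x x<n → h x (ℕₚ.m≤n⇒m≤1+n x<n))

  value-set : ∀ n b a → value (suc n) (set n b a) ≡ (if b then 2 ℕ.^ n else 0) ℕ.+ value n a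
  value-set n b a = cong₂ (λ b v → (if b then 2 ℕ.^ n else 0) ℕ.+ v) (set-same n b a)
                          (value-cong n λ x x<n → set-other n b a x (ℕₚ.<⇒≢ x<n))

  value-bits : ∀ n j → j ℕ.< 2 ℕ.^ n → value n (bits n j) ≡ j
  value-bits zero    zero    lt = refl
  value-bits zero    (suc j) (ℕ.s≤s ())
  value-bits (suc n) j lt with j <? 2 ℕ.^ n
  ... | yes j<2^n = trans (value-set n false _) (value-bits n j j<2^n)
  ... | no  j≮2^n = trans (value-set n true _) (trans (cong (2 ℕ.^ n ℕ.+_) (value-bits n (j ℕ.∸ 2 ℕ.^ n) lt′)) split)
    where
    split : 2 ℕ.^ n ℕ.+ (j ℕ.∸ 2 ℕ.^ n) ≡ j
    split = ℕₚ.m+[n∸m]≡n (ℕₚ.≮⇒≥ j≮2^n)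
    lt′ : j ℕ.∸ 2 ℕ.^ n ℕ.< 2 ℕ.^ n
    lt′ = ℕₚ.+-cancelˡ-< (2 ℕ.^ n) _ _ (subst₂ ℕ._<_ (sym split) (cong (2 ℕ.^ n ℕ.+_) (ℕₚ.+-identityʳ _)) lt)

  module _ (n : ℕ) where

    T : ℕ
    T = (2 ℕ.^ n) !

    -- A modulus 1 + T (j + 1) is affine in its index j, and j is linear in its bits. So T 2^i is
    -- the coefficient of bit i, and 1 + T the constant term.
    linear : ℕ → Tree Carrier
    linear zero    = const (fromℕ (suc T))
    linear (suc i) = plus (times (const (fromℕ (T ℕ.* 2 ℕ.^ i))) (lit (pos i))) (linear i)

    eval-linear : ∀ i a → eval (linear i) a ≡ fromℕ (suc (T ℕ.* suc (value i a)))
    eval-linear zero    a = cong (fromℕ ∘ suc) (sym (ℕₚ.*-identityʳ T))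
    eval-linear (suc i) a = trans (cong₂ _+_ (term (a i)) (eval-linear i a)) (trans (sym (fromℕ-+ (T ℕ.* (if a i then 2 ℕ.^ i else 0)) (suc (T ℕ.* suc (value i a)))))
      (cong fromℕ (rearrange T (if a i then 2 ℕ.^ i else 0) (value i a))))
      where
      term : ∀ b → fromℕ (T ℕ.* 2 ℕ.^ i) * (if b then 1# else 0#) ≡ fromℕ (T ℕ.* (if b then 2 ℕ.^ i else 0))
      term true  = *-identityʳ _
      term false = trans (zeroʳ _) (cong fromℕ (sym (ℕₚ.*-zeroʳ T)))
      rearrange : ∀ T b v → T ℕ.* b ℕ.+ suc (T ℕ.* suc v) ≡ suc (T ℕ.* suc (b ℕ.+ v))
      rearrange = solve 3 (λ T b v → T :* b :+ (con 1 :+ T :* (con 1 :+ v)) := con 1 :+ T :* (con 1 :+ (b :+ v))) refl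
        where open +-*-Solver

    mon-linear : ∀ i → Every MonAt (linear i)
    mon-linear zero    = fromℕ-nonneg (suc T)
    mon-linear (suc i) = tt , (tt , fromℕ-nonneg (T ℕ.* 2 ℕ.^ i) , tt) , mon-linear i

    dec-linear : ∀ i → Every DecAt (linear i)
    dec-linear zero    = tt
    dec-linear (suc i) = tt , ((λ { x (inj₁ ()) ; x (inj₂ ()) }) , tt , tt) , dec-linear i

    size-linear : ∀ i → length (subtrees (linear i)) ≡ 4 ℕ.* i ℕ.+ 1
    size-linear zero    = refl
    size-linear (suc i) = trans (cong (4 ℕ.+_) (size-linear i)) (solve 1 (λ i → con 4 :+ (con 4 :* i :+ con 1) := con 4 :* (con 1 :+ i) :+ con 1) refl i)
      where open +-*-Solver

    linearAC : ∃ λ C → D-ACₘ C × (∀ a → ⟦ C ⟧ a ≡ fromℕ (β-modulus (2 ℕ.^ n) (value n a))) × size C ℕ.≤ 4 ℕ.* n ℕ.+ 1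
    linearAC with realiseAC (subtrees-dag (linear n)) (root∈subtrees (linear n))
    ... | C , eq , le = C , (dec⇐ C (subst (Every DecAt) (sym eq) (dec-linear n)) , mon⇐ C (subst (Every MonAt) (sym eq) (mon-linear n))) ,
      (λ a → trans (⟦⟧-eval C a) (trans (cong (λ t → eval t a) eq) (eval-linear n a))) ,
      subst (size C ℕ.≤_) (size-linear n) le

    det-linear-size : ∀ C → Deterministic C → (∀ a → ⟦ C ⟧ a ≡ fromℕ (β-modulus (2 ℕ.^ n) (value n a))) → 2 ℕ.^ n ℕ.≤ size C
    det-linear-size C det computes = det-size C (det⇒ C det) (β-modulus (2 ℕ.^ n) ∘ Fin.toℕ) (β-modulus≢1 (2 ℕ.^ n) ∘ Fin.toℕ) (λ _ ())
      (λ {i} {j} i≢j → β-coprime (Finₚ.toℕ<n i) (Finₚ.toℕ<n j) (i≢j ∘ Finₚ.toℕ-injective))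
      λ j → bits n (Fin.toℕ j) , trans (sym (⟦⟧-eval C _)) (trans (computes _)
              (cong (fromℕ ∘ β-modulus (2 ℕ.^ n)) (value-bits n (Fin.toℕ j) (Finₚ.toℕ<n j))))

  -- Cancelling X^d bounds X by a number independent of X. Both separations contradict it by
  -- choosing X larger.
  exponential-gap : ∀ K c d X → 1 ℕ.≤ X → X ℕ.^ suc d ℕ.≤ K ℕ.* (c ℕ.* X) ℕ.^ d → X ℕ.≤ K ℕ.* c ℕ.^ d
  exponential-gap K c d X@(suc _) _ le = ℕₚ.*-cancelʳ-≤ X (K ℕ.* c ℕ.^ d) (X ℕ.^ d) {{ℕₚ.m^n≢0 X d}} (begin
    X ℕ.* X ℕ.^ d                 ≤⟨ le ⟩
    K ℕ.* (c ℕ.* X) ℕ.^ d         ≡⟨ cong (K ℕ.*_) (^-distribʳ-* d c X) ⟩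
    K ℕ.* (c ℕ.^ d ℕ.* X ℕ.^ d)   ≡⟨ sym (ℕₚ.*-assoc K (c ℕ.^ d) (X ℕ.^ d)) ⟩
    K ℕ.* c ℕ.^ d ℕ.* X ℕ.^ d     ∎)
    where open ℕₚ.≤-Reasoning

  n<2^n : ∀ n → n ℕ.< 2 ℕ.^ n
  n<2^n zero    = ℕ.s≤s ℕ.z≤n
  n<2^n (suc n) = ℕₚ.+-mono-≤ (ℕₚ.m^n>0 2 n) (subst (suc n ℕ.≤_) (sym (ℕₚ.+-identityʳ _)) (n<2^n n))

  dwD⋠D : dwD-ACₘ ⋠ D-ACₘ
  dwD⋠D le with ≼⇒simulates le
  ... | K , d , sim = ℕₚ.<⇒≱ (n<2^n m) (exponential-gap K c d X 1≤X (begin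
      X ℕ.^ suc d                           ≡⟨ ℕₚ.^-*-assoc 2 m (suc d) ⟩
      2 ℕ.^ n′                              ≤⟨ det-linear-size n′ C′ (proj₁ C′∈) (λ a → trans (same a) (computes a)) ⟩
      size C′                               ≤⟨ C′≤ ⟩
      K ℕ.* size C ℕ.^ d                    ≤⟨ ℕₚ.*-monoʳ-≤ K (ℕₚ.^-monoˡ-≤ d C≤cX) ⟩
      K ℕ.* (c ℕ.* X) ℕ.^ d                 ∎))
    where
    open ℕₚ.≤-Reasoning
    -- With m equal to the forbidden bound, X = 2^m exceeds it. Taking m (d + 1) variables makes the
    -- lower bound X^(d+1), while the linear form has size at most c X.
    c = 4 ℕ.* suc d ℕ.+ 1
    m = K ℕ.* c ℕ.^ d
    X = 2 ℕ.^ m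
    n′ = m ℕ.* suc d
    1≤X : 1 ℕ.≤ X
    1≤X = ℕₚ.m^n>0 2 m
    L = linearAC n′
    C = proj₁ L
    computes = proj₁ (proj₂ (proj₂ L))
    S = sim C (proj₁ (proj₂ L))
    C′ = proj₁ S
    C′∈ = proj₁ (proj₂ S)
    same = proj₁ (proj₂ (proj₂ S))
    C′≤ = proj₂ (proj₂ (proj₂ S))
    C≤cX : size C ℕ.≤ c ℕ.* X
    C≤cX = begin
      size C                            ≤⟨ proj₂ (proj₂ (proj₂ L)) ⟩
      4 ℕ.* (m ℕ.* suc d) ℕ.+ 1         ≤⟨ ℕₚ.+-mono-≤ (ℕₚ.*-monoʳ-≤ 4 (ℕₚ.*-monoˡ-≤ (suc d) (ℕₚ.<⇒≤ (n<2^n m)))) 1≤X ⟩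
      4 ℕ.* (X ℕ.* suc d) ℕ.+ X         ≡⟨ rearrange X d ⟩
      c ℕ.* X                           ∎
      where
      rearrange : ∀ X d → 4 ℕ.* (X ℕ.* suc d) ℕ.+ X ≡ (4 ℕ.* suc d ℕ.+ 1) ℕ.* X
      rearrange = solve 2 (λ X d → con 4 :* (X :* (con 1 :+ d)) :+ X := (con 4 :* (con 1 :+ d) :+ con 1) :* X) refl
        where open +-*-Solver

  -- Even numbers name the variables of a constraint, odd numbers the selectors
  -- that make the choice of a satisfied term deterministic.
  plain sel : ℕ → ℕ
  plain v = double v
  sel n   = suc (double n)

  plain-injective : ∀ {v w} → plain v ≡ plain w → v ≡ w
  plain-injective {v} {w} eq with trans (sym (parity-even v)) (trans (cong parity eq) (parity-even w))
  ... | refl = refl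

  sel-injective : ∀ {m n} → sel m ≡ sel n → m ≡ n
  sel-injective {m} {n} eq with trans (sym (parity-odd m)) (trans (cong parity eq) (parity-odd n))
  ... | refl = refl

  plain≢sel : ∀ {v n} → plain v ≢ sel n
  plain≢sel {v} {n} eq with trans (sym (parity-even v)) (trans (cong parity eq) (parity-odd n))
  ... | ()

  -- Deterministic weakly decomposable circuits for conjunctions of choices

  Term : Set
  Term = List ℕ

  conjunction : Term → Tree Carrier
  conjunction t = mul (map (λ v → lit (pos (plain v))) t) (const 1#)

  choice : ℕ → List Term → Tree Carrier
  choice m []       = const 0#
  choice m (t ∷ ts) = plus (times (lit (pos (sel m))) (conjunction t))
                           (times (lit (neg (sel m))) (choice (suc m) ts))

  allOf : ℕ → List (List Term) → Tree Carrier
  allOf m []       = const 1#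
  allOf m (c ∷ cs) = times (choice m c) (allOf (m ℕ.+ length c) cs)

  -- The invariant behind weak decomposability: plain variables occur positively only, and
  -- selectors, which have both polarities, come from the interval reserved for the subcircuit.
  data Allowed (lo hi : ℕ) : Lit → Set where
    plain⁺ : ∀ v → Allowed lo hi (pos (plain v))
    sel⁺   : ∀ n → lo ℕ.≤ n → n ℕ.< hi → Allowed lo hi (pos (sel n))
    sel⁻   : ∀ n → lo ℕ.≤ n → n ℕ.< hi → Allowed lo hi (neg (sel n))

  widen : ∀ {lo hi lo′ hi′ ℓ} → lo′ ℕ.≤ lo → hi ℕ.≤ hi′ → Allowed lo hi ℓ → Allowed lo′ hi′ ℓ
  widen p q (plain⁺ v)    = plain⁺ v
  widen p q (sel⁺ n l h)  = sel⁺ n (ℕₚ.≤-trans p l) (ℕₚ.≤-trans h q)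
  widen p q (sel⁻ n l h)  = sel⁻ n (ℕₚ.≤-trans p l) (ℕₚ.≤-trans h q)

  occ-conjunction : ∀ t {ℓ} → Occ ℓ (conjunction t) → ∃ λ v → ℓ ≡ pos (plain v)
  occ-conjunction (v ∷ t) (inj₁ refl) = v , refl
  occ-conjunction (v ∷ t) (inj₂ o)    = occ-conjunction t o

  occ-choice : ∀ m ts {ℓ} → Occ ℓ (choice m ts) → Allowed m (m ℕ.+ length ts) ℓ
  occ-choice m (t ∷ ts) (inj₁ (inj₁ refl)) = sel⁺ m ℕₚ.≤-refl (ℕₚ.m<m+n m (ℕ.s≤s ℕ.z≤n))
  occ-choice m (t ∷ ts) (inj₁ (inj₂ o)) with occ-conjunction t o
  ... | v , refl = plain⁺ v
  occ-choice m (t ∷ ts) (inj₂ (inj₁ refl)) = sel⁻ m ℕₚ.≤-refl (ℕₚ.m<m+n m (ℕ.s≤s ℕ.z≤n))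
  occ-choice m (t ∷ ts) (inj₂ (inj₂ o)) =
    widen (ℕₚ.n≤1+n m) (ℕₚ.≤-reflexive (sym (ℕₚ.+-suc m (length ts)))) (occ-choice (suc m) ts o)

  total : List (List Term) → ℕ
  total cs = length (concat cs)

  occ-allOf : ∀ m cs {ℓ} → Occ ℓ (allOf m cs) → Allowed m (m ℕ.+ total cs) ℓ
  occ-allOf m (c ∷ cs) (inj₁ o) = widen ℕₚ.≤-refl
    (ℕₚ.+-monoʳ-≤ m (subst (length c ℕ.≤_) (sym (Listₚ.length-++ c)) (ℕₚ.m≤m+n _ _))) (occ-choice m c o)
  occ-allOf m (c ∷ cs) (inj₂ o) = widen (ℕₚ.m≤m+n m (length c))
    (ℕₚ.≤-reflexive (trans (ℕₚ.+-assoc m (length c) (total cs)) (cong (m ℕ.+_) (sym (Listₚ.length-++ c)))))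
    (occ-allOf (m ℕ.+ length c) cs o)

  selector-only : ∀ {lo hi x} → Allowed lo hi (neg x) → ∃ λ n → x ≡ sel n × lo ℕ.≤ n × n ℕ.< hi
  selector-only (sel⁻ n l h) = n , refl , l , h

  selector-range : ∀ {lo hi n} → Allowed lo hi (pos (sel n)) ⊎ Allowed lo hi (neg (sel n)) → lo ℕ.≤ n × n ℕ.< hi
  selector-range {lo} {hi} {n} = [ (λ al → go al refl) , (λ al → go al refl) ]′
    where
    go : ∀ {ℓ} → Allowed lo hi ℓ → var ℓ ≡ sel n → lo ℕ.≤ n × n ℕ.< hi
    go (plain⁺ v)   eq = ⊥-elim (plain≢sel {v} {n} eq)
    go (sel⁺ m l h) eq = subst (λ n → lo ℕ.≤ n × n ℕ.< hi) (sel-injective eq) (l , h)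
    go (sel⁻ m l h) eq = subst (λ n → lo ℕ.≤ n × n ℕ.< hi) (sel-injective eq) (l , h)

  no-neg : ∀ t {x} → ¬ Occ (neg x) (conjunction t)
  no-neg t o with occ-conjunction t o
  ... | _ , ()

  wdec-conjunction : ∀ t → Every WDecAt (conjunction t)
  wdec-conjunction []      = tt
  wdec-conjunction (v ∷ t) = (λ { x _ _ (_ , inj₁ ()) ; x _ _ (_ , inj₂ o) → no-neg t o }) , tt , wdec-conjunction t

  wdec-choice : ∀ m ts → Every WDecAt (choice m ts)
  wdec-choice m []       = tt
  wdec-choice m (t ∷ ts) =
    tt , ((λ { x _ _ (_ , inj₁ ()) ; x _ _ (_ , inj₂ o) → no-neg t o }) , tt , wdec-conjunction t)
       , (fresh , tt , wdec-choice (suc m) ts)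
    where
    fresh : WDecAt (times (lit (neg (sel m))) (choice (suc m) ts))
    fresh x (inj₂ refl) o _ = ℕₚ.<-irrefl refl
      (proj₁ (selector-range {n = m} (Sum.map (occ-choice (suc m) ts) (occ-choice (suc m) ts) o)))

  -- Constraints share plain variables, so the product need not be decomposable. But a negative
  -- literal belongs to a selector, and selectors are not shared.
  wdec-allOf : ∀ m cs → Every WDecAt (allOf m cs)
  wdec-allOf m []       = tt
  wdec-allOf m (c ∷ cs) = separate , wdec-choice m c , wdec-allOf (m ℕ.+ length c) cs
    where
    clash : ∀ n → OccVar (sel n) (choice m c) → OccVar (sel n) (allOf (m ℕ.+ length c) cs) → ⊥
    clash n o o′ = ℕₚ.<⇒≱
      (proj₂ (selector-range {n = n} (Sum.map (occ-choice m c) (occ-choice m c) o)))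
      (proj₁ (selector-range {n = n} (Sum.map (occ-allOf (m ℕ.+ length c) cs) (occ-allOf (m ℕ.+ length c) cs) o′)))
    separate : WDecAt (times (choice m c) (allOf (m ℕ.+ length c) cs))
    separate x o o′ (_ , inj₁ p) with selector-only (occ-choice m c p)
    ... | n , refl , _ = clash n o o′
    separate x o o′ (_ , inj₂ p) with selector-only (occ-allOf (m ℕ.+ length c) cs p)
    ... | n , refl , _ = clash n o o′

  mon-conjunction : ∀ t → Every MonAt (conjunction t)
  mon-conjunction []      = 0≤1
  mon-conjunction (v ∷ t) = tt , tt , mon-conjunction t

  mon-choice : ∀ m ts → Every MonAt (choice m ts)
  mon-choice m []       = ≤.refl
  mon-choice m (t ∷ ts) = tt , (tt , tt , mon-conjunction t) , (tt , tt , mon-choice (suc m) ts)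

  mon-allOf : ∀ m cs → Every MonAt (allOf m cs)
  mon-allOf m []       = 0≤1
  mon-allOf m (c ∷ cs) = tt , mon-choice m c , mon-allOf (m ℕ.+ length c) cs

  det-conjunction : ∀ t → Every DetAt (conjunction t)
  det-conjunction []      = tt
  det-conjunction (v ∷ t) = tt , tt , det-conjunction t

  det-choice : ∀ m ts → Every DetAt (choice m ts)
  det-choice m []       = tt
  det-choice m (t ∷ ts) = exclusive , (tt , tt , det-conjunction t) , (tt , tt , det-choice (suc m) ts)
    where
    opposite : ∀ b → (if b then 1# else 0#) ≢ 0# → (if not b then 1# else 0#) ≢ 0# → ⊥
    opposite true  p q = q refl
    opposite false p q = p refl
    exclusive : DetAt (choice m (t ∷ ts))
    exclusive (a , p , q) = opposite (a (sel m)) (*-≢0ˡ p) (*-≢0ˡ q)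

  det-allOf : ∀ m cs → Every DetAt (allOf m cs)
  det-allOf m []       = tt
  det-allOf m (c ∷ cs) = tt , det-choice m c , det-allOf (m ℕ.+ length c) cs

  SatTerm : Assignment → Term → Set
  SatTerm a t = All (λ v → a (plain v) ≡ true) t

  SatChoice : Assignment → List Term → Set
  SatChoice a ts = ∃ λ t → t ∈ ts × SatTerm a t

  literal-true : ∀ b → (if b then 1# else 0#) ≢ 0# → b ≡ true
  literal-true true  p = refl
  literal-true false p = ⊥-elim (p refl)

  conjunction⇒sat : ∀ t a → eval (conjunction t) a ≢ 0# → SatTerm a t
  conjunction⇒sat []      a nz = []
  conjunction⇒sat (v ∷ t) a nz = literal-true (a (plain v)) (*-≢0ˡ nz) ∷ conjunction⇒sat t a (*-≢0ʳ nz)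

  sat⇒conjunction : ∀ t a → SatTerm a t → eval (conjunction t) a ≢ 0#
  sat⇒conjunction []      a []       = 0≢1 ∘ sym
  sat⇒conjunction (v ∷ t) a (p ∷ ps) = *-≢0 (subst (λ b → (if b then 1# else 0#) ≢ 0#) (sym p) (0≢1 ∘ sym)) (sat⇒conjunction t a ps)

  +-≢0 : ∀ {x y} → x + y ≢ 0# → x ≢ 0# ⊎ y ≢ 0#
  +-≢0 {x} {y} nz with x ≟0
  ... | no p  = inj₁ p
  ... | yes p = inj₂ λ q → nz (trans (cong₂ _+_ p q) (+-identityˡ 0#))

  choice⇒sat : ∀ m ts a → eval (choice m ts) a ≢ 0# → SatChoice a ts
  choice⇒sat m []       a nz = ⊥-elim (nz refl)
  choice⇒sat m (t ∷ ts) a nz with +-≢0 nz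
  ... | inj₁ p = t , here refl , conjunction⇒sat t a (*-≢0ʳ p)
  ... | inj₂ q = let s , s∈ts , sat = choice⇒sat (suc m) ts a (*-≢0ʳ q) in s , there s∈ts , sat

  allOf⇒sat : ∀ m cs a → eval (allOf m cs) a ≢ 0# → All (SatChoice a) cs
  allOf⇒sat m []       a nz = []
  allOf⇒sat m (c ∷ cs) a nz = choice⇒sat m c a (*-≢0ˡ nz) ∷ allOf⇒sat (m ℕ.+ length c) cs a (*-≢0ʳ nz)

  satTerm? : ∀ a t → Dec (SatTerm a t)
  satTerm? a = All.all? (λ v → a (plain v) Boolₚ.≟ true)

  -- Each selector tells whether its term is satisfied, so every decision list stops at its first
  -- satisfied term. Terms are numbered along the concatenation of the constraints, as in `allOf`.
  answers : Assignment → List Term → ℕ → Bool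
  answers x []       n       = false
  answers x (t ∷ ts) zero    = does (satTerm? x t)
  answers x (t ∷ ts) (suc n) = answers x ts n

  override : Assignment → (ℕ → Bool) → Assignment
  override x s z = [ (λ _ → x z) , s ]′ (parity z)

  override-plain : ∀ x s v → override x s (plain v) ≡ x (plain v)
  override-plain x s v = cong [ (λ _ → x (plain v)) , s ]′ (parity-even v)

  override-sel : ∀ x s n → override x s (sel n) ≡ s n
  override-sel x s n = cong [ (λ _ → x (sel n)) , s ]′ (parity-odd n)

  module _ (x a : Assignment) (agree : ∀ v → a (plain v) ≡ x (plain v)) where

    sat-agree : ∀ {t} → SatTerm x t → SatTerm a t
    sat-agree = All.map (λ {v} → trans (agree v))

    -- The answers run through all constraints in sequence, so the terms after the present
    -- constraint are carried along as `rest`.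
    sat⇒choice : ∀ m ts rest → (∀ n → a (sel (m ℕ.+ n)) ≡ answers x (ts ++ rest) n) → SatChoice x ts →
                 eval (choice m ts) a ≢ 0#
    sat⇒choice m (t ∷ ts) rest sels (s , s∈ts , sat) with satTerm? x t | sels 0
    ... | yes p | a≡ = subst (_≢ 0#) (sym simplified) (sat⇒conjunction t a (sat-agree p))
      where
      on : a (sel m) ≡ true
      on = trans (cong (a ∘ sel) (sym (ℕₚ.+-identityʳ m))) a≡
      simplified : eval (choice m (t ∷ ts)) a ≡ eval (conjunction t) a
      simplified rewrite on = trans (cong₂ _+_ (*-identityˡ _) (zeroˡ _)) (+-identityʳ _)
    ... | no ¬p | a≡ = subst (_≢ 0#) (sym simplified) (sat⇒choice (suc m) ts rest
      (λ n → trans (cong (a ∘ sel) (sym (ℕₚ.+-suc m n))) (sels (suc n))) (s , later s∈ts , sat))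
      where
      off : a (sel m) ≡ false
      off = trans (cong (a ∘ sel) (sym (ℕₚ.+-identityʳ m))) a≡
      later : s ∈ t ∷ ts → s ∈ ts
      later (here refl) = ⊥-elim (¬p sat)
      later (there m)   = m
      simplified : eval (choice m (t ∷ ts)) a ≡ eval (choice (suc m) ts) a
      simplified rewrite off = trans (cong₂ _+_ (zeroˡ _) (*-identityˡ _)) (+-identityˡ _)

    answers-++ : ∀ ts rest n → answers x (ts ++ rest) (length ts ℕ.+ n) ≡ answers x rest n
    answers-++ []       rest n = refl
    answers-++ (t ∷ ts) rest n = answers-++ ts rest n

    sat⇒allOf : ∀ m cs → (∀ n → a (sel (m ℕ.+ n)) ≡ answers x (concat cs) n) → All (SatChoice x) cs →
                eval (allOf m cs) a ≢ 0#
    sat⇒allOf m []       sels []       = 0≢1 ∘ sym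
    sat⇒allOf m (c ∷ cs) sels (p ∷ ps) = *-≢0 (sat⇒choice m c (concat cs) sels p)
      (sat⇒allOf (m ℕ.+ length c) cs (λ n → trans (cong (a ∘ sel) (ℕₚ.+-assoc m (length c) n))
        (trans (sels (length c ℕ.+ n)) (answers-++ c (concat cs) n))) ps)

  -- With `allOf⇒sat`: on the plain variables, the support of the product projects exactly to the
  -- assignments that satisfy all constraints.
  extend : ∀ cs x → All (SatChoice x) cs → ∃ λ a → (∀ v → a (plain v) ≡ x (plain v)) × eval (allOf 0 cs) a ≢ 0#
  extend cs x sat = a , override-plain x s , sat⇒allOf x a (override-plain x s) 0 cs (override-sel x s) sat
    where
    s = answers x (concat cs)
    a = override x s

  size-conjunction : ∀ t → length (subtrees (conjunction t)) ≡ suc (2 ℕ.* length t)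
  size-conjunction []      = refl
  size-conjunction (v ∷ t) = trans (cong (2 ℕ.+_) (size-conjunction t)) (cong suc (sym (ℕₚ.*-distribˡ-+ 2 1 (length t))))

  -- Twelve nodes a term: at most seven for the conjunction of three variables, and five for the
  -- sum, the two products and the two selector literals.
  size-choice : ∀ m ts → All (λ t → length t ℕ.≤ 3) ts → length (subtrees (choice m ts)) ℕ.≤ suc (12 ℕ.* length ts)
  size-choice m []       []       = ℕₚ.≤-refl
  size-choice m (t ∷ ts) (p ∷ ps) = begin
    suc (length (subtrees l ++ subtrees r))            ≡⟨ cong suc (Listₚ.length-++ (subtrees l)) ⟩
    suc (2 ℕ.+ length (subtrees (conjunction t)) ℕ.+ (2 ℕ.+ length (subtrees (choice (suc m) ts))))
      ≤⟨ ℕ.s≤s (ℕₚ.+-mono-≤ (ℕₚ.+-monoʳ-≤ 2 (ℕₚ.≤-trans (ℕₚ.≤-reflexive (size-conjunction t)) (ℕ.s≤s (ℕₚ.*-monoʳ-≤ 2 p))))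
                            (ℕₚ.+-monoʳ-≤ 2 (size-choice (suc m) ts ps))) ⟩
    suc (9 ℕ.+ (2 ℕ.+ suc (12 ℕ.* length ts)))         ≡⟨ cong suc (sym (ℕₚ.*-distribˡ-+ 12 1 (length ts))) ⟩
    suc (12 ℕ.* length (t ∷ ts))                       ∎
    where
    open ℕₚ.≤-Reasoning
    l = times (lit (pos (sel m))) (conjunction t)
    r = times (lit (neg (sel m))) (choice (suc m) ts)

  size-allOf : ∀ B m cs → All (λ c → All (λ t → length t ℕ.≤ 3) c × length c ℕ.≤ B) cs →
               length (subtrees (allOf m cs)) ℕ.≤ suc (length cs ℕ.* (2 ℕ.+ 12 ℕ.* B))
  size-allOf B m []       []             = ℕₚ.≤-refl
  size-allOf B m (c ∷ cs) ((p , q) ∷ ps) = ℕ.s≤s (begin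
    length (subtrees (choice m c) ++ subtrees (allOf _ cs))          ≡⟨ Listₚ.length-++ (subtrees (choice m c)) ⟩
    length (subtrees (choice m c)) ℕ.+ length (subtrees (allOf _ cs))
      ≤⟨ ℕₚ.+-mono-≤ (ℕₚ.≤-trans (size-choice m c p) (ℕ.s≤s (ℕₚ.*-monoʳ-≤ 12 q))) (size-allOf B (m ℕ.+ length c) cs ps) ⟩
    suc (12 ℕ.* B) ℕ.+ suc (length cs ℕ.* (2 ℕ.+ 12 ℕ.* B))          ≡⟨ cong suc (ℕₚ.+-suc (12 ℕ.* B) _) ⟩
    suc (length cs) ℕ.* (2 ℕ.+ 12 ℕ.* B)                             ∎)
    where open ℕₚ.≤-Reasoning

  -- Descending to a balanced node

  -- The part of `a` outside s completes any support element of s to one of t. This permits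
  -- exchanging what happens below s.
  Extends : Tree Carrier → Tree Carrier → Assignment → Set
  Extends s t a = ∀ b → (∀ x → ¬ OccVar x s → b x ≡ a x) → eval s b ≢ 0# → eval t b ≢ 0#

  plus-≢0ˡ : ∀ {x y} → 0# ≤ x → 0# ≤ y → x ≢ 0# → x + y ≢ 0#
  plus-≢0ˡ p q nz = nz ∘ +≡0ˡ p q

  plus-≢0ʳ : ∀ {x y} → 0# ≤ x → 0# ≤ y → y ≢ 0# → x + y ≢ 0#
  plus-≢0ʳ p q nz = nz ∘ +≡0ʳ p q

  module Descent (z : ℕ → ℕ) (z-injective : ∀ {i j} → z i ≡ z j → i ≡ j) (n : ℕ) where

    -- The z i will be the variables that one fixed codeword sets at its symbols. They are distinct,
    -- so a leaf weighs at most 1.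
    weight : Tree Carrier → ℕ
    weight t = length (filter (λ i → occVar? (z i) t) (upTo n))

    weight-lit : ∀ ℓ → weight (lit ℓ) ℕ.≤ 1
    weight-lit ℓ = count-≤1 _ (upTo⁺ n) λ p q →
      z-injective (trans (occVar-lit {A = Carrier} ℓ p) (sym (occVar-lit {A = Carrier} ℓ q)))

    weight-const : ∀ v → weight (const v) ℕ.≤ 1
    weight-const v = count-≤1 _ (upTo⁺ n) λ { (inj₁ ()) _ ; (inj₂ ()) _ }

    record Balanced (k : ℕ) (L : List (Tree Carrier)) (t : Tree Carrier) (a : Assignment) : Set where
      field
        s       : Tree Carrier
        s∈L     : s ∈ L
        heavy   : k ℕ.≤ weight s
        light   : weight s ℕ.≤ k ℕ.+ k
        nonzero : eval s a ≢ 0#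
        below   : ∀ {x} → OccVar x s → OccVar x t
        extends : Extends s t a

    lift : ∀ {k L s t a} → (∀ {x} → OccVar x s → OccVar x t) → Extends s t a → Balanced k L s a → Balanced k L t a
    lift up ext B = record
      { s = s ; s∈L = s∈L ; heavy = heavy ; light = light ; nonzero = nonzero ; below = up ∘ below
      ; extends = λ b eq nz → ext b (λ x ¬o → eq x (¬o ∘ below)) (extends b eq nz) }
      where open Balanced B

    -- At a sum the walk follows a nonzero summand, which keeps the weight by smoothness and extends
    -- by monotonicity. At a product it enters a factor of weight at least k; one exists as the
    -- whole weighs more than 2k, and decomposability leaves the other factor untouched. It stops
    -- once the weight is at most 2k.
    descend : ∀ k {L} → 1 ℕ.≤ k → Dag L → ∀ t → t ∈ L → Every SmoothAt t → Every DecAt t → Every MonAt t →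
              ∀ a → eval t a ≢ 0# → k ℕ.+ k ℕ.< weight t → Balanced k L t a
    descend k 1≤k d (const v)   m sm de mo a nz gt =
      ⊥-elim (ℕₚ.<⇒≱ gt (ℕₚ.≤-trans (weight-const v) (ℕₚ.≤-trans 1≤k (ℕₚ.m≤m+n k k))))
    descend k 1≤k d (lit ℓ)     m sm de mo a nz gt =
      ⊥-elim (ℕₚ.<⇒≱ gt (ℕₚ.≤-trans (weight-lit ℓ) (ℕₚ.≤-trans 1≤k (ℕₚ.m≤m+n k k))))
    descend k 1≤k d (plus l r)  m (s , sl , sr) (_ , dl , dr) (_ , ml , mr) a nz gt with +-≢0 nz
    ... | inj₁ nzl = lift {s = l} {plus l r} (Sum.map inj₁ inj₁)
      (λ b eq nz → plus-≢0ˡ (eval-nonneg l ml b) (eval-nonneg r mr b) nz)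
      (descend k 1≤k d l (proj₁ (dag-plus d m)) sl dl ml a nzl
        (ℕₚ.≤-trans gt (count-mono (λ i → occVar? (z i) (plus l r)) (λ i → occVar? (z i) l) (upTo n)
          λ o → [ id , proj₂ (s _) ]′ (occVar-plus {l = l} {r} o))))
    ... | inj₂ nzr = lift {s = r} {plus l r} (Sum.map inj₂ inj₂)
      (λ b eq nz → plus-≢0ʳ (eval-nonneg l ml b) (eval-nonneg r mr b) nz)
      (descend k 1≤k d r (proj₂ (dag-plus d m)) sr dr mr a nzr
        (ℕₚ.≤-trans gt (count-mono (λ i → occVar? (z i) (plus l r)) (λ i → occVar? (z i) r) (upTo n)
          λ o → [ proj₁ (s _) , id ]′ (occVar-plus {l = l} {r} o))))
    descend k {L} 1≤k d (times l r) m (_ , sl , sr) (de , dl , dr) (_ , ml , mr) a nz gt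
      with k ℕₚ.≤? weight l
    ... | yes k≤wl = lift {s = l} {times l r} (Sum.map inj₁ inj₁) extˡ goˡ
      where
      nzl = *-≢0ˡ nz
      extˡ : Extends l (times l r) a
      extˡ b eq nz′ = *-≢0 nz′ (subst (_≢ 0#) (eval-cong r λ x o → sym (eq x λ o′ → de x o′ o)) (*-≢0ʳ nz))
      goˡ : Balanced k L l a
      goˡ with weight l ℕₚ.≤? k ℕ.+ k
      ... | yes wl≤ = record { s = l ; s∈L = proj₁ (dag-times d m) ; heavy = k≤wl ; light = wl≤ ; nonzero = nzl
                             ; below = id ; extends = λ b _ nz → nz }
      ... | no wl≰  = descend k 1≤k d l (proj₁ (dag-times d m)) sl dl ml a nzl (ℕₚ.≰⇒> wl≰)
    ... | no k≰wl = lift {s = r} {times l r} (Sum.map inj₂ inj₂) extʳ goʳ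
      where
      nzr = *-≢0ʳ nz
      extʳ : Extends r (times l r) a
      extʳ b eq nz′ = *-≢0 (subst (_≢ 0#) (eval-cong l λ x o → sym (eq x (de x o))) (*-≢0ˡ nz)) nz′
      k≤wr : k ℕ.≤ weight r
      k≤wr = ℕₚ.+-cancelˡ-≤ k k (weight r) (begin
        k ℕ.+ k                   ≤⟨ ℕₚ.<⇒≤ gt ⟩
        weight (times l r)        ≤⟨ count-⊎ (λ i → occVar? (z i) (times l r)) (λ i → occVar? (z i) l) (λ i → occVar? (z i) r)
                                       (upTo n) occVar-times ⟩
        weight l ℕ.+ weight r     ≤⟨ ℕₚ.+-monoˡ-≤ (weight r) (ℕₚ.<⇒≤ (ℕₚ.≰⇒> k≰wl)) ⟩
        k ℕ.+ weight r            ∎)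
        where open ℕₚ.≤-Reasoning
      goʳ : Balanced k L r a
      goʳ with weight r ℕₚ.≤? k ℕ.+ k
      ... | yes wr≤ = record { s = r ; s∈L = proj₂ (dag-times d m) ; heavy = k≤wr ; light = wr≤ ; nonzero = nzr
                             ; below = id ; extends = λ b _ nz → nz }
      ... | no wr≰  = descend k 1≤k d r (proj₂ (dag-times d m)) sr dr mr a nzr (ℕₚ.≰⇒> wr≰)

  -- The Reed–Solomon code as a conjunction of local constraints

  -- coef r is the r-th coefficient of the message; part i r is the r-th
  -- intermediate value of Horner's scheme at the point i.
  data Pos : Set where
    coef : ℕ → Pos
    part : ℕ → ℕ → Pos

  digits : Pos → ℕ → List ℕ
  digits (coef r)   v = 0 ∷ r ∷ v ∷ []
  digits (part i r) v = 1 ∷ i ∷ r ∷ v ∷ []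

  digits-injective : ∀ p q {v w} → digits p v ≡ digits q w → p ≡ q × v ≡ w
  digits-injective (coef r)   (coef _)   refl = refl , refl
  digits-injective (part i r) (part _ _) refl = refl , refl

  abstract
    name : Pos → ℕ → ℕ
    name p v = encode (digits p v)

    name-injective : ∀ p q {v w} → name p v ≡ name q w → p ≡ q × v ≡ w
    name-injective p q eq = digits-injective p q (encode-injective (digits p _) (digits q _) eq)

  -- One-hot encoding: this variable says that position p carries the value v.
  block : Pos → ℕ → ℕ
  block p v = plain (name p v)

  block-injective : ∀ p q {v w} → block p v ≡ block q w → p ≡ q × v ≡ w
  block-injective p q eq = name-injective p q (plain-injective eq)

  -- There are n evaluation points and k coefficients; M bounds the coefficients and Q the
  -- intermediate values entering a step. The value leaving a step needs no enumeration, being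
  -- computed from the other two.
  module Code (n k Q M : ℕ) where

    initial : ℕ → List Term
    initial i = (name (part i 0) 0 ∷ []) ∷ []

    stepTerm : ℕ → ℕ → ℕ → ℕ → Term
    stepTerm i r s c = name (part i r) s ∷ name (coef r) c ∷ name (part i (suc r)) (c ℕ.+ i ℕ.* s) ∷ []

    step : ℕ → ℕ → List Term
    step i r = cartesianProductWith (stepTerm i r) (upTo Q) (upTo M)

    point : ℕ → List (List Term)
    point i = initial i ∷ map (step i) (upTo k)

    constraints : List (List Term)
    constraints = concatMap point (upTo n)

    initial∈ : ∀ {i} → i ℕ.< n → initial i ∈ constraints
    initial∈ i<n = ∈-concatMap⁺ point (lose (∈-upTo⁺ i<n) (here refl))

    step∈ : ∀ {i r} → i ℕ.< n → r ℕ.< k → step i r ∈ constraints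
    step∈ {i} i<n r<k = ∈-concatMap⁺ point (lose (∈-upTo⁺ i<n) (there (∈-map⁺ (step i) (∈-upTo⁺ r<k))))

    constraints-all : ∀ {P : List Term → Set} → (∀ {i} → i ℕ.< n → P (initial i)) →
                      (∀ {i r} → i ℕ.< n → r ℕ.< k → P (step i r)) → All P constraints
    constraints-all {P} pi ps = All.tabulate λ m → let i , i∈ , m′ = find (∈-concatMap⁻ point m) in go (∈-upTo⁻ i∈) m′
      where
      go : ∀ {i c} → i ℕ.< n → c ∈ point i → P c
      go i<n (here refl) = pi i<n
      go {i} i<n (there m) with ∈-map⁻ (step i) m
      ... | r , r∈ , refl = ps i<n (∈-upTo⁻ r∈)

    step-all : ∀ {P : Term → Set} i r → (∀ s c → P (stepTerm i r s c)) → All P (step i r)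
    step-all {P} i r h = All.tabulate λ m → let s , c , _ , _ , eq = ∈-cartesianProductWith⁻ (stepTerm i r) (upTo Q) (upTo M) m in
                                      subst P (sym eq) (h s c)

    length-step : ∀ i r → length (step i r) ≡ Q ℕ.* M
    length-step i r = trans (length-cartesianProductWith (stepTerm i r) (upTo Q) (upTo M))
                            (cong₂ ℕ._*_ (Listₚ.length-upTo Q) (Listₚ.length-upTo M))

    length-constraints : length constraints ≡ n ℕ.* suc k
    length-constraints = trans (go (upTo n)) (cong (ℕ._* suc k) (Listₚ.length-upTo n))
      where
      go : ∀ is → length (concatMap point is) ≡ length is ℕ.* suc k
      go []       = refl
      go (i ∷ is) = trans (Listₚ.length-++ (point i)) (cong₂ ℕ._+_
        (cong suc (trans (Listₚ.length-map (step i) (upTo k)) (Listₚ.length-upTo k))) (go is))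

    codeTree : Tree Carrier
    codeTree = allOf 0 constraints

    size-codeTree : 1 ℕ.≤ Q ℕ.* M → length (subtrees codeTree) ℕ.≤ suc (n ℕ.* suc k ℕ.* (2 ℕ.+ 12 ℕ.* (Q ℕ.* M)))
    size-codeTree 1≤QM = subst (λ l → length (subtrees codeTree) ℕ.≤ suc (l ℕ.* (2 ℕ.+ 12 ℕ.* (Q ℕ.* M)))) length-constraints
      (size-allOf (Q ℕ.* M) 0 constraints (constraints-all
        (λ _ → (ℕ.s≤s ℕ.z≤n ∷ []) , 1≤QM)
        (λ {i} {r} _ _ → step-all i r (λ _ _ → ℕₚ.≤-refl) , ℕₚ.≤-reflexive (length-step i r))))

    Follows : (ℕ → ℕ) → Pos → ℕ
    Follows u (coef r)   = u r
    Follows u (part i r) = horner u r i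

    positions : List Pos
    positions = map coef (upTo k) ++ concatMap (λ i → map (part i) (upTo (suc k))) (upTo n)

    coef∈ : ∀ {r} → r ℕ.< k → coef r ∈ positions
    coef∈ r<k = ∈-++⁺ˡ (∈-map⁺ coef (∈-upTo⁺ r<k))

    part∈ : ∀ {i r} → i ℕ.< n → r ℕ.≤ k → part i r ∈ positions
    part∈ {i} i<n r≤k = ∈-++⁺ʳ (map coef (upTo k))
      (∈-concatMap⁺ (λ i → map (part i) (upTo (suc k))) (lose (∈-upTo⁺ i<n) (∈-map⁺ (part i) (∈-upTo⁺ (ℕ.s≤s r≤k)))))

    positions-all : ∀ {P : Pos → Set} → (∀ {r} → r ℕ.< k → P (coef r)) → (∀ {i r} → i ℕ.< n → r ℕ.≤ k → P (part i r)) →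
                    ∀ {p} → p ∈ positions → P p
    positions-all {P} pc pp m with ∈-++⁻ (map coef (upTo k)) m
    ... | inj₁ m₁ with ∈-map⁻ coef m₁
    ...   | r , r∈ , refl = pc (∈-upTo⁻ r∈)
    positions-all {P} pc pp m | inj₂ m₂ with find (∈-concatMap⁻ (λ i → map (part i) (upTo (suc k))) {xs = upTo n} m₂)
    ... | i , i∈ , m₃ with ∈-map⁻ (part i) m₃
    ...   | r , r∈ , refl = pp (∈-upTo⁻ i∈) (ℕₚ.≤-pred (∈-upTo⁻ r∈))

    indicator : (Pos → ℕ) → Assignment
    indicator c z = does (z ∈? map (λ p → block p (c p)) positions)

    indicator⁺ : ∀ c {p} → p ∈ positions → indicator c (block p (c p)) ≡ true
    indicator⁺ c m = dec-true (_ ∈? _) (∈-map⁺ (λ p → block p (c p)) m)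

    indicator⁻ : ∀ c p v → indicator c (block p v) ≡ true → p ∈ positions × v ≡ c p
    indicator⁻ c p v eq with block p v ∈? map (λ p → block p (c p)) positions
    ... | yes m with ∈-map⁻ (λ p → block p (c p)) m
    ...   | q , q∈ , eq′ with block-injective p q eq′
    ...     | refl , refl = q∈ , refl

    codeword-sat : ∀ u → (∀ {r} → r ℕ.< k → u r ℕ.< M) → (∀ {i r} → i ℕ.< n → r ℕ.< k → horner u r i ℕ.< Q) →
                   All (SatChoice (indicator (Follows u))) constraints
    codeword-sat u u<M h<Q = constraints-all
      (λ {i} i<n → _ , here refl , indicator⁺ (Follows u) (part∈ i<n ℕ.z≤n) ∷ [])
      (λ {i} {r} i<n r<k → _ ,
        ∈-cartesianProductWith⁺ (stepTerm i r) (∈-upTo⁺ (h<Q i<n r<k)) (∈-upTo⁺ (u<M r<k)) ,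
        indicator⁺ (Follows u) (part∈ i<n (ℕₚ.<⇒≤ r<k)) ∷ indicator⁺ (Follows u) (coef∈ r<k) ∷
        indicator⁺ (Follows u) (part∈ i<n r<k) ∷ [])

    module _ {a : Assignment} (nz : eval codeTree a ≢ 0#) where

      private sat = allOf⇒sat 0 constraints a nz

      initial-sat : ∀ {i} → i ℕ.< n → a (block (part i 0) 0) ≡ true
      initial-sat i<n with All.lookup sat (initial∈ i<n)
      ... | _ , here refl , p ∷ [] = p

      step-sat : ∀ {i r} → i ℕ.< n → r ℕ.< k → ∃ λ s → ∃ λ c → a (block (part i r) s) ≡ true ×
                 a (block (coef r) c) ≡ true × a (block (part i (suc r)) (c ℕ.+ i ℕ.* s)) ≡ true
      step-sat {i} {r} i<n r<k with All.lookup sat (step∈ i<n r<k)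
      ... | t , t∈ , holds with ∈-cartesianProductWith⁻ (stepTerm i r) (upTo Q) (upTo M) t∈
      step-sat i<n r<k | t , t∈ , p ∷ q ∷ w ∷ [] | s , c , _ , _ , refl = s , c , p , q , w

      hit : 1 ℕ.≤ n → ∀ {p} → p ∈ positions → ∃ λ v → a (block p v) ≡ true
      hit 1≤n = positions-all {λ p → ∃ λ v → a (block p v) ≡ true}
        -- Coefficients are read off the constraints of point 0.
        (λ r<k → let _ , c , _ , q , _ = step-sat 1≤n r<k in c , q)
        (λ { {i} {zero} i<n _ → 0 , initial-sat i<n
           ; {i} {suc r} i<n r<k → let s , c , _ , _ , w = step-sat i<n r<k in c ℕ.+ i ℕ.* s , w })

      -- The constraints are positive and cannot exclude several true variables in one block, so
      -- uniqueness enters as a hypothesis. Given it, the steps force Horner's recursion.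
      follows : ∀ y → (∀ {p v} → p ∈ positions → a (block p v) ≡ true → v ≡ y p) →
                ∀ {i} → i ℕ.< n → ∀ r → r ℕ.≤ k → y (part i r) ≡ horner (y ∘ coef) r i
      follows y unique {i} i<n zero    _   = sym (unique (part∈ i<n ℕ.z≤n) (initial-sat i<n))
      follows y unique {i} i<n (suc r) r<k with step-sat i<n r<k
      ... | s , c , p , q , w = begin
        y (part i (suc r))                           ≡⟨ sym (unique (part∈ i<n r<k) w) ⟩
        c ℕ.+ i ℕ.* s                                ≡⟨ cong₂ (λ c s → c ℕ.+ i ℕ.* s) (unique (coef∈ r<k) q)
                                                          (trans (unique (part∈ i<n (ℕₚ.<⇒≤ r<k)) p)
                                                                 (follows y unique i<n r (ℕₚ.<⇒≤ r<k))) ⟩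
        horner (y ∘ coef) (suc r) i                  ∎
        where open ≡-Reasoning

  -- Lower bound for smooth decomposable circuits of the code

  module LowerBound (k M : ℕ) (1≤k : 1 ℕ.≤ k) (1≤M : 1 ℕ.≤ M) where

    -- With 3k points, a node that sees between k and 2k of them leaves at least k outside, so
    -- either side alone determines a message.
    points range : ℕ
    points = k ℕ.+ k ℕ.+ k
    range  = M ℕ.* suc points ℕ.^ k

    open Code points k range M

    1≤points : 1 ℕ.≤ points
    1≤points = ℕₚ.≤-trans 1≤k (ℕₚ.m≤n+m k (k ℕ.+ k))

    Valid : (ℕ → ℕ) → Set
    Valid u = ∀ {r} → r ℕ.< k → u r ℕ.< M

    horner<range : ∀ {u} → Valid u → ∀ {i r} → i ℕ.< points → r ℕ.< k → horner u r i ℕ.< range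
    horner<range {u} valid {i} {r} i<n r<k = ℕₚ.<-≤-trans
      (horner-bound u M points i (ℕₚ.<⇒≤ i<n) 1≤M r (λ r′<r → valid (ℕₚ.<-trans r′<r r<k)))
      (ℕₚ.*-monoʳ-≤ M (ℕₚ.^-monoʳ-≤ (suc points) (ℕₚ.<⇒≤ r<k)))

    codeword : ∀ {u} → Valid u → ∃ λ a → (∀ v → a (plain v) ≡ indicator (Follows u) (plain v)) × eval codeTree a ≢ 0#
    codeword {u} valid = extend constraints (indicator (Follows u)) (codeword-sat u valid (horner<range {u} valid))

    word : ∀ {u} → Valid u → Assignment
    word valid = proj₁ (codeword valid)

    word⁻ : ∀ {u} (valid : Valid u) p v → word valid (block p v) ≡ true → v ≡ Follows u p
    word⁻ {u} valid p v eq = proj₂ (indicator⁻ (Follows u) p v (trans (sym (proj₁ (proj₂ (codeword valid)) (name p v))) eq))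

    module _ {t : Tree Carrier} (computes : ∀ a → eval t a ≡ eval codeTree a) where

      nonzero⇒code : ∀ {a} → eval t a ≢ 0# → eval codeTree a ≢ 0#
      nonzero⇒code {a} = subst (_≢ 0#) (computes a)

      -- If t did not see this variable, erasing it from the codeword would keep t nonzero. But then
      -- the whole block would be false, while each support element hits each block.
      mentions : ∀ {u} → Valid u → ∀ {i} → i ℕ.< points → OccVar (block (part i k) (Follows u (part i k))) t
      mentions {u} valid {i} i<n = decidable-stable (occVar? z t) contra
        where
        p = part i k
        z = block p (Follows u p)
        a = word valid
        contra : ¬ ¬ OccVar z t
        contra ¬o with hit {set z false a} (nonzero⇒code (subst (_≢ 0#)
            (trans (sym (computes a)) (eval-cong t λ x o → sym (set-other z false a x λ { refl → ¬o o })))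
            (proj₂ (proj₂ (codeword valid))))) 1≤points (part∈ i<n ℕₚ.≤-refl)
        ... | v , eq = erased (block p v ℕₚ.≟ z)
          where
          erased : ¬ Dec (block p v ≡ z)
          erased (yes v≡) = case trans (sym eq) (trans (cong (set z false a) v≡) (set-same z false a)) of λ ()
          erased (no v≢)  = v≢ (cong (block p) (word⁻ valid p v (trans (sym (set-other z false a (block p v) v≢)) eq)))

      -- The codeword of u on the variables of s, that of v elsewhere. It is in the support because
      -- u makes s nonzero and v extends s to t.
      module Hybrid {u v} (vu : Valid u) (vv : Valid v) {s}
                    (nz : eval s (word vu) ≢ 0#) (ext : Extends s t (word vv)) where

        hybrid : Assignment
        hybrid x with occVar? x s
        ... | yes _ = word vu x
        ... | no _  = word vv x

        hybrid-inside : ∀ x → OccVar x s → hybrid x ≡ word vu x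
        hybrid-inside x o with occVar? x s
        ... | yes _ = refl
        ... | no ¬o = ⊥-elim (¬o o)

        hybrid-outside : ∀ x → ¬ OccVar x s → hybrid x ≡ word vv x
        hybrid-outside x ¬o with occVar? x s
        ... | yes o = ⊥-elim (¬o o)
        ... | no _  = refl

        hybrid-nonzero : eval codeTree hybrid ≢ 0#
        hybrid-nonzero = nonzero⇒code (ext hybrid hybrid-outside
          (subst (_≢ 0#) (eval-cong s λ x o → sym (hybrid-inside x o)) nz))

        hybrid⁻ : ∀ p w → hybrid (block p w) ≡ true →
                  (OccVar (block p w) s × w ≡ Follows u p) ⊎ (¬ OccVar (block p w) s × w ≡ Follows v p)
        hybrid⁻ p w eq with occVar? (block p w) s
        ... | yes o = inj₁ (o , word⁻ vu p w eq)
        ... | no ¬o = inj₂ (¬o , word⁻ vv p w eq)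

        -- Some variable of the block p must be set by the hybrid.
        inside-mono : ∀ {p} → p ∈ positions → OccVar (block p (Follows v p)) s → OccVar (block p (Follows u p)) s
        inside-mono {p} p∈ o with hit hybrid-nonzero 1≤points p∈
        ... | w , eq with hybrid⁻ p w eq
        ...   | inj₁ (o′ , refl) = o′
        ...   | inj₂ (¬o , refl) = ⊥-elim (¬o o)

      module Separation {u v} (vu : Valid u) (vv : Valid v) {s}
                        (nzu : eval s (word vu) ≢ 0#) (extu : Extends s t (word vu))
                        (nzv : eval s (word vv) ≢ 0#) (extv : Extends s t (word vv)) where

        open Hybrid vu vv {s} nzu extv
        module Mirror = Hybrid vv vu {s} nzv extu

        inside? : ∀ p → Dec (OccVar (block p (Follows u p)) s)
        inside? p = occVar? (block p (Follows u p)) s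

        -- A block may lie partly below s. Asking for the variable of u decides the case: by
        -- `inside-mono` and its mirror image it lies below s exactly if that of v does.
        mixture : Pos → ℕ
        mixture p with inside? p
        ... | yes _ = Follows u p
        ... | no _  = Follows v p

        mixture-inside : ∀ p → OccVar (block p (Follows u p)) s → mixture p ≡ Follows u p
        mixture-inside p o with inside? p
        ... | yes _ = refl
        ... | no ¬o = ⊥-elim (¬o o)

        mixture-outside : ∀ p → ¬ OccVar (block p (Follows u p)) s → mixture p ≡ Follows v p
        mixture-outside p ¬o with inside? p
        ... | yes o = ⊥-elim (¬o o)
        ... | no _  = refl

        mixture-unique : ∀ {p w} → p ∈ positions → hybrid (block p w) ≡ true → w ≡ mixture p
        mixture-unique {p} {w} p∈ eq with hybrid⁻ p w eq
        ... | inj₁ (o , refl)  = sym (mixture-inside p o)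
        ... | inj₂ (¬o , refl) = sym (mixture-outside p (¬o ∘ Mirror.inside-mono p∈))

        mixture-follows : ∀ {i} → i ℕ.< points → mixture (part i k) ≡ horner (mixture ∘ coef) k i
        mixture-follows i<n = follows hybrid-nonzero mixture mixture-unique i<n k ℕₚ.≤-refl

        module _ (heavy : k ℕ.≤ length (filter (λ i → inside? (part i k)) (upTo points)))
                 (light : length (filter (λ i → inside? (part i k)) (upTo points)) ℕ.≤ k ℕ.+ k) where

          k≤outside : k ℕ.≤ length (filter (λ i → ¬? (inside? (part i k))) (upTo points))
          k≤outside = ℕₚ.+-cancelˡ-≤ (k ℕ.+ k) k _ (begin
            points                               ≡⟨ sym (Listₚ.length-upTo points) ⟩
            length (upTo points)                 ≤⟨ count-all _ (upTo points) (λ {i} _ → toSum (inside? (part i k))) ⟩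
            length (filter (λ i → inside? (part i k) ⊎-dec ¬? (inside? (part i k))) (upTo points))
                                                 ≤⟨ count-⊎ _ (λ i → inside? (part i k)) (λ i → ¬? (inside? (part i k))) (upTo points) id ⟩
            length (filter (λ i → inside? (part i k)) (upTo points)) ℕ.+
            length (filter (λ i → ¬? (inside? (part i k))) (upTo points))
                                                 ≤⟨ ℕₚ.+-monoˡ-≤ _ light ⟩
            k ℕ.+ k ℕ.+ length (filter (λ i → ¬? (inside? (part i k))) (upTo points)) ∎)
            where
            open ℕₚ.≤-Reasoning

          -- The hybrid carries a single message, whose symbols agree with those of u at the k or
          -- more inside points and with those of v at the k or more outside points. So it equals
          -- both.
          same-message : ∀ {r} → r ℕ.< k → u r ≡ v r
          same-message r<k = trans (sym (agree-u r<k)) (agree-v r<k)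
            where
            agree-u : ∀ {r} → r ℕ.< k → mixture (coef r) ≡ u r
            agree-u = horner-agree (mixture ∘ coef) u k _ (filter⁺ (λ i → inside? (part i k)) (upTo⁺ points)) heavy λ m →
              let i∈ , o = ∈-filter⁻ (λ i → inside? (part i k)) {xs = upTo points} m in
              trans (sym (mixture-follows (∈-upTo⁻ i∈))) (mixture-inside _ o)
            agree-v : ∀ {r} → r ℕ.< k → mixture (coef r) ≡ v r
            agree-v = horner-agree (mixture ∘ coef) v k _ (filter⁺ (λ i → ¬? (inside? (part i k))) (upTo⁺ points)) k≤outside λ m →
              let i∈ , ¬o = ∈-filter⁻ (λ i → ¬? (inside? (part i k))) {xs = upTo points} m in
              trans (sym (mixture-follows (∈-upTo⁻ i∈))) (mixture-outside _ ¬o)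

    message : Fin (M ℕ.^ k) → ℕ → ℕ
    message m r with r <? k
    ... | yes r<k = Fin.toℕ (Fin.finToFun m (Fin.fromℕ< r<k))
    ... | no _    = 0

    message-valid : ∀ m → Valid (message m)
    message-valid m {r} r<k with r <? k
    ... | yes r<k′ = Finₚ.toℕ<n _
    ... | no r≮k   = ⊥-elim (r≮k r<k)

    message-toℕ : ∀ m j → message m (Fin.toℕ j) ≡ Fin.toℕ (Fin.finToFun {M} {k} m j)
    message-toℕ m j with Fin.toℕ j <? k
    ... | yes lt = cong (Fin.toℕ ∘ Fin.finToFun {M} {k} m) (Finₚ.fromℕ<-toℕ j lt)
    ... | no ≮   = ⊥-elim (≮ (Finₚ.toℕ<n j))

    message-injective : ∀ {m m′} → (∀ {r} → r ℕ.< k → message m r ≡ message m′ r) → m ≡ m′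
    message-injective {m} {m′} h = begin
      m                                  ≡⟨ sym (Finₚ.funToFin-finToFin {k} {M} m) ⟩
      Fin.funToFin (Fin.finToFun {M} {k} m)  ≡⟨ funToFin-cong k (λ j → Finₚ.toℕ-injective
                                              (trans (sym (message-toℕ m j)) (trans (h (Finₚ.toℕ<n j)) (message-toℕ m′ j)))) ⟩
      Fin.funToFin (Fin.finToFun {M} {k} m′) ≡⟨ Finₚ.funToFin-finToFin {k} {M} m′ ⟩
      m′                                 ∎
      where
      open ≡-Reasoning
      funToFin-cong : ∀ k {f g : Fin k → Fin M} → f ≗ g → Fin.funToFin f ≡ Fin.funToFin g
      funToFin-cong zero    h = refl
      funToFin-cong (suc k) h = cong₂ Fin.combine (h zero) (funToFin-cong k (h ∘ suc))

    -- Pigeonhole on the list position of the balanced node of each message. In a collision the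
    -- balance is measured with the variables of the first message only; from the second one the
    -- common node and its extension property are taken.
    code-size : ∀ C → Every SmoothAt (tree C) → Every DecAt (tree C) → Every MonAt (tree C) →
                (∀ a → eval (tree C) a ≡ eval codeTree a) → M ℕ.^ k ℕ.≤ size C
    code-size C sm de mo computes with dagAC C
    ... | L , d , t∈L , len = ℕₚ.≮⇒≥ λ size< →
      let m , m′ , m<m′ , eq = Finₚ.pigeonhole (subst (ℕ._< M ℕ.^ k) (sym len) size<) (λ m → Any.index (s∈L m)) in
      Finₚ.<⇒≢ m<m′ (collision eq)
      where
      t = tree C
      z : Fin (M ℕ.^ k) → ℕ → ℕ
      z m i = block (part i k) (Follows (message m) (part i k))
      z-injective : ∀ m {i j} → z m i ≡ z m j → i ≡ j
      z-injective m eq with block-injective _ _ eq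
      ... | refl , _ = refl
      module D m = Descent (z m) (z-injective m) points
      heavy-root : ∀ m → k ℕ.+ k ℕ.< D.weight m t
      heavy-root m = begin
        suc (k ℕ.+ k)          ≡⟨ ℕₚ.+-comm 1 (k ℕ.+ k) ⟩
        k ℕ.+ k ℕ.+ 1          ≤⟨ ℕₚ.+-monoʳ-≤ (k ℕ.+ k) 1≤k ⟩
        points                 ≡⟨ sym (Listₚ.length-upTo points) ⟩
        length (upTo points)   ≤⟨ count-all _ (upTo points) (λ i∈ → mentions {t} computes (message-valid m) (∈-upTo⁻ i∈)) ⟩
        D.weight m t           ∎
        where open ℕₚ.≤-Reasoning
      balanced : ∀ m → D.Balanced m k L t (word (message-valid m))
      balanced m = D.descend m k 1≤k d t t∈L sm de mo _
        (subst (_≢ 0#) (sym (computes _)) (proj₂ (proj₂ (codeword (message-valid m))))) (heavy-root m)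
      module B m = D.Balanced m (balanced m)
      s∈L : ∀ m → B.s m ∈ L
      s∈L = B.s∈L
      collision : ∀ {m m′} → Any.index (s∈L m) ≡ Any.index (s∈L m′) → m ≡ m′
      collision {m} {m′} eq = message-injective (S.same-message (B.heavy m) (B.light m))
        where
        same : B.s m′ ≡ B.s m
        same = trans (lookup-index (s∈L m′)) (trans (cong (lookup L) (sym eq)) (sym (lookup-index (s∈L m))))
        module S = Separation {t} computes (message-valid m) (message-valid m′) {B.s m} (B.nonzero m) (B.extends m)
                     (subst (λ s → eval s _ ≢ 0#) same (B.nonzero m′)) (subst (λ s → Extends s t _) same (B.extends m′))

    codeAC : ∃ λ C → dwD-ACₘ C × (∀ a → ⟦ C ⟧ a ≡ eval codeTree a) ×
                     size C ℕ.≤ suc (points ℕ.* suc k ℕ.* (2 ℕ.+ 12 ℕ.* (range ℕ.* M)))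
    codeAC with realiseAC (subtrees-dag codeTree) (root∈subtrees codeTree)
    ... | C , eq , le = C ,
      ( det⇐ C (subst (Every DetAt) (sym eq) (det-allOf 0 constraints))
      , wdec⇐ C (subst (Every WDecAt) (sym eq) (wdec-allOf 0 constraints))
      , mon⇐ C (subst (Every MonAt) (sym eq) (mon-allOf 0 constraints))) ,
      (λ a → trans (⟦⟧-eval C a) (cong (λ t → eval t a) eq)) ,
      ℕₚ.≤-trans le (size-codeTree (ℕₚ.*-mono-≤ (ℕₚ.*-mono-≤ 1≤M (ℕₚ.m^n>0 (suc points) k)) 1≤M))

  sD⋠dwD : sD-ACₘ ⋠ dwD-ACₘ
  sD⋠dwD le with ≼⇒simulates le
  ... | K , d , sim = ℕₚ.<-irrefl refl (exponential-gap K c (2 ℕ.* d) M 1≤M (begin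
      M ℕ.^ dim                          ≤⟨ code-size C′ (smooth⇒ C′ (proj₁ C′∈)) (dec⇒ C′ (proj₁ (proj₂ C′∈)))
                                            (mon⇒ C′ (proj₂ (proj₂ C′∈)))
                                            (λ a → trans (sym (⟦⟧-eval C′ a)) (trans (same a) (computes a))) ⟩
      size C′                          ≤⟨ C′≤ ⟩
      K ℕ.* size C ℕ.^ d               ≤⟨ ℕₚ.*-monoʳ-≤ K (ℕₚ.^-monoˡ-≤ d size≤) ⟩
      K ℕ.* ((c ℕ.* M) ℕ.^ 2) ℕ.^ d    ≡⟨ cong (K ℕ.*_) (ℕₚ.^-*-assoc (c ℕ.* M) 2 d) ⟩
      K ℕ.* (c ℕ.* M) ℕ.^ (2 ℕ.* d)    ∎))
    where
    open ℕₚ.≤-Reasoning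
    dim P E c M : ℕ
    -- The circuit for the code is quadratic in M, so the bound has degree 2d in M; a dimension one
    -- higher beats it.
    dim = suc (2 ℕ.* d)
    P = (dim ℕ.+ dim ℕ.+ dim) ℕ.* suc dim
    E = suc (dim ℕ.+ dim ℕ.+ dim) ℕ.^ dim
    c = suc (P ℕ.* (2 ℕ.+ 12 ℕ.* E))
    -- One more than `exponential-gap` permits; c depends on d only, so the choice is not circular.
    M = suc (K ℕ.* c ℕ.^ (2 ℕ.* d))
    1≤M : 1 ℕ.≤ M
    1≤M = ℕ.s≤s ℕ.z≤n
    open LowerBound dim M (ℕ.s≤s ℕ.z≤n) 1≤M
    C = proj₁ codeAC
    computes = proj₁ (proj₂ (proj₂ codeAC))
    S = sim C (proj₁ (proj₂ codeAC))
    C′ = proj₁ S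
    C′∈ = proj₁ (proj₂ S)
    same = proj₁ (proj₂ (proj₂ S))
    C′≤ = proj₂ (proj₂ (proj₂ S))
    bound : ∀ P E M .{{_ : ℕ.NonZero M}} → let c = suc (P ℕ.* (2 ℕ.+ 12 ℕ.* E)) in
            suc (P ℕ.* (2 ℕ.+ 12 ℕ.* (M ℕ.* E ℕ.* M))) ℕ.≤ (c ℕ.* M) ℕ.^ 2
    bound P E M = begin
      suc (P ℕ.* (2 ℕ.+ 12 ℕ.* (M ℕ.* E ℕ.* M)))
        ≤⟨ ℕₚ.+-mono-≤ (ℕₚ.*-mono-≤ (1≤ M) (1≤ M))
             (ℕₚ.*-monoʳ-≤ P (ℕₚ.+-monoˡ-≤ _ (ℕₚ.*-monoʳ-≤ 2 (ℕₚ.*-mono-≤ (1≤ M) (1≤ M))))) ⟩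
      M ℕ.* M ℕ.+ P ℕ.* (2 ℕ.* (M ℕ.* M) ℕ.+ 12 ℕ.* (M ℕ.* E ℕ.* M))
        ≡⟨ collect P E M ⟩
      c′ ℕ.* (M ℕ.* M)
        ≤⟨ ℕₚ.*-monoˡ-≤ (M ℕ.* M) (ℕₚ.m≤m*n c′ c′) ⟩
      c′ ℕ.* c′ ℕ.* (M ℕ.* M)
        ≡⟨ square c′ M ⟩
      (c′ ℕ.* M) ℕ.^ 2 ∎
      where
      c′ = suc (P ℕ.* (2 ℕ.+ 12 ℕ.* E))
      1≤ : ∀ M .{{_ : ℕ.NonZero M}} → 1 ℕ.≤ M
      1≤ (suc _) = ℕ.s≤s ℕ.z≤n
      open +-*-Solver
      collect : ∀ P E M → M ℕ.* M ℕ.+ P ℕ.* (2 ℕ.* (M ℕ.* M) ℕ.+ 12 ℕ.* (M ℕ.* E ℕ.* M)) ≡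
                          suc (P ℕ.* (2 ℕ.+ 12 ℕ.* E)) ℕ.* (M ℕ.* M)
      collect = solve 3 (λ P E M → M :* M :+ P :* (con 2 :* (M :* M) :+ con 12 :* (M :* E :* M)) :=
                                   (con 1 :+ P :* (con 2 :+ con 12 :* E)) :* (M :* M)) refl
      square : ∀ c M → c ℕ.* c ℕ.* (M ℕ.* M) ≡ (c ℕ.* M) ℕ.^ 2
      square = solve 2 (λ c M → c :* c :* (M :* M) := (c :* M) :* ((c :* M) :* con 1)) refl
    size≤ : size C ℕ.≤ (c ℕ.* M) ℕ.^ 2
    size≤ = ℕₚ.≤-trans (proj₂ (proj₂ (proj₂ codeAC))) (bound P E M)

  -- Inclusions of classes, and the remaining separations

  dec⇒wdec : ∀ C → Decomposable C → WeaklyDecomposable C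
  dec⇒wdec C d i l r at x p q _ = d i l r at x p q

  D≼sD : D-ACₘ ≼ sD-ACₘ
  D≼sD = ⊇⇒≼ λ C (s , d , m) → d , m

  wD≼D : wD-ACₘ ≼ D-ACₘ
  wD≼D = ⊇⇒≼ λ C (d , m) → dec⇒wdec C d , m

  wD≼dwD : wD-ACₘ ≼ dwD-ACₘ
  wD≼dwD = ⊇⇒≼ λ C → proj₂

  swD≼sD : swD-ACₘ ≼ sD-ACₘ
  swD≼sD = ⊇⇒≼ λ C (s , d , m) → s , dec⇒wdec C d , m

  D≼dD : D-ACₘ ≼ dD-ACₘ
  D≼dD = ⊇⇒≼ λ C → proj₂

  dwD≼dD : dwD-ACₘ ≼ dD-ACₘ
  dwD≼dD = ⊇⇒≼ λ C (e , d , m) → e , dec⇒wdec C d , m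

  dD≼sdD : dD-ACₘ ≼ sdD-ACₘ
  dD≼sdD = ⊇⇒≼ λ C → proj₂

  sdwD≼sdD : sdwD-ACₘ ≼ sdD-ACₘ
  sdwD≼sdD = ⊇⇒≼ λ C (s , e , d , m) → s , e , dec⇒wdec C d , m

  D⋠dwD : D-ACₘ ⋠ dwD-ACₘ
  D⋠dwD = sD⋠dwD ∘ ≼-trans sD≼D

  D≼swD : D-ACₘ ≼ swD-ACₘ
  D≼swD = ≼-trans D≼sD sD≼swD

  dD≼sdwD : dD-ACₘ ≼ sdwD-ACₘ
  dD≼sdwD = ≼-trans dD≼sdD sdD≼sdwD

  dD⋠D : dD-ACₘ ⋠ D-ACₘ
  dD⋠D = dwD⋠D ∘ ≼-trans dwD≼dD

  dD⋠dwD : dD-ACₘ ⋠ dwD-ACₘ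
  dD⋠dwD = D⋠dwD ∘ ≼-trans D≼dD

  D⋠wD : D-ACₘ ⋠ wD-ACₘ
  D⋠wD le = D⋠dwD (≼-trans le wD≼dwD)

theorem1 : (ℝ : RealField) → let open Circuits ℝ in
  -- (i)
  ((wD-ACₘ ≺ D-ACₘ) × (wD-ACₘ ≺ swD-ACₘ) × (wD-ACₘ ≺ dwD-ACₘ)) ×
  -- (ii)
  ((D-ACₘ ≃ sD-ACₘ) × (sD-ACₘ ≃ swD-ACₘ)) ×
  -- (iii)
  ((D-ACₘ ≺ dD-ACₘ) × (sD-ACₘ ≺ sdD-ACₘ) × (swD-ACₘ ≺ sdwD-ACₘ)) ×
  -- (iv)
  ((dwD-ACₘ ≺ dD-ACₘ) × (dwD-ACₘ ≺ sdwD-ACₘ)) ×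
  -- (v)
  ((dD-ACₘ ≃ sdD-ACₘ) × (sdD-ACₘ ≃ sdwD-ACₘ)) ×
  -- (vi)
  ((dwD-ACₘ ⋠ D-ACₘ) × (D-ACₘ ⋠ dwD-ACₘ))
theorem1 ℝ =
  ( (wD≼D , D⋠wD)
  , (≼-trans wD≼D D≼swD , λ le → D⋠wD (≼-trans D≼swD le))
  , (wD≼dwD , λ le → dwD⋠D (≼-trans le wD≼D)) ) ,
  ( (D≼sD , sD≼D) , (sD≼swD , swD≼sD) ) ,
  ( (D≼dD , dD⋠D)
  , (≼-trans sD≼D (≼-trans D≼dD dD≼sdD) , λ le → dD⋠D (≼-trans dD≼sdD (≼-trans le sD≼D)))
  , (≼-trans (≼-trans swD≼sD sD≼D) (≼-trans D≼dD dD≼sdwD) ,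
     λ le → dD⋠D (≼-trans dD≼sdwD (≼-trans le (≼-trans swD≼sD sD≼D)))) ) ,
  ( (dwD≼dD , dD⋠dwD)
  , (≼-trans dwD≼dD dD≼sdwD , λ le → dD⋠dwD (≼-trans dD≼sdwD le)) ) ,
  ( (dD≼sdD , sdD≼dD) , (sdD≼sdwD , sdwD≼sdD) ) ,
  ( dwD⋠D , D⋠dwD )
  where open Succinctness ℝ
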